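{- Let $$\mathcal{G}(t;x,u,v,q,z)=\sum_{n=1}^{\infty}t^n\sum_{\pi\in\mathfrak{S}_n}\frac{u^{\mathsf{des}(\pi)}x^{\mathsf{ides}(\pi)}q^{\mathsf{lmin}(\pi)}v^{\mathsf{rmax}(\pi)}z^{\mathsf{lmax}(\pi)}}{(1-u)^n(1-x)^n}.$$ Put $r=1-t$ and, for $n\ge 1$, $\mathcal{T}_n=r^{n-1}\,\mathcal{G}(t;xr^{n-1},u,v,1,1)$. The generating function $\mathcal{G}(t;x,u,v,1,z)$ of permutations counted by the quadruple $(\mathsf{des},\mathsf{ides},\mathsf{rmax},\mathsf{lmax})$ of Euler-Stirling statistics equals $$\mathcal{G}(t;x,u,v,1,z)=\sum_{n=1}^{\infty}\frac{ztv\,r^{n-1}(1+ux\,\mathcal{T}_n)}{u(xr^{n-1}-1)}\prod_{i=1}^{n-1}\frac{t(1-z)r^{i-1}+r^i-1}{u(r^i-1)}$$ $$\times\left(1-\sum_{n=1}^{\infty}\frac{t(z-1)r^{n-1}}{u(r^n-1)}\prod_{i=1}^{n-1}\frac{t(1-z)r^{i-1}+r^i-1}{u(r^i-1)}\right)^{ -1}.$$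
   Context: $\mathfrak{S}_n$ is the set of permutations $\pi=\pi_1\pi_2\cdots\pi_n$ of $[n]=\{1,\dots,n\}$. $\mathsf{des}(\pi)=|\{i\in[n-1]:\pi_i>\pi_{i+1}\}|$ is the number of descents; $\mathsf{ides}(\pi)=\mathsf{des}(\pi^{ -1})$ is the number of inverse descents; $\mathsf{lmax}(\pi)=|\{\pi_i:\pi_i>\pi_j\text{ for all }j<i\}|$ is the number of left-to-right maxima; $\mathsf{lmin}(\pi)=|\{\pi_i:\pi_i<\pi_j\text{ for all }j<i\}|$ is the number of left-to-right minima; $\mathsf{rmax}(\pi)=|\{\pi_i:\pi_i>\pi_j\text{ for all }j>i\}|$ is the number of right-to-left maxima. A statistic is called Eulerian (respectively Stirling) if its distribution over permutations is given by the Eulerian numbers (respectively the signless Stirling numbers of the first kind); $\mathsf{des},\mathsf{ides}$ are Eulerian and $\mathsf{lmax},\mathsf{lmin},\mathsf{rmax}$ are Stirling. Empty products equal $1$. The series $\mathcal{G}(t;x,u,v,1,1)$ entering $\mathcal{T}_n$ (with $x$ replaced by $xr^{n-1}$) is given by either of the two equivalent forms $$\mathcal{G}(t;x,u,v,1,1)=\sum_{m=1}^{\infty}\frac{vtu^{m-1}}{(1-t)^m-x}\prod_{i=1}^{m-1}\frac{x-(1-t)^i-xvt}{x-(1-t)^i}=\sum_{m=1}^{\infty}\frac{vt(1-t)^{m-1}}{u^{m}(x(1-t)^{m-1}-1)}\prod_{i=1}^{m}\frac{1-x(1-t)^{i-1}}{x(1-t)^{i-1}(vt-1)+1}.$$ 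-}

module Defs where

open import Algebra.Bundles using (RawRing)
import Algebra.Definitions.RawSemiring as RawSemiringDefinitions
open import Data.Bool.Base using (if_then_else_)
open import Data.Fin.Base as Fin using (Fin; zero; suc; inject₁)
open import Data.Fin.Patterns using (0F; 1F; 2F; 3F; 4F)
open import Data.Fin.Permutation using (Permutation′; _⟨$⟩ʳ_; id; flip; insert)
open import Data.Fin.Properties as Fin using (all?)
open import Data.List.Base as List
  using (List; []; _∷_; allFin; cartesianProductWith; filter; foldr; length; upTo)
open import Data.Nat.Base as ℕ using (ℕ; zero; suc; _∸_)
import Data.Nat.Properties as ℕ
open import Data.Rational.Base as ℚ using (ℚ; 0ℚ; 1ℚ)
import Data.Rational.Properties as ℚ
open import Data.Vec.Base as Vec using (Vec; []; _∷_; replicate; updateAt; zipWith; _[_]≔_)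
import Data.Vec.Properties as Vec
open import Level using (0ℓ)
open import Relation.Binary.PropositionalEquality.Core using (_≡_)
open import Relation.Nullary.Decidable.Core using (yes; no; does; _→-dec_)
open import Relation.Unary using (Decidable)

------------------------------------------------------------------------
-- Permutations and their statistics

-- The word of π is  π ⟨$⟩ʳ 0, π ⟨$⟩ʳ 1, … .  Each π ∈ 𝔖ₙ₊₁ arises exactly once
-- from its first letter j and the relative order of its remaining letters.
𝔖 : ∀ n → List (Permutation′ n)
𝔖 zero    = id ∷ []
𝔖 (suc n) = cartesianProductWith (insert zero) (allFin (suc n)) (𝔖 n)

count : ∀ {n} {P : Fin n → Set} → Decidable P → ℕ
count {n} P? = length (filter P? (allFin n))

des : ∀ {n} → Permutation′ n → ℕ
des {zero}  π = 0
des {suc n} π = count {n} λ i → (π ⟨$⟩ʳ suc i) Fin.<? (π ⟨$⟩ʳ inject₁ i)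

ides : ∀ {n} → Permutation′ n → ℕ
ides π = des (flip π)

-- Distinct positions carry distinct letters, so counting positions is
-- counting letters.
lmax lmin rmax : ∀ {n} → Permutation′ n → ℕ
lmax π = count λ i → all? λ j → (j Fin.<? i) →-dec ((π ⟨$⟩ʳ j) Fin.<? (π ⟨$⟩ʳ i))
lmin π = count λ i → all? λ j → (j Fin.<? i) →-dec ((π ⟨$⟩ʳ i) Fin.<? (π ⟨$⟩ʳ j))
rmax π = count λ i → all? λ j → (i Fin.<? j) →-dec ((π ⟨$⟩ʳ j) Fin.<? (π ⟨$⟩ʳ i))

------------------------------------------------------------------------
-- Formal power series over ℚ in the indeterminates t, u⁻¹, x, v, z
--
-- The infinite sums below have n-th term of order u⁻ⁿ and diverge u-adically,
-- so rational functions of u are expanded at u = ∞.  Rational functions of x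
-- are expanded at x = 0.  Both expansions are injective.

Monomial : Set
Monomial = Vec ℕ 5

Series : Set
Series = Monomial → ℚ

-- The exponent vectors β ≤ α.
divisors : ∀ {k} → Vec ℕ k → List (Vec ℕ k)
divisors []      = [] ∷ []
divisors (a ∷ α) = cartesianProductWith _∷_ (upTo (suc a)) (divisors α)

1ₘ : Monomial
1ₘ = replicate 5 0

constant : ℚ → Series
constant c α = if does (Vec.≡-dec ℕ._≟_ α 1ₘ) then c else 0ℚ

var : Fin 5 → Series
var i α = if does (Vec.≡-dec ℕ._≟_ α (1ₘ [ i ]≔ 1)) then 1ℚ else 0ℚ

seriesRawRing : RawRing 0ℓ 0ℓ
seriesRawRing = record
  { Carrier = Series
  ; _≈_     = λ f g → ∀ α → f α ≡ g α
  ; _+_     = λ f g α → f α ℚ.+ g α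
  ; _*_     = λ f g α →
      foldr (λ β s → f β ℚ.* g (zipWith _∸_ α β) ℚ.+ s) 0ℚ (divisors α)
  ; -_      = λ f α → ℚ.- f α
  ; 0#      = constant 0ℚ
  ; 1#      = constant 1ℚ
  }

open RawRing seriesRawRing public using (_≈_; _+_; _*_; -_; 0#; 1#)
open RawSemiringDefinitions (RawRing.rawSemiring seriesRawRing) public using (_^_)

infixl 6 _-_
_-_ : Series → Series → Series
f - g = f + (- g)

t u⁻¹ x v z r : Series
t   = var 0F
u⁻¹ = var 1F
x   = var 2F
v   = var 3F
z   = var 4F
r   = 1# - t

∑[_] : ∀ {A : Set} → List A → (A → Series) → Series
∑[ as ] f = foldr (λ a s → f a + s) 0# as

-- ∑[1⋯ n ] f = f 1 + ⋯ + f n  and  ∏[1⋯ n ] f = f 1 * ⋯ * f n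
∑[1⋯_] ∏[1⋯_] : ℕ → (ℕ → Series) → Series
∑[1⋯ zero  ] f = 0#
∑[1⋯ suc n ] f = ∑[1⋯ n ] f + f (suc n)
∏[1⋯ zero  ] f = 1#
∏[1⋯ suc n ] f = ∏[1⋯ n ] f * f (suc n)

-- The sum of f n over all n ≥ 1, for f n with no monomials of total degree
-- below n: only the terms n ≤ deg α then contribute to the coefficient of α.
-- Every use below has f n divisible by tⁿ or by (u⁻¹)ⁿ.
∑₁∞ : (ℕ → Series) → Series
∑₁∞ f α = (∑[1⋯ Vec.sum α ] f) α

-- Total, with recip 0ℚ = 0ℚ; used at nonzero arguments only.
recip : ℚ → ℚ
recip p with p ℚ.≟ 0ℚ
... | yes _  = 0ℚ
... | no p≢0 = ℚ.1/_ p {{ℚ.≢-nonZero p≢0}}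

-- The inverse of a series with constant term c ≢ 0ℚ:  with g = f / c it is
-- (1 / c) ∑ₖ (1 - g)ᵏ, and (1 - g)ᵏ has no monomials of degree below k.
-- The constant terms inverted below are 1, -1 and (for (rⁱ - 1) / t) -i.
inv : Series → Series
inv f α = (c⁻¹ * (1# + ∑[1⋯ Vec.sum α ] λ k → (1# - c⁻¹ * f) ^ k)) α
  where
  c⁻¹ : Series
  c⁻¹ = constant (recip (f 1ₘ))

-- The quotient by an indeterminate, for series divisible by it.
_/var_ : Series → Fin 5 → Series
(f /var i) α = f (updateAt α i suc)

-- Multiplication by u, for series divisible by u⁻¹.
infix 9 u·_
u·_ : Series → Series
u· f = f /var 1F

-- f / g for f and g both divisible by t, with g / t invertible.
infixl 7 _/ₜ_
_/ₜ_ : Series → Series → Series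
f /ₜ g = (f /var 0F) * inv (g /var 0F)

------------------------------------------------------------------------
-- The generating function

-- 𝒢(t; X, u, V, Q, Z).  Expanded in u⁻¹,
--   u^des / (1 - u)ⁿ = (u⁻¹)^(n - des) / (u⁻¹ - 1)ⁿ,
-- where des < n, so that every term is divisible by u⁻¹.
𝒢 : (X V Q Z : Series) → Series
𝒢 X V Q Z = ∑₁∞ λ n → t ^ n * ∑[ 𝔖 n ] λ π →
  (u⁻¹ ^ (n ∸ des π) * X ^ ides π * Q ^ lmin π * V ^ rmax π * Z ^ lmax π)
    * inv ((u⁻¹ - 1#) ^ n * (1# - X) ^ n)

𝒯 : ℕ → Series
𝒯 n = r ^ (n ∸ 1) * 𝒢 (x * r ^ (n ∸ 1)) v 1# 1#

module Submission where

-- With w = u⁻¹ and s = t / (w - 1), let E v z l be the sum of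
-- sⁿ w^(n - des) v^rmax z^lmax over the words of length n ≥ 0 in l letters.
-- Since x^ides / (1 - x)ⁿ⁺¹ counts P-partitions, standardization of words gives
--   𝒢(t; x, u, v, 1, z) = ∑ₗ xˡ (E v z (l + 1) - E v z l).
-- Splitting a word at the last occurrence of its largest letter shows
--   E v z (l + 1) - E v z l = s v z · E 1 z (l + 1) · B l,  B l = w - 1 + E v 1 l.
-- For v = z = 1 the solution is E 1 1 l = (1 - w) / (1 - w rˡ), which turns the
-- case v = 1 into the linear recursion
--   E 1 z (l + 1) · (1 - (1 - t z) w rˡ) = E 1 z l · (1 - w rˡ).
-- Let Pₙ be the product of the theorem with n factors.  By the q-binomial theorem
-- the series Sₗ = ∑ₙ rⁿˡ Pₙ satisfies the same recursion, so E 1 z l · S₀ = Sₗ,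
-- and the denominator of the theorem is (1 - w) S₀.  In its numerator,
-- (1 + u x 𝒯ₙ) / (u (x rⁿ⁻¹ - 1)) = - ∑ₗ (x rⁿ⁻¹)ˡ B l, because ∑ₗ Xˡ (B (l + 1) - B l)
-- is 𝒢(t; X, u, v, 1, 1).  Every identity is proved modulo each total degree,
-- where the infinite sums become finite and the indeterminates nilpotent.

open import Algebra.Bundles using (CommutativeRing)
import Algebra.Properties.AbelianGroup
import Algebra.Properties.CommutativeSemigroup
import Algebra.Properties.CommutativeSemiring.Exp
import Algebra.Properties.Ring
import Algebra.Properties.Semiring.Mult.TCOptimised
import Algebra.Solver.Ring
open import Algebra.Solver.Ring.AlmostCommutativeRing
  using (fromCommutativeRing; _-Raw-AlmostCommutative⟶_)
open import Data.Bool.Base using (Bool; true; false; if_then_else_; _∧_; not)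
import Data.Bool.Properties as Bool
open import Data.Fin.Base as Fin using (Fin; zero; suc; toℕ; punchIn; inject₁)
open import Data.Fin.Patterns using (0F; 1F; 2F; 3F; 4F)
open import Data.Fin.Permutation as Perm using (Permutation′; _⟨$⟩ʳ_; _⟨$⟩ˡ_; insert)
import Data.Fin.Properties as Fin
open import Data.Integer.Base as ℤ using (ℤ; -[1+_]; 0ℤ)
import Data.Integer.Properties as ℤ
open import Data.List.Base as List using (List; []; _∷_; _++_; allFin; filter; foldr; length)
import Data.List.Properties as List
open import Data.List.Relation.Unary.All as All using (All; []; _∷_)
import Data.List.Relation.Unary.All.Properties as All
import Data.Maybe.Base as Maybe
open import Data.Nat.Base as ℕ using (ℕ; zero; suc; _∸_; _≤_; _<_; _⊔_; z≤n; s≤s; z<s; s<s)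
import Data.Nat.Properties as ℕ
open import Data.Product.Base using (_×_; _,_; proj₁)
open import Data.Rational.Base as ℚ using (ℚ; 0ℚ; 1ℚ)
import Data.Rational.Properties as ℚ
open import Data.Sign.Base as Sign using (Sign)
open import Data.Sum.Base using (_⊎_; inj₁; inj₂)
open import Data.Vec.Base as Vec
  using (Vec; []; _∷_; insertAt; lookup; replicate; tabulate; toList; updateAt; zip; zipWith; _[_]≔_)
import Data.Vec.Properties as Vec
open import Data.Vec.Relation.Unary.All as Vecᴬ using ([]; _∷_)
import Data.Vec.Relation.Unary.All.Properties as Vecᴬ
open import Function.Base using (_∘_; case_of_)
open import Function.Bundles using (mk⇔)
open import Level using (0ℓ)
open import Relation.Binary.Definitions using (tri<; tri≈; tri>)
open import Relation.Binary.PropositionalEquality as ≡ using (_≡_; _≢_; cong; cong₂)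
import Relation.Binary.Reasoning.Setoid
open import Relation.Nullary.Decidable as Dec
  using (Dec; yes; no; does; dec-true; dec-false; dec⇒maybe; does-⇔; _⊎-dec_; _×-dec_; _→-dec_)
open import Relation.Nullary.Negation using (¬_; contradiction)
open import Relation.Unary using (Decidable)

open import Defs using (𝔖; count; des; ides; lmin; lmax; rmax)

-- Sums and convolutions in commutative rings

-- The last occurrence of the largest letter separates the two kinds of maxima: strict right-to-left
-- maxima occur only from that letter on, weak left-to-right maxima only up to it. Hence one factor
-- of the splitting carries `z` alone and the other `v` alone, and the case of general `v` and `z`
-- reduces to cases in which one of them is 1. The obstacle is division. Besides dividing by units,
-- the theorem divides by `r ^ n - 1#`, which is only a unit times `t`, and it multiplies by `u`,
-- that is, divides by `u⁻¹`. Both quotients shift coefficients and cost one degree of precision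
-- modulo a total degree. The combinatorics and the functional equations are therefore developed
-- over an arbitrary commutative ring with nilpotent elements, where each quotient enters only
-- through the multiplicative equation that it satisfies. Series appear only where these equations
-- are checked.

module IntegerSolver (R : CommutativeRing 0ℓ 0ℓ) where
  open CommutativeRing R
  open Algebra.Properties.Ring ring using (-‿distribˡ-*; -‿distribʳ-*; -0#≈0#)
  open Algebra.Properties.AbelianGroup +-abelianGroup using (⁻¹-∙-comm; ⁻¹-involutive)
  open Algebra.Properties.Semiring.Mult.TCOptimised semiring
    using (×-homo-+; ×1-homo-*; 1+×) renaming (_×_ to _·_)
  open Relation.Binary.Reasoning.Setoid setoid

  -- The canonical ring homomorphism. The solver has to compare coefficients, and equality in `R` is
  -- not decidable; equality in ℤ is.
  ⟦_⟧ᵢ : ℤ → Carrier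
  ⟦ ℤ.+ n    ⟧ᵢ = n · 1#
  ⟦ -[1+ n ] ⟧ᵢ = - (suc n · 1#)

  neg-homo : ∀ i → ⟦ ℤ.- i ⟧ᵢ ≈ - ⟦ i ⟧ᵢ
  neg-homo (ℤ.+ zero)  = sym -0#≈0#
  neg-homo (ℤ.+ suc n) = refl
  neg-homo -[1+ n ]    = sym (⁻¹-involutive _)

  ⊖-homo : ∀ m n → ⟦ m ℤ.⊖ n ⟧ᵢ ≈ m · 1# - n · 1#
  ⊖-homo zero    zero    = sym (-‿inverseʳ 0#)
  ⊖-homo zero    (suc n) = sym (+-identityˡ _)
  ⊖-homo (suc m) zero    = sym (trans (+-congˡ -0#≈0#) (+-identityʳ _))
  ⊖-homo (suc m) (suc n) = begin
    ⟦ suc m ℤ.⊖ suc n ⟧ᵢ                    ≡⟨ ≡.cong ⟦_⟧ᵢ (ℤ.[1+m]⊖[1+n]≡m⊖n m n) ⟩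
    ⟦ m ℤ.⊖ n ⟧ᵢ                            ≈⟨ ⊖-homo m n ⟩
    m · 1# - n · 1#                         ≈⟨ +-congʳ (+-identityˡ _) ⟨
    0# + m · 1# - n · 1#                    ≈⟨ +-congʳ (+-congʳ (-‿inverseʳ 1#)) ⟨
    1# - 1# + m · 1# - n · 1#               ≈⟨ +-congʳ (+-assoc _ _ _) ⟩
    1# + (- 1# + m · 1#) - n · 1#           ≈⟨ +-congʳ (+-congˡ (+-comm _ _)) ⟩
    1# + (m · 1# - 1#) - n · 1#             ≈⟨ +-congʳ (+-assoc _ _ _) ⟨
    1# + m · 1# - 1# - n · 1#               ≈⟨ +-assoc _ _ _ ⟩
    1# + m · 1# + (- 1# - n · 1#)           ≈⟨ +-congˡ (⁻¹-∙-comm _ _) ⟩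
    1# + m · 1# - (1# + n · 1#)             ≈⟨ +-cong (1+× m 1#) (-‿cong (1+× n 1#)) ⟨
    suc m · 1# - suc n · 1#                 ∎

  +-homo : ∀ i j → ⟦ i ℤ.+ j ⟧ᵢ ≈ ⟦ i ⟧ᵢ + ⟦ j ⟧ᵢ
  +-homo (ℤ.+ m)  (ℤ.+ n)  = ×-homo-+ 1# m n
  +-homo (ℤ.+ m)  -[1+ n ] = ⊖-homo m (suc n)
  +-homo -[1+ m ] (ℤ.+ n)  = trans (⊖-homo n (suc m)) (+-comm _ _)
  +-homo -[1+ m ] -[1+ n ] = begin
    - (suc (suc (m ℕ.+ n)) · 1#)       ≡⟨ ≡.cong (λ k → - (k · 1#)) (≡.sym (≡.cong suc (ℕ.+-suc m n))) ⟩
    - ((suc m ℕ.+ suc n) · 1#)         ≈⟨ -‿cong (×-homo-+ 1# (suc m) (suc n)) ⟩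
    - (suc m · 1# + suc n · 1#)        ≈⟨ ⁻¹-∙-comm _ _ ⟨
    - (suc m · 1#) - suc n · 1#        ∎

  +◃-homo : ∀ n → ⟦ Sign.+ ℤ.◃ n ⟧ᵢ ≈ n · 1#
  +◃-homo n = reflexive (≡.cong ⟦_⟧ᵢ (ℤ.+◃n≡+n n))

  -◃-homo : ∀ n → ⟦ Sign.- ℤ.◃ n ⟧ᵢ ≈ - (n · 1#)
  -◃-homo n = trans (reflexive (≡.cong ⟦_⟧ᵢ (ℤ.-◃n≡-n n))) (neg-homo (ℤ.+ n))

  *-homo : ∀ i j → ⟦ i ℤ.* j ⟧ᵢ ≈ ⟦ i ⟧ᵢ * ⟦ j ⟧ᵢ
  *-homo (ℤ.+ m)  (ℤ.+ n)  = trans (+◃-homo (m ℕ.* n)) (×1-homo-* m n)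
  *-homo (ℤ.+ m)  -[1+ n ] = trans (-◃-homo (m ℕ.* suc n))
    (trans (-‿cong (×1-homo-* m (suc n))) (-‿distribʳ-* _ _))
  *-homo -[1+ m ] (ℤ.+ n)  = trans (-◃-homo (suc m ℕ.* n))
    (trans (-‿cong (×1-homo-* (suc m) n)) (-‿distribˡ-* _ _))
  *-homo -[1+ m ] -[1+ n ] = begin
    (suc m ℕ.* suc n) · 1#                ≈⟨ ×1-homo-* (suc m) (suc n) ⟩
    suc m · 1# * suc n · 1#               ≈⟨ ⁻¹-involutive _ ⟨
    - - (suc m · 1# * suc n · 1#)         ≈⟨ -‿cong (-‿distribˡ-* _ _) ⟩
    - (- (suc m · 1#) * suc n · 1#)       ≈⟨ -‿distribʳ-* _ _ ⟩
    - (suc m · 1#) * - (suc n · 1#)       ∎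

  morphism : ℤ.+-*-rawRing -Raw-AlmostCommutative⟶ fromCommutativeRing R
  morphism = record
    { ⟦_⟧    = ⟦_⟧ᵢ
    ; +-homo = +-homo
    ; *-homo = *-homo
    ; -‿homo = neg-homo
    ; 0-homo = refl
    ; 1-homo = refl
    }

  open Algebra.Solver.Ring ℤ.+-*-rawRing (fromCommutativeRing R) morphism
    (λ i j → Maybe.map (λ i≡j → reflexive (≡.cong ⟦_⟧ᵢ i≡j)) (dec⇒maybe (i ℤ.≟ j)))
    public using (solve; _:=_; con; _:+_; _:*_; _:-_; :-_; Polynomial)

  :1 : ∀ {n} → Polynomial n
  :1 = con (ℤ.+ 1)

module RingIdentities (R : CommutativeRing 0ℓ 0ℓ) where
  open CommutativeRing R
  open IntegerSolver R
  open Relation.Binary.Reasoning.Setoid setoid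

  geometric-zero : ∀ y → (1# - y) * (1# + 0#) + y * 1# ≈ 1#
  geometric-zero = solve 1 (λ y → (:1 :- y) :* (:1 :+ con (ℤ.+ 0)) :+ y :* :1 := :1) refl

  geometric-suc : ∀ y s p → (1# - y) * (1# + s) + p ≈ 1# → (1# - y) * (1# + (s + p)) + y * p ≈ 1#
  geometric-suc y s p = trans
    (solve 3 (λ y s p → (:1 :- y) :* (:1 :+ (s :+ p)) :+ y :* p := (:1 :- y) :* (:1 :+ s) :+ p) refl y s p)

  -- Here `s` stands for a partial sum of the powers of `y = 1# - c * f` and `p` for the next power.
  -- The telescoped sum says that `c * (1# + s)` inverts `f` up to the remainder `p`.
  geometric-inverse : ∀ c f s p → (1# - (1# - c * f)) * (1# + s) + p ≈ 1# → p ≈ 0# → c * (1# + s) * f ≈ 1#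
  geometric-inverse c f s p sum≈1 p≈0 = begin
    c * (1# + s) * f
      ≈⟨ solve 4 (λ c f s p → c :* (:1 :+ s) :* f := (:1 :- (:1 :- c :* f)) :* (:1 :+ s) :+ p :- p) refl c f s p ⟩
    (1# - (1# - c * f)) * (1# + s) + p - p
      ≈⟨ +-cong sum≈1 (-‿cong p≈0) ⟩
    1# - 0#
      ≈⟨ solve 0 (:1 :- con (ℤ.+ 0) := :1) refl ⟩
    1#
      ∎

  split-difference : ∀ a f g → a * f ≈ a * g + a * (f - g)
  split-difference = solve 3 (λ a f g → a :* f := a :* g :+ a :* (f :- g)) refl

module Sums (R : CommutativeRing 0ℓ 0ℓ) where
  open CommutativeRing R
  open Algebra.Properties.CommutativeSemigroup +-commutativeSemigroup using (interchange)
  open Relation.Binary.Reasoning.Setoid setoid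

  private
    A : Set
    A = Carrier

  sum< : ℕ → (ℕ → A) → A
  sum< zero    f = 0#
  sum< (suc n) f = sum< n f + f n

  sum<-cong : ∀ n {f g} → (∀ {i} → i < n → f i ≈ g i) → sum< n f ≈ sum< n g
  sum<-cong zero    f≈g = refl
  sum<-cong (suc n) f≈g = +-cong (sum<-cong n λ i<n → f≈g (ℕ.m<n⇒m<1+n i<n)) (f≈g ℕ.≤-refl)

  sum<-zero : ∀ n {f} → (∀ {i} → i < n → f i ≈ 0#) → sum< n f ≈ 0#
  sum<-zero zero    f≈0 = refl
  sum<-zero (suc n) f≈0 = trans
    (+-cong (sum<-zero n λ i<n → f≈0 (ℕ.m<n⇒m<1+n i<n)) (f≈0 ℕ.≤-refl)) (+-identityˡ 0#)

  sum<-+ : ∀ n f g → sum< n (λ i → f i + g i) ≈ sum< n f + sum< n g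
  sum<-+ zero    f g = sym (+-identityˡ 0#)
  sum<-+ (suc n) f g = trans (+-congʳ (sum<-+ n f g)) (interchange _ _ _ _)

  sum<-*ˡ : ∀ n a f → a * sum< n f ≈ sum< n (λ i → a * f i)
  sum<-*ˡ zero    a f = zeroʳ a
  sum<-*ˡ (suc n) a f = trans (distribˡ a _ _) (+-congʳ (sum<-*ˡ n a f))

  sum<-*ʳ : ∀ n a f → sum< n f * a ≈ sum< n (λ i → f i * a)
  sum<-*ʳ n a f = trans (*-comm _ a)
    (trans (sum<-*ˡ n a f) (sum<-cong n λ _ → *-comm a _))

  sum<-suc : ∀ n f → sum< (suc n) f ≈ f 0 + sum< n (f ∘ suc)
  sum<-suc zero    f = +-comm 0# _
  sum<-suc (suc n) f = trans (+-congʳ (sum<-suc n f)) (+-assoc _ _ _)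

  sum<-swap : ∀ m n (f : ℕ → ℕ → A) →
    sum< m (λ i → sum< n (f i)) ≈ sum< n (λ j → sum< m (λ i → f i j))
  sum<-swap zero    n f = sym (sum<-zero n λ _ → refl)
  sum<-swap (suc m) n f = trans (+-congʳ (sum<-swap m n f)) (sym (sum<-+ n _ _))

  sum<-extend : ∀ m n f → (∀ j → f (m ℕ.+ j) ≈ 0#) → sum< (m ℕ.+ n) f ≈ sum< m f
  sum<-extend m zero    f f≈0 = reflexive (≡.cong (λ k → sum< k f) (ℕ.+-identityʳ m))
  sum<-extend m (suc n) f f≈0 = begin
    sum< (m ℕ.+ suc n) f             ≡⟨ ≡.cong (λ k → sum< k f) (ℕ.+-suc m n) ⟩
    sum< (m ℕ.+ n) f + f (m ℕ.+ n)   ≈⟨ +-cong (sum<-extend m n f f≈0) (f≈0 n) ⟩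
    sum< m f + 0#                    ≈⟨ +-identityʳ _ ⟩
    sum< m f                         ∎

  sumL : ∀ {B : Set} → List B → (B → A) → A
  sumL bs f = foldr (λ b s → f b + s) 0# bs

  module _ {B : Set} where

    sumL-cong : ∀ (bs : List B) {f g} → (∀ b → f b ≈ g b) → sumL bs f ≈ sumL bs g
    sumL-cong []       f≈g = refl
    sumL-cong (b ∷ bs) f≈g = +-cong (f≈g b) (sumL-cong bs f≈g)

    sumL-zero : ∀ (bs : List B) → sumL bs (λ _ → 0#) ≈ 0#
    sumL-zero []       = refl
    sumL-zero (b ∷ bs) = trans (+-identityˡ _) (sumL-zero bs)

    sumL-+ : ∀ (bs : List B) f g → sumL bs (λ b → f b + g b) ≈ sumL bs f + sumL bs g
    sumL-+ []       f g = sym (+-identityˡ 0#)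
    sumL-+ (b ∷ bs) f g = trans (+-congˡ (sumL-+ bs f g)) (interchange _ _ _ _)

    sumL-*ˡ : ∀ (bs : List B) a f → a * sumL bs f ≈ sumL bs (λ b → a * f b)
    sumL-*ˡ []       a f = zeroʳ a
    sumL-*ˡ (b ∷ bs) a f = trans (distribˡ a _ _) (+-congˡ (sumL-*ˡ bs a f))

    sumL-++ : ∀ (bs cs : List B) f → sumL (bs List.++ cs) f ≈ sumL bs f + sumL cs f
    sumL-++ []       cs f = sym (+-identityˡ _)
    sumL-++ (b ∷ bs) cs f = trans (+-congˡ (sumL-++ bs cs f)) (sym (+-assoc _ _ _))

    sum<-sumL : ∀ n (bs : List B) (f : ℕ → B → A) →
      sum< n (λ i → sumL bs (f i)) ≈ sumL bs (λ b → sum< n (λ i → f i b))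
    sum<-sumL zero    bs f = sym (sumL-zero bs)
    sum<-sumL (suc n) bs f = trans (+-congʳ (sum<-sumL n bs f)) (sym (sumL-+ bs _ _))

  sumL-map : ∀ {B C : Set} (g : C → B) (cs : List C) f → sumL (List.map g cs) f ≈ sumL cs (f ∘ g)
  sumL-map g []       f = refl
  sumL-map g (c ∷ cs) f = +-congˡ (sumL-map g cs f)

  module _ {B C : Set} where

    sumL-swap : ∀ (bs : List B) (cs : List C) (f : B → C → A) →
      sumL bs (λ b → sumL cs (f b)) ≈ sumL cs (λ c → sumL bs (λ b → f b c))
    sumL-swap []       []       f = refl
    sumL-swap []       (c ∷ cs) f = trans (sumL-swap [] cs f) (sym (+-identityˡ _))
    sumL-swap (b ∷ bs) cs       f = trans (+-congˡ (sumL-swap bs cs f)) (sym (sumL-+ cs _ _))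

    sumL-cartesianProductWith : ∀ {D : Set} (g : C → D → B) (cs : List C) (ds : List D) f →
      sumL (List.cartesianProductWith g cs ds) f ≈ sumL cs (λ c → sumL ds (λ d → f (g c d)))
    sumL-cartesianProductWith g []       ds f = refl
    sumL-cartesianProductWith g (c ∷ cs) ds f = trans (sumL-++ (List.map (g c) ds) _ f)
      (+-cong (sumL-map (g c) ds f) (sumL-cartesianProductWith g cs ds f))

  -- conv n H is the sum of H i j over i + j = n.
  conv : ℕ → (ℕ → ℕ → A) → A
  conv zero    H = H 0 0
  conv (suc n) H = H 0 (suc n) + conv n (H ∘ suc)

  conv-cong : ∀ n {H K} → (∀ {i j} → i ℕ.+ j ≡ n → H i j ≈ K i j) → conv n H ≈ conv n K
  conv-cong zero    H≈K = H≈K ≡.refl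
  conv-cong (suc n) H≈K = +-cong (H≈K ≡.refl) (conv-cong n λ i+j≡n → H≈K (≡.cong suc i+j≡n))

  conv-+ : ∀ n H K → conv n (λ i j → H i j + K i j) ≈ conv n H + conv n K
  conv-+ zero    H K = refl
  conv-+ (suc n) H K = trans (+-congˡ (conv-+ n _ _)) (interchange _ _ _ _)

  conv-*ˡ : ∀ n a H → a * conv n H ≈ conv n (λ i j → a * H i j)
  conv-*ˡ zero    a H = refl
  conv-*ˡ (suc n) a H = trans (distribˡ a _ _) (+-congˡ (conv-*ˡ n a _))

  conv-zero : ∀ n → conv n (λ _ _ → 0#) ≈ 0#
  conv-zero zero    = refl
  conv-zero (suc n) = trans (+-identityˡ _) (conv-zero n)

  conv-last : ∀ n H → conv (suc n) H ≈ conv n (λ i j → H i (suc j)) + H (suc n) 0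
  conv-last zero    H = refl
  conv-last (suc n) H = trans (+-congˡ (conv-last n (H ∘ suc))) (sym (+-assoc _ _ _))

  conv-comm : ∀ n H → conv n H ≈ conv n (λ i j → H j i)
  conv-comm zero    H = refl
  conv-comm (suc n) H = trans (+-congˡ (conv-comm n (H ∘ suc)))
    (trans (+-comm _ _) (sym (conv-last n (λ i j → H j i))))

  conv-assoc : ∀ n (H : ℕ → ℕ → ℕ → A) →
    conv n (λ i k → conv i (λ p q → H p q k)) ≈ conv n (λ p m → conv m (H p))
  conv-assoc zero    H = refl
  conv-assoc (suc n) H = begin
    H 0 0 (suc n) + conv n (λ i k → H 0 (suc i) k + conv i (λ p q → H (suc p) q k))
      ≈⟨ +-congˡ (conv-+ n _ _) ⟩
    H 0 0 (suc n) + (conv n (H 0 ∘ suc) + conv n (λ i k → conv i (λ p q → H (suc p) q k)))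
      ≈⟨ +-assoc _ _ _ ⟨
    conv (suc n) (H 0) + conv n (λ i k → conv i (λ p q → H (suc p) q k))
      ≈⟨ +-congˡ (conv-assoc n (H ∘ suc)) ⟩
    conv (suc n) (H 0) + conv n (λ p m → conv m (H (suc p)))
      ∎

  sum<-conv : ∀ n H → sum< n (λ m → conv m H) ≈ sum< n (λ i → sum< (n ∸ i) (H i))
  sum<-conv zero    H = refl
  sum<-conv (suc n) H = begin
    sum< (suc n) (λ m → conv m H)
      ≈⟨ sum<-suc n _ ⟩
    H 0 0 + sum< n (λ m → H 0 (suc m) + conv m (H ∘ suc))
      ≈⟨ +-congˡ (sum<-+ n _ _) ⟩
    H 0 0 + (sum< n (H 0 ∘ suc) + sum< n (λ m → conv m (H ∘ suc)))
      ≈⟨ +-assoc _ _ _ ⟨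
    H 0 0 + sum< n (H 0 ∘ suc) + sum< n (λ m → conv m (H ∘ suc))
      ≈⟨ +-cong (sum<-suc n (H 0)) (sym (sum<-conv n (H ∘ suc))) ⟨
    sum< (suc n) (H 0) + sum< n (λ i → sum< (n ∸ i) (H (suc i)))
      ≈⟨ sum<-suc n _ ⟨
    sum< (suc n) (λ i → sum< (suc n ∸ i) (H i))
      ∎

  sum<-antidiagonal : ∀ n (H : ℕ → ℕ → A) → sum< (suc n) (λ i → H i (n ∸ i)) ≈ conv n H
  sum<-antidiagonal zero    H = +-identityˡ _
  sum<-antidiagonal (suc n) H = trans (sum<-suc (suc n) _)
    (+-congˡ (sum<-antidiagonal n (H ∘ suc)))

  sumL-applyUpTo : ∀ n {B : Set} (g : ℕ → B) f → sumL (List.applyUpTo g n) f ≈ sum< n (f ∘ g)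
  sumL-applyUpTo zero    g f = refl
  sumL-applyUpTo (suc n) g f = trans (+-congˡ (sumL-applyUpTo n (g ∘ suc) f))
    (sym (sum<-suc n (f ∘ g)))

  conv-swap : ∀ m n (H : ℕ → ℕ → ℕ → ℕ → A) →
    conv m (λ i j → conv n (H i j)) ≈ conv n (λ k l → conv m (λ i j → H i j k l))
  conv-swap zero    n H = refl
  conv-swap (suc m) n H = trans (+-congˡ (conv-swap m n (H ∘ suc))) (sym (conv-+ n _ _))

  conv-single : ∀ e n {H} → (∀ {i j} → i ≢ e → H i j ≈ 0#) → conv (e ℕ.+ n) H ≈ H e n
  conv-single zero    zero    H≈0 = refl
  conv-single zero    (suc n) H≈0 = trans
    (+-congˡ (trans (conv-cong n λ _ → H≈0 λ ()) (conv-zero n))) (+-identityʳ _)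
  conv-single (suc e) n       H≈0 = trans
    (+-cong (H≈0 λ ()) (conv-single e n λ i≢e → H≈0 (i≢e ∘ ℕ.suc-injective))) (+-identityˡ _)

  -- The coefficient of a product of series in `k` indeterminates. Unlike the sum over `divisors`,
  -- it involves no truncated subtraction, so the ring laws follow by recursion on the exponents.
  convᵛ : ∀ {k} → Vec ℕ k → (Vec ℕ k → Vec ℕ k → A) → A
  convᵛ []      H = H [] []
  convᵛ (a ∷ α) H = conv a λ i j → convᵛ α λ β γ → H (i ∷ β) (j ∷ γ)

  convᵛ-cong : ∀ {k} (α : Vec ℕ k) {H K} → (∀ {β γ} → zipWith ℕ._+_ β γ ≡ α → H β γ ≈ K β γ) →
    convᵛ α H ≈ convᵛ α K
  convᵛ-cong []      H≈K = H≈K ≡.refl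
  convᵛ-cong (a ∷ α) H≈K = conv-cong a λ i+j≡a → convᵛ-cong α λ β+γ≡α →
    H≈K (≡.cong₂ _∷_ i+j≡a β+γ≡α)

  convᵛ-+ : ∀ {k} (α : Vec ℕ k) H K →
    convᵛ α (λ β γ → H β γ + K β γ) ≈ convᵛ α H + convᵛ α K
  convᵛ-+ []      H K = refl
  convᵛ-+ (a ∷ α) H K = trans (conv-cong a λ _ → convᵛ-+ α _ _) (conv-+ a _ _)

  convᵛ-*ˡ : ∀ {k} (α : Vec ℕ k) c H → c * convᵛ α H ≈ convᵛ α (λ β γ → c * H β γ)
  convᵛ-*ˡ []      c H = refl
  convᵛ-*ˡ (a ∷ α) c H = trans (conv-*ˡ a c _) (conv-cong a λ _ → convᵛ-*ˡ α c _)

  convᵛ-zero : ∀ {k} (α : Vec ℕ k) → convᵛ α (λ _ _ → 0#) ≈ 0#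
  convᵛ-zero []      = refl
  convᵛ-zero (a ∷ α) = trans (conv-cong a λ _ → convᵛ-zero α) (conv-zero a)

  convᵛ-comm : ∀ {k} (α : Vec ℕ k) H → convᵛ α H ≈ convᵛ α (λ β γ → H γ β)
  convᵛ-comm []      H = refl
  convᵛ-comm (a ∷ α) H = trans (conv-comm a _) (conv-cong a λ _ → convᵛ-comm α _)

  convᵛ-swap : ∀ m {k} (α : Vec ℕ k) (H : ℕ → ℕ → Vec ℕ k → Vec ℕ k → A) →
    convᵛ α (λ β γ → conv m (λ i j → H i j β γ)) ≈ conv m (λ i j → convᵛ α (H i j))
  convᵛ-swap m []      H = refl
  convᵛ-swap m (a ∷ α) H = trans (conv-cong a λ _ → convᵛ-swap m α _) (conv-swap a m _)

  -- Associativity holds in each exponent separately; the two uses of `convᵛ-swap` bring the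
  -- convolutions of the first exponent together.
  convᵛ-assoc : ∀ {k} (α : Vec ℕ k) (H : Vec ℕ k → Vec ℕ k → Vec ℕ k → A) →
    convᵛ α (λ β γ → convᵛ β (λ δ ε → H δ ε γ)) ≈ convᵛ α (λ δ β → convᵛ β (H δ))
  convᵛ-assoc []      H = refl
  convᵛ-assoc (a ∷ α) H = begin
    conv a (λ i k → convᵛ α λ β γ → conv i λ p q → convᵛ β λ δ ε → H (p ∷ δ) (q ∷ ε) (k ∷ γ))
      ≈⟨ conv-cong a (λ {i} _ → convᵛ-swap i α _) ⟩
    conv a (λ i k → conv i λ p q → convᵛ α λ β γ → convᵛ β λ δ ε → H (p ∷ δ) (q ∷ ε) (k ∷ γ))
      ≈⟨ conv-cong a (λ {i} _ → conv-cong i λ _ → convᵛ-assoc α _) ⟩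
    conv a (λ i k → conv i λ p q → convᵛ α λ δ β → convᵛ β λ ε γ → H (p ∷ δ) (q ∷ ε) (k ∷ γ))
      ≈⟨ conv-assoc a _ ⟩
    conv a (λ p m → conv m λ q k → convᵛ α λ δ β → convᵛ β λ ε γ → H (p ∷ δ) (q ∷ ε) (k ∷ γ))
      ≈⟨ conv-cong a (λ {_} {m} _ → convᵛ-swap m α _) ⟨
    conv a (λ p m → convᵛ α λ δ β → conv m λ q k → convᵛ β λ ε γ → H (p ∷ δ) (q ∷ ε) (k ∷ γ))
      ∎

  convᵛ-single : ∀ {k} (ε α : Vec ℕ k) {H} → (∀ {β γ} → β ≢ ε → H β γ ≈ 0#) →
    convᵛ (zipWith ℕ._+_ ε α) H ≈ H ε α
  convᵛ-single []      []      H≈0 = refl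
  convᵛ-single (e ∷ ε) (a ∷ α) H≈0 = trans
    (conv-single e a λ i≢e → trans (convᵛ-cong (zipWith ℕ._+_ ε α) λ _ → H≈0 (i≢e ∘ Vec.∷-injectiveˡ))
                                   (convᵛ-zero (zipWith ℕ._+_ ε α)))
    (convᵛ-single ε α λ β≢ε → H≈0 (β≢ε ∘ Vec.∷-injectiveʳ))

-- Words

bit : Bool → ℕ
bit true  = 1
bit false = 0

-- The exponent n ∸ des of u⁻¹ in 𝒢.
nondescents : List ℕ → ℕ
nondescents []           = 0
nondescents (c ∷ [])     = 1
nondescents (c ∷ d ∷ cs) = bit (does (c ℕ.≤? d)) ℕ.+ nondescents (d ∷ cs)

-- The count for a strictly larger letter followed by the given word: that letter descends into a
-- nonempty word and adds nothing, but at the end of the word it adds 1.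
nondescents⁺ : List ℕ → ℕ
nondescents⁺ []       = 1
nondescents⁺ (c ∷ cs) = nondescents (c ∷ cs)

-- Equal letters are standardized from left to right.  Hence the left-to-right
-- maxima of a word are weak, and its right-to-left maxima are strict.
lmaxFrom : ℕ → List ℕ → ℕ
lmaxFrom m []       = 0
lmaxFrom m (c ∷ cs) = bit (does (m ℕ.≤? c)) ℕ.+ lmaxFrom (m ⊔ c) cs

rmaxʷ : List ℕ → ℕ
rmaxʷ []       = 0
rmaxʷ (c ∷ cs) = bit (does (All.all? (ℕ._<? c) cs)) ℕ.+ rmaxʷ cs

module _ (l : ℕ) where

  nondescents-∷ : ∀ {cs} → All (_< l) cs → nondescents (l ∷ cs) ≡ nondescents⁺ cs
  nondescents-∷ []                      = ≡.refl
  nondescents-∷ {c ∷ cs} (c<l ∷ cs<l) = cong (λ b → bit b ℕ.+ nondescents (c ∷ cs))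
    (dec-false (l ℕ.≤? c) (ℕ.<⇒≱ c<l))

  -- The final letter of `bs` counts 1 for want of a successor, and before `l` it still counts 1
  -- because it is at most `l`.
  nondescents-++ : ∀ {bs cs} → All (_< suc l) bs → All (_< l) cs →
    nondescents (bs ++ l ∷ cs) ≡ nondescents bs ℕ.+ nondescents⁺ cs
  nondescents-++ []                   cs<l = nondescents-∷ cs<l
  nondescents-++ {b ∷ []} {cs} (b≤l ∷ []) cs<l = cong₂ (λ d n → bit d ℕ.+ n)
    (dec-true (b ℕ.≤? l) (ℕ.≤-pred b≤l)) (nondescents-∷ cs<l)
  nondescents-++ {b ∷ b′ ∷ bs} {cs} (b≤l ∷ bs≤l) cs<l = ≡.trans
    (cong (bit (does (b ℕ.≤? b′)) ℕ.+_) (nondescents-++ bs≤l cs<l))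
    (≡.sym (ℕ.+-assoc (bit (does (b ℕ.≤? b′))) _ _))

  lmaxFrom-zero : ∀ {cs m} → l ≤ m → All (_< l) cs → lmaxFrom m cs ≡ 0
  lmaxFrom-zero l≤m []                    = ≡.refl
  lmaxFrom-zero {c ∷ cs} {m} l≤m (c<l ∷ cs<l) = cong₂ (λ b n → bit b ℕ.+ n)
    (dec-false (m ℕ.≤? c) (ℕ.<⇒≱ (ℕ.<-≤-trans c<l l≤m)))
    (lmaxFrom-zero (ℕ.≤-trans l≤m (ℕ.m≤m⊔n m c)) cs<l)

  -- As maxima are weak, `l` counts even if `bs` already contains it; after it, every letter is
  -- smaller and none counts.
  lmaxFrom-++ : ∀ {bs cs m} → m ≤ l → All (_< suc l) bs → All (_< l) cs →
    lmaxFrom m (bs ++ l ∷ cs) ≡ suc (lmaxFrom m bs)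
  lmaxFrom-++ {cs = cs} {m} m≤l [] cs<l = cong₂ (λ b n → bit b ℕ.+ n)
    (dec-true (m ℕ.≤? l) m≤l) (lmaxFrom-zero (ℕ.m≤n⊔m m l) cs<l)
  lmaxFrom-++ {b ∷ bs} {m = m} m≤l (b≤l ∷ bs≤l) cs<l = ≡.trans
    (cong (bit (does (m ℕ.≤? b)) ℕ.+_) (lmaxFrom-++ (ℕ.⊔-lub m≤l (ℕ.≤-pred b≤l)) bs≤l cs<l))
    (ℕ.+-suc _ _)

  -- As maxima are strict, `l` disqualifies every letter of `bs`, even one equal to it.
  rmaxʷ-++ : ∀ {bs cs} → All (_< suc l) bs → All (_< l) cs → rmaxʷ (bs ++ l ∷ cs) ≡ suc (rmaxʷ cs)
  rmaxʷ-++ {cs = cs} [] cs<l = cong (λ b → bit b ℕ.+ rmaxʷ cs) (dec-true (All.all? (ℕ._<? l) cs) cs<l)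
  rmaxʷ-++ {b ∷ bs} {cs} (b≤l ∷ bs≤l) cs<l = cong₂ (λ d n → bit d ℕ.+ n)
    (dec-false (All.all? (ℕ._<? b) (bs ++ l ∷ cs))
      (λ below-b → ℕ.<⇒≱ (All.head (All.++⁻ʳ bs below-b)) (ℕ.≤-pred b≤l)))
    (rmaxʷ-++ bs≤l cs<l)

-- Sums over words and their generating functions

module Words (R : CommutativeRing 0ℓ 0ℓ) where
  open CommutativeRing R
  open Sums R
  open Algebra.Properties.CommutativeSemiring.Exp commutativeSemiring public
    using (_^_; ^-homo-*; ^-distrib-*; ^-congˡ; ^-assocʳ)
  open Relation.Binary.Reasoning.Setoid setoid

  sumᵂ : ℕ → (n : ℕ) → (Vec ℕ n → Carrier) → Carrier
  sumᵂ l zero    F = F []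
  sumᵂ l (suc n) F = sum< l λ c → sumᵂ l n λ cs → F (c ∷ cs)

  sumᵂ-cong : ∀ l n {F G} → (∀ {c} → Vecᴬ.All (_< l) c → F c ≈ G c) → sumᵂ l n F ≈ sumᵂ l n G
  sumᵂ-cong l zero    F≈G = F≈G []
  sumᵂ-cong l (suc n) F≈G = sum<-cong l λ c<l → sumᵂ-cong l n λ cs<l → F≈G (c<l ∷ cs<l)

  sumᵂ-cong′ : ∀ l n {F G} → (∀ c → F c ≈ G c) → sumᵂ l n F ≈ sumᵂ l n G
  sumᵂ-cong′ l n F≈G = sumᵂ-cong l n λ {c} _ → F≈G c

  sumᵂ-*ˡ : ∀ l n a F → a * sumᵂ l n F ≈ sumᵂ l n (λ c → a * F c)
  sumᵂ-*ˡ l zero    a F = refl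
  sumᵂ-*ˡ l (suc n) a F = trans (sum<-*ˡ l a _) (sum<-cong l λ _ → sumᵂ-*ˡ l n a _)

  sumᵂ-*ʳ : ∀ l n a F → sumᵂ l n F * a ≈ sumᵂ l n (λ c → F c * a)
  sumᵂ-*ʳ l n a F = trans (*-comm _ a) (trans (sumᵂ-*ˡ l n a F) (sumᵂ-cong′ l n λ _ → *-comm a _))

  sumᵂ-zero : ∀ l n → sumᵂ l n (λ _ → 0#) ≈ 0#
  sumᵂ-zero l zero    = refl
  sumᵂ-zero l (suc n) = sum<-zero l λ _ → sumᵂ-zero l n

  sumᵂ-+ : ∀ l n F G → sumᵂ l n (λ c → F c + G c) ≈ sumᵂ l n F + sumᵂ l n G
  sumᵂ-+ l zero    F G = refl
  sumᵂ-+ l (suc n) F G = trans (sum<-cong l λ _ → sumᵂ-+ l n _ _) (sum<-+ l _ _)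

  sumᵂ-sumL : ∀ l n {B : Set} (bs : List B) (F : B → Vec ℕ n → Carrier) →
    sumᵂ l n (λ c → sumL bs (λ b → F b c)) ≈ sumL bs (λ b → sumᵂ l n (F b))
  sumᵂ-sumL l n []       F = sumᵂ-zero l n
  sumᵂ-sumL l n (b ∷ bs) F = trans (sumᵂ-+ l n _ _) (+-congˡ (sumᵂ-sumL l n bs F))

  sumᴸ : ℕ → ℕ → (List ℕ → Carrier) → Carrier
  sumᴸ l n F = sumᵂ l n (F ∘ Vec.toList)

  sumᴸ-cong : ∀ l n {F G} → (∀ {c} → All (_< l) c → F c ≈ G c) → sumᴸ l n F ≈ sumᴸ l n G
  sumᴸ-cong l n F≈G = sumᵂ-cong l n λ c<l → F≈G (Vecᴬ.toList⁺ c<l)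

  conv-sum< : ∀ n m (H : ℕ → ℕ → ℕ → Carrier) →
    conv n (λ i j → sum< m (H i j)) ≈ sum< m (λ c → conv n (λ i j → H i j c))
  conv-sum< n zero    H = conv-zero n
  conv-sum< n (suc m) H = trans (conv-+ n _ _) (+-congʳ (conv-sum< n m H))

  private
    -- The words that contain the letter l, split at its last occurrence.
    splits : ℕ → ℕ → (List ℕ → Carrier) → Carrier
    splits l zero    F = 0#
    splits l (suc n) F = conv n λ i j → sumᴸ (suc l) i λ bs → sumᴸ l j λ cs → F (bs ++ l ∷ cs)

    splits-suc : ∀ l n F → sumᴸ l n (F ∘ (l ∷_)) + sum< (suc l) (λ c → splits l n (F ∘ (c ∷_))) ≈ splits l (suc n) F
    splits-suc l zero    F = trans (+-congˡ (sum<-zero (suc l) λ _ → refl)) (+-identityʳ _)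
    splits-suc l (suc n) F = +-congˡ (sym (conv-sum< n (suc l) λ i j c →
      sumᴸ (suc l) i λ bs → sumᴸ l j λ cs → F (c ∷ bs ++ l ∷ cs)))

  -- Induction on the first letter. If the rest contains `l`, the first letter joins the left part.
  -- Otherwise it is below `l` and the word avoids `l`, or it is `l` itself and the left part is
  -- empty.
  sumᴸ-last-maximum : ∀ l n F → sumᴸ (suc l) n F ≈ sumᴸ l n F + splits l n F
  sumᴸ-last-maximum l zero    F = sym (+-identityʳ _)
  sumᴸ-last-maximum l (suc n) F = begin
    sum< (suc l) (λ c → sumᴸ (suc l) n (F ∘ (c ∷_)))
      ≈⟨ sum<-cong (suc l) (λ {c} _ → sumᴸ-last-maximum l n (F ∘ (c ∷_))) ⟩
    sum< (suc l) (λ c → sumᴸ l n (F ∘ (c ∷_)) + splits l n (F ∘ (c ∷_)))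
      ≈⟨ sum<-+ (suc l) _ _ ⟩
    sumᴸ l (suc n) F + sumᴸ l n (F ∘ (l ∷_)) + sum< (suc l) (λ c → splits l n (F ∘ (c ∷_)))
      ≈⟨ +-assoc _ _ _ ⟩
    sumᴸ l (suc n) F + (sumᴸ l n (F ∘ (l ∷_)) + sum< (suc l) (λ c → splits l n (F ∘ (c ∷_))))
      ≈⟨ +-congˡ (splits-suc l n F) ⟩
    sumᴸ l (suc n) F + splits l (suc n) F
      ∎

  1^ : ∀ n → 1# ^ n ≈ 1#
  1^ zero    = refl
  1^ (suc n) = trans (*-identityˡ _) (1^ n)

  ^-vanish : ∀ {s m} n → s ^ m ≈ 0# → s ^ (m ℕ.+ n) ≈ 0#
  ^-vanish {s} {m} n sᵐ≈0 = trans (^-homo-* s m n) (trans (*-congʳ sᵐ≈0) (zeroˡ _))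

  open Algebra.Properties.CommutativeSemigroup *-commutativeSemigroup using (interchange)

  -- The convolutions run over the triangle `i + j < m`, the product of sums over the square
  -- `i, j < m`. The terms in between carry `s ^ (i + j)` with `i + j ≥ m` and vanish.
  cauchy-product : ∀ {s} m → s ^ m ≈ 0# → (a b : ℕ → Carrier) →
    sum< m (λ n → s ^ n * conv n (λ i j → a i * b j))
      ≈ sum< m (λ i → s ^ i * a i) * sum< m (λ j → s ^ j * b j)
  cauchy-product {s} m sᵐ≈0 a b = begin
    sum< m (λ n → s ^ n * conv n (λ i j → a i * b j))
      ≈⟨ sum<-cong m (λ {n} _ → trans (conv-*ˡ n (s ^ n) _) (conv-cong n λ {i} {j} i+j≡n →
           trans (*-congʳ (trans (reflexive (cong (s ^_) (≡.sym i+j≡n))) (^-homo-* s i j))) (interchange _ _ _ _))) ⟩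
    sum< m (λ n → conv n (λ i j → s ^ i * a i * (s ^ j * b j)))
      ≈⟨ sum<-conv m _ ⟩
    sum< m (λ i → sum< (m ∸ i) (λ j → s ^ i * a i * (s ^ j * b j)))
      ≈⟨ sum<-cong m (λ {i} i<m → sym (extend (ℕ.<⇒≤ i<m))) ⟩
    sum< m (λ i → sum< m (λ j → s ^ i * a i * (s ^ j * b j)))
      ≈⟨ sum<-cong m (λ _ → sum<-*ˡ m _ _) ⟨
    sum< m (λ i → s ^ i * a i * sum< m (λ j → s ^ j * b j))
      ≈⟨ sum<-*ʳ m _ _ ⟨
    sum< m (λ i → s ^ i * a i) * sum< m (λ j → s ^ j * b j)
      ∎
    where
    extend : ∀ {i} → i ≤ m → let f = λ j → s ^ i * a i * (s ^ j * b j) in sum< m f ≈ sum< (m ∸ i) f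
    extend {i} i≤m = trans (reflexive (cong (λ k → sum< k f) (≡.sym (ℕ.m∸n+n≡m i≤m))))
      (sum<-extend (m ∸ i) i f λ j → begin
        s ^ i * a i * (s ^ (m ∸ i ℕ.+ j) * b (m ∸ i ℕ.+ j))    ≈⟨ interchange _ _ _ _ ⟩
        s ^ i * s ^ (m ∸ i ℕ.+ j) * (a i * b (m ∸ i ℕ.+ j))    ≈⟨ *-congʳ (^-homo-* s i _) ⟨
        s ^ (i ℕ.+ (m ∸ i ℕ.+ j)) * (a i * b (m ∸ i ℕ.+ j))    ≈⟨ *-congʳ (reflexive (cong (s ^_)
                                                                    (≡.trans (≡.sym (ℕ.+-assoc i (m ∸ i) j)) (cong (ℕ._+ j) (ℕ.m+[n∸m]≡n i≤m))))) ⟩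
        s ^ (m ℕ.+ j) * (a i * b (m ∸ i ℕ.+ j))                ≈⟨ *-congʳ (^-vanish {s} {m} j sᵐ≈0) ⟩
        0# * (a i * b (m ∸ i ℕ.+ j))                           ≈⟨ zeroˡ _ ⟩
        0#                                                     ∎)
      where
      f : ℕ → Carrier
      f j = s ^ i * a i * (s ^ j * b j)

  module WordSeries (w s : Carrier) (M : ℕ) (s-nilpotent : s ^ suc M ≈ 0#) where
    open IntegerSolver R

    weight : Carrier → Carrier → List ℕ → Carrier
    weight V Z c = w ^ nondescents c * V ^ rmaxʷ c * Z ^ lmaxFrom 0 c

    words : Carrier → Carrier → ℕ → ℕ → Carrier
    words V Z l n = sumᴸ l n (weight V Z)

    E : Carrier → Carrier → ℕ → Carrier
    E V Z l = sum< (suc M) λ n → s ^ n * words V Z l n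

    E-zero : ∀ V Z → E V Z 0 ≈ 1#
    E-zero V Z = trans (sum<-suc M _) (trans (+-congˡ (sum<-zero M λ _ → zeroʳ _))
      (solve 0 (:1 :* (:1 :* :1 :* :1) :+ con 0ℤ := :1) refl))

    private
      weightˡ : Carrier → List ℕ → Carrier
      weightˡ Z c = w ^ nondescents c * Z ^ lmaxFrom 0 c

      weightʳ : Carrier → List ℕ → Carrier
      weightʳ V c = w ^ nondescents⁺ c * V ^ rmaxʷ c

      weight-++ : ∀ V Z l {bs cs} → All (_< suc l) bs → All (_< l) cs →
        weight V Z (bs ++ l ∷ cs) ≈ V * Z * (weightˡ Z bs * weightʳ V cs)
      weight-++ V Z l {bs} {cs} bs≤l cs<l
        rewrite nondescents-++ l bs≤l cs<l | rmaxʷ-++ l bs≤l cs<l | lmaxFrom-++ l z≤n bs≤l cs<l = trans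
          (*-congʳ (*-congʳ (^-homo-* w (nondescents bs) (nondescents⁺ cs))))
          (solve 6 (λ a b V Z c d → a :* b :* (V :* c) :* (Z :* d) := V :* Z :* ((a :* d) :* (b :* c))) refl
            (w ^ nondescents bs) (w ^ nondescents⁺ cs) V Z (V ^ rmaxʷ cs) (Z ^ lmaxFrom 0 bs))

      weightˡ≈ : ∀ Z c → weightˡ Z c ≈ weight 1# Z c
      weightˡ≈ Z c = *-congʳ (sym (trans (*-congˡ (1^ (rmaxʷ c))) (*-identityʳ _)))

      weightʳ≈ : ∀ V l j → sumᴸ l (suc j) (weightʳ V) ≈ words V 1# l (suc j)
      weightʳ≈ V l j = sumᵂ-cong′ l (suc j) {weightʳ V ∘ Vec.toList} {weight V 1# ∘ Vec.toList} λ { (c ∷ cs) →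
        sym (trans (*-congˡ (1^ (lmaxFrom 0 (c ∷ Vec.toList cs)))) (*-identityʳ _)) }

      splits-weight : ∀ V Z l n → splits l (suc n) (weight V Z) ≈
        V * Z * conv n (λ i j → words 1# Z (suc l) i * sumᴸ l j (weightʳ V))
      splits-weight V Z l n = sym (trans (conv-*ˡ n (V * Z) _) (conv-cong n λ {i} {j} _ → begin
        V * Z * (words 1# Z (suc l) i * sumᴸ l j (weightʳ V))
          ≈⟨ *-congˡ (sumᵂ-*ʳ (suc l) i _ _) ⟩
        V * Z * sumᴸ (suc l) i (λ bs → weight 1# Z bs * sumᴸ l j (weightʳ V))
          ≈⟨ sumᵂ-*ˡ (suc l) i _ _ ⟩
        sumᴸ (suc l) i (λ bs → V * Z * (weight 1# Z bs * sumᴸ l j (weightʳ V)))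
          ≈⟨ sumᴸ-cong (suc l) i (λ {bs} bs≤l → trans (*-congˡ (trans (*-congʳ (sym (weightˡ≈ Z bs))) (sumᵂ-*ˡ l j _ _)))
               (trans (sumᵂ-*ˡ l j _ _) (sumᴸ-cong l j λ {cs} cs<l → sym (weight-++ V Z l bs≤l cs<l)))) ⟩
        sumᴸ (suc l) i (λ bs → sumᴸ l j λ cs → weight V Z (bs ++ l ∷ cs))
          ∎))

      -- The two weights differ at the empty word only, which `nondescents⁺` counts as `w` instead
      -- of `1#`; this is the origin of the summand `w - 1#`.
      sum-weightʳ : ∀ V l → sum< (suc M) (λ j → s ^ j * sumᴸ l j (weightʳ V)) ≈ w - 1# + E V 1# l
      sum-weightʳ V l = begin
        sum< (suc M) (λ j → s ^ j * sumᴸ l j (weightʳ V))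
          ≈⟨ sum<-suc M _ ⟩
        1# * (w * 1# * 1#) + sum< M (λ j → s ^ suc j * sumᴸ l (suc j) (weightʳ V))
          ≈⟨ +-congˡ (sum<-cong M λ {j} _ → *-congˡ (weightʳ≈ V l j)) ⟩
        1# * (w * 1# * 1#) + sum< M (λ j → s ^ suc j * words V 1# l (suc j))
          ≈⟨ solve 2 (λ w x → :1 :* (w :* :1 :* :1) :+ x := w :- :1 :+ (:1 :* (:1 :* :1 :* :1) :+ x)) refl w _ ⟩
        w - 1# + (1# * (1# * 1# * 1#) + sum< M (λ j → s ^ suc j * words V 1# l (suc j)))
          ≈⟨ +-congˡ (sum<-suc M (λ j → s ^ j * words V 1# l j)) ⟨
        w - 1# + E V 1# l
          ∎

    E-suc : ∀ V Z l → E V Z (suc l) ≈ E V Z l + s * V * Z * (E 1# Z (suc l) * (w - 1# + E V 1# l))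
    E-suc V Z l = begin
      sum< (suc M) (λ n → s ^ n * words V Z (suc l) n)
        ≈⟨ sum<-cong (suc M) (λ {n} _ → trans (*-congˡ (sumᴸ-last-maximum l n (weight V Z))) (distribˡ _ _ _)) ⟩
      sum< (suc M) (λ n → s ^ n * words V Z l n + s ^ n * splits l n (weight V Z))
        ≈⟨ sum<-+ (suc M) _ _ ⟩
      E V Z l + sum< (suc M) (λ n → s ^ n * splits l n (weight V Z))
        ≈⟨ +-congˡ (begin
          sum< (suc M) (λ n → s ^ n * splits l n (weight V Z))
            ≈⟨ trans (sum<-suc M _) (trans (+-congʳ (zeroʳ _)) (+-identityˡ _)) ⟩
          sum< M (λ n → s ^ suc n * splits l (suc n) (weight V Z))
            ≈⟨ sum<-cong M (λ {n} _ → trans (*-congˡ (splits-weight V Z l n))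
                 (solve 5 (λ s V Z p c → s :* p :* (V :* Z :* c) := s :* V :* Z :* (p :* c)) refl s V Z (s ^ n) (H n))) ⟩
          sum< M (λ n → s * V * Z * (s ^ n * H n))
            -- The factor `s` in front turns the additional term `n = M` into a multiple of
            -- `s ^ suc M`; with it the range is that of `cauchy-product`.
            ≈⟨ trans (+-congˡ (trans (solve 5 (λ s V Z p c → s :* V :* Z :* (p :* c) := s :* p :* (V :* Z :* c)) refl s V Z (s ^ M) (H M))
                                     (trans (*-congʳ s-nilpotent) (zeroˡ _)))) (+-identityʳ _) ⟨
          sum< (suc M) (λ n → s * V * Z * (s ^ n * H n))
            ≈⟨ sum<-*ˡ (suc M) _ _ ⟨
          s * V * Z * sum< (suc M) (λ n → s ^ n * H n)
            ≈⟨ *-congˡ (cauchy-product (suc M) s-nilpotent (words 1# Z (suc l)) (λ j → sumᴸ l j (weightʳ V))) ⟩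
          s * V * Z * (E 1# Z (suc l) * sum< (suc M) (λ j → s ^ j * sumᴸ l j (weightʳ V)))
            ≈⟨ *-congˡ (*-congˡ (sum-weightʳ V l)) ⟩
          s * V * Z * (E 1# Z (suc l) * (w - 1# + E V 1# l))
            ∎) ⟩
      E V Z l + s * V * Z * (E 1# Z (suc l) * (w - 1# + E V 1# l))
        ∎
      where
      H : ℕ → Carrier
      H n = conv n λ i j → words 1# Z (suc l) i * sumᴸ l j (weightʳ V)

-- Standardization of words

infix 4 _≺_ _≺?_
infix 7 _≺ᵇ_

-- Pairs of a letter and its position in the word.
_≺_ : ℕ × ℕ → ℕ × ℕ → Set
(b , i) ≺ (c , j) = b < c ⊎ (b ≡ c × i < j)

_≺?_ : ∀ p q → Dec (p ≺ q)
(b , i) ≺? (c , j) = (b ℕ.<? c) ⊎-dec ((b ℕ.≟ c) ×-dec (i ℕ.<? j))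

_≺ᵇ_ : ℕ × ℕ → ℕ × ℕ → Bool
p ≺ᵇ q = does (p ≺? q)

≺-trans : ∀ {p q r} → p ≺ q → q ≺ r → p ≺ r
≺-trans (inj₁ b<c)           (inj₁ c<d)           = inj₁ (ℕ.<-trans b<c c<d)
≺-trans (inj₁ b<c)           (inj₂ (≡.refl , _))  = inj₁ b<c
≺-trans (inj₂ (≡.refl , _))  (inj₁ c<d)           = inj₁ c<d
≺-trans (inj₂ (≡.refl , i<j)) (inj₂ (≡.refl , j<k)) = inj₂ (≡.refl , ℕ.<-trans i<j j<k)

≺ᵇ⇒≺ : ∀ p q → p ≺ᵇ q ≡ true → p ≺ q
≺ᵇ⇒≺ p q = invert (p ≺? q)
  where
  invert : ∀ {A : Set} (a? : Dec A) → does a? ≡ true → A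
  invert (yes a) _ = a

sorted : ∀ {n} → Vec (ℕ × ℕ) n → Bool
sorted []           = true
sorted (p ∷ [])     = true
sorted (p ∷ q ∷ ps) = p ≺ᵇ q ∧ sorted (q ∷ ps)

shiftPosition : ℕ × ℕ → ℕ × ℕ
shiftPosition (b , i) = b , suc i

sorted-shiftPosition : ∀ {n} (ps : Vec (ℕ × ℕ) n) → sorted (Vec.map shiftPosition ps) ≡ sorted ps
sorted-shiftPosition []           = ≡.refl
sorted-shiftPosition (p ∷ [])     = ≡.refl
sorted-shiftPosition (p ∷ q ∷ ps) = cong (p ≺ᵇ q ∧_) (sorted-shiftPosition (q ∷ ps))

-- The order is total on pairs with distinct positions, and the position 0 of a new first letter
-- differs from every shifted one.
≺ᵇ-complement : ∀ c p → shiftPosition p ≺ᵇ (c , 0) ≡ not ((c , 0) ≺ᵇ shiftPosition p)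
≺ᵇ-complement c (b , i) with ℕ.<-cmp b c
... | tri< b<c b≢c c≮b = ≡.trans (dec-true ((b , suc i) ≺? (c , 0)) (inj₁ b<c))
  (cong not (≡.sym (dec-false ((c , 0) ≺? (b , suc i)) λ { (inj₁ c<b) → c≮b c<b ; (inj₂ (c≡b , _)) → b≢c (≡.sym c≡b) })))
... | tri≈ b≮c b≡c c≮b = ≡.trans (dec-false ((b , suc i) ≺? (c , 0)) λ { (inj₁ b<c) → b≮c b<c ; (inj₂ (_ , ())) })
  (cong not (≡.sym (dec-true ((c , 0) ≺? (b , suc i)) (inj₂ (≡.sym b≡c , z<s)))))
... | tri> b≮c b≢c c<b = ≡.trans (dec-false ((b , suc i) ≺? (c , 0)) λ { (inj₁ b<c) → b≮c b<c ; (inj₂ (b≡c , _)) → b≢c b≡c })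
  (cong not (≡.sym (dec-true ((c , 0) ≺? (b , suc i)) (inj₁ c<b))))

lookup-injective : ∀ {A : Set} {n} (xs ys : Vec A n) → (∀ i → lookup xs i ≡ lookup ys i) → xs ≡ ys
lookup-injective []       []       eq = ≡.refl
lookup-injective (x ∷ xs) (y ∷ ys) eq = cong₂ _∷_ (eq zero) (lookup-injective xs ys (eq ∘ suc))

insertAt-unique : ∀ {A : Set} {n} (ys : Vec A (suc n)) (xs : Vec A n) j x → lookup ys j ≡ x →
  (∀ i → lookup ys (punchIn j i) ≡ lookup xs i) → ys ≡ insertAt xs j x
insertAt-unique (y ∷ ys) xs       zero    x y≡x eq = cong₂ _∷_ y≡x (lookup-injective ys xs eq)
insertAt-unique (y ∷ ys) (z ∷ xs) (suc j) x ys≡x eq = cong₂ _∷_ (eq zero) (insertAt-unique ys xs j x ys≡x (eq ∘ suc))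

zip-insertAt : ∀ {A B : Set} {n} (xs : Vec A n) (ys : Vec B n) j x y →
  zip (insertAt xs j x) (insertAt ys j y) ≡ insertAt (zip xs ys) j (x , y)
zip-insertAt []       []       zero    x y = ≡.refl
zip-insertAt (_ ∷ _)  (_ ∷ _)  zero    x y = ≡.refl
zip-insertAt (a ∷ xs) (b ∷ ys) (suc j) x y = cong (_ ∷_) (zip-insertAt xs ys j x y)

zip-suc : ∀ {n} (bs is : Vec ℕ n) → zip bs (Vec.map suc is) ≡ Vec.map shiftPosition (zip bs is)
zip-suc []       []       = ≡.refl
zip-suc (b ∷ bs) (i ∷ is) = cong (_ ∷_) (zip-suc bs is)

-- The word of the inverse permutation.
positions : ∀ {n} → Permutation′ n → Vec ℕ n
positions π = tabulate λ p → toℕ (π ⟨$⟩ˡ p)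

_∘ᵂ_ : ∀ {n} → Vec ℕ n → Permutation′ n → Vec ℕ n
b ∘ᵂ π = tabulate λ i → lookup b (π ⟨$⟩ʳ i)

module _ {n} (j : Fin (suc n)) (π : Permutation′ n) where

  insert-zeroˡ : insert zero j π ⟨$⟩ˡ j ≡ zero
  insert-zeroˡ with j Fin.≟ j
  ... | yes _   = ≡.refl
  ... | no  j≢j = contradiction ≡.refl j≢j

  insert-punchInˡ : ∀ p → insert zero j π ⟨$⟩ˡ punchIn j p ≡ suc (π ⟨$⟩ˡ p)
  insert-punchInˡ p with j Fin.≟ punchIn j p
  ... | yes j≡ = contradiction (≡.sym j≡) (Fin.punchInᵢ≢i j p)
  ... | no  j≢ = cong (λ k → suc (π ⟨$⟩ˡ k))
    (≡.trans (Fin.punchOut-cong j ≡.refl) (Fin.punchOut-punchIn j))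

  positions-insert : positions (insert zero j π) ≡ insertAt (Vec.map suc (positions π)) j 0
  positions-insert = insertAt-unique _ _ j 0
    (≡.trans (Vec.lookup∘tabulate rank j) (cong toℕ insert-zeroˡ))
    (λ i → ≡.trans (Vec.lookup∘tabulate rank (punchIn j i)) (≡.trans (cong toℕ (insert-punchInˡ i))
      (≡.sym (≡.trans (Vec.lookup-map i suc (positions π)) (cong suc (Vec.lookup∘tabulate _ i))))))
    where
    rank : Fin (suc n) → ℕ
    rank p = toℕ (insert zero j π ⟨$⟩ˡ p)

  zip-positions-insert : ∀ b c → zip (insertAt b j c) (positions (insert zero j π)) ≡
    insertAt (Vec.map shiftPosition (zip b (positions π))) j (c , 0)
  zip-positions-insert b c = ≡.trans (cong (zip (insertAt b j c)) positions-insert)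
    (≡.trans (zip-insertAt b (Vec.map suc (positions π)) j c 0)
             (cong (λ ps → insertAt ps j (c , 0)) (zip-suc b (positions π))))

  ∘ᵂ-insert : ∀ b c → insertAt b j c ∘ᵂ insert zero j π ≡ c ∷ b ∘ᵂ π
  ∘ᵂ-insert b c = cong₂ _∷_ (Vec.insertAt-lookup b j c)
    (Vec.tabulate-cong λ i → Vec.insertAt-punchIn b j c (π ⟨$⟩ʳ i))

-- On distinct entries these are the descents. The exact negation of `<` is used because `_≺_`
-- admits equal letters only at increasing positions.
nonascents : ∀ {n} → Vec ℕ n → ℕ
nonascents []            = 0
nonascents (i ∷ [])      = 0
nonascents (i ∷ i′ ∷ is) = bit (not (does (i ℕ.<? i′))) ℕ.+ nonascents (i′ ∷ is)

module Standardization (R : CommutativeRing 0ℓ 0ℓ) where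
  open CommutativeRing R hiding (zero)
  open Sums R
  open Words R
  open Relation.Binary.Reasoning.Setoid setoid

  infix 5 [_]_
  [_]_ : Bool → Carrier → Carrier
  [ b ] a = if b then a else 0#

  sumL-allFin-suc : ∀ n (f : Fin (suc n) → Carrier) →
    sumL (allFin (suc n)) f ≈ f zero + sumL (allFin n) (f ∘ suc)
  sumL-allFin-suc n f = +-congˡ (trans
    (reflexive (cong (λ is → sumL is f) (≡.sym (List.map-tabulate (λ i → i) suc))))
    (sumL-map suc (allFin n) f))

  -- The induction behind `sum-insertions` has to know the element in front. The first place needs
  -- `p ≺ q` and `q ≺ r`, the later ones `r ≺ q`, so they never contribute together. Transitivity
  -- rules out the two patterns of comparisons in which the identity would fail.
  sum-insertions-∷ : ∀ {n} p q (ps : Vec (ℕ × ℕ) n) a → Vecᴬ.All (λ r → r ≺ᵇ q ≡ not (q ≺ᵇ r)) ps →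
    sumL (allFin (suc n)) (λ j → [ sorted (p ∷ insertAt ps j q) ] a) ≈ [ p ≺ᵇ q ∧ sorted (p ∷ ps) ] a
  sum-insertions-∷ p q []       a [] = +-identityʳ _
  sum-insertions-∷ {suc n} p q (r ∷ ps) a (r⊀q ∷ ps⊀q) = begin
    sumL (allFin (suc (suc n))) (λ j → [ sorted (p ∷ insertAt (r ∷ ps) j q) ] a)
      ≈⟨ sumL-allFin-suc (suc n) _ ⟩
    ([ p ≺ᵇ q ∧ (q ≺ᵇ r ∧ S) ] a) + sumL (allFin (suc n)) (λ j → [ p ≺ᵇ r ∧ sorted (r ∷ insertAt ps j q) ] a)
      ≈⟨ +-congˡ (factor (p ≺ᵇ r)) ⟩
    ([ p ≺ᵇ q ∧ (q ≺ᵇ r ∧ S) ] a) + ([ p ≺ᵇ r ∧ (r ≺ᵇ q ∧ S) ] a)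
      ≈⟨ cases (p ≺ᵇ q) (q ≺ᵇ r) (p ≺ᵇ r) ≡.refl ≡.refl ≡.refl ⟩
    [ p ≺ᵇ q ∧ (p ≺ᵇ r ∧ S) ] a
      ∎
    where
    S : Bool
    S = sorted (r ∷ ps)
    factor : ∀ b → sumL (allFin (suc n)) (λ j → [ b ∧ sorted (r ∷ insertAt ps j q) ] a) ≈ [ b ∧ (r ≺ᵇ q ∧ S) ] a
    factor true  = sum-insertions-∷ r q ps a ps⊀q
    factor false = sumL-zero (allFin (suc n))
    go : ∀ pq qr pr → p ≺ᵇ q ≡ pq → q ≺ᵇ r ≡ qr → p ≺ᵇ r ≡ pr →
      ([ pq ∧ (qr ∧ S) ] a) + ([ pr ∧ (not qr ∧ S) ] a) ≈ [ pq ∧ (pr ∧ S) ] a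
    go true  true  true  _   _   _   = +-identityʳ _
    go true  true  false p≺q q≺r p⊀r with () ← ≡.trans (≡.sym (dec-true (p ≺? r)
      (≺-trans (≺ᵇ⇒≺ p q p≺q) (≺ᵇ⇒≺ q r q≺r)))) p⊀r
    go true  false true  _   _   _   = +-identityˡ _
    go true  false false _   _   _   = +-identityˡ _
    go false true  true  _   _   _   = +-identityʳ _
    go false true  false _   _   _   = +-identityʳ _
    go false false true  p⊀q q⊀r p≺r with () ← ≡.trans (≡.sym (dec-true (p ≺? q)
      (≺-trans (≺ᵇ⇒≺ p r p≺r) (≺ᵇ⇒≺ r q (≡.trans r⊀q (cong not q⊀r)))))) p⊀q
    go false false false _   _   _   = +-identityʳ _
    cases : ∀ pq qr pr → p ≺ᵇ q ≡ pq → q ≺ᵇ r ≡ qr → p ≺ᵇ r ≡ pr →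
      ([ pq ∧ (qr ∧ S) ] a) + ([ pr ∧ (r ≺ᵇ q ∧ S) ] a) ≈ [ pq ∧ (pr ∧ S) ] a
    cases pq qr pr p≺q q≺r p≺r = trans
      (+-congˡ (reflexive (cong (λ rq → [ pr ∧ (rq ∧ S) ] a) (≡.trans r⊀q (cong not q≺r)))))
      (go pq qr pr p≺q q≺r p≺r)

  -- A new element has exactly one place in a sorted sequence.
  sum-insertions : ∀ {n} q (ps : Vec (ℕ × ℕ) n) a → Vecᴬ.All (λ r → r ≺ᵇ q ≡ not (q ≺ᵇ r)) ps →
    sumL (allFin (suc n)) (λ j → [ sorted (insertAt ps j q) ] a) ≈ [ sorted ps ] a
  sum-insertions q []       a [] = +-identityʳ _
  sum-insertions {suc n} q (p ∷ ps) a (p⊀q ∷ ps⊀q) = begin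
    sumL (allFin (suc (suc n))) (λ j → [ sorted (insertAt (p ∷ ps) j q) ] a)
      ≈⟨ sumL-allFin-suc (suc n) _ ⟩
    ([ q ≺ᵇ p ∧ sorted (p ∷ ps) ] a) + sumL (allFin (suc n)) (λ j → [ sorted (p ∷ insertAt ps j q) ] a)
      ≈⟨ +-congˡ (sum-insertions-∷ p q ps a ps⊀q) ⟩
    ([ q ≺ᵇ p ∧ sorted (p ∷ ps) ] a) + ([ p ≺ᵇ q ∧ sorted (p ∷ ps) ] a)
      ≈⟨ cases (q ≺ᵇ p) p⊀q ⟩
    [ sorted (p ∷ ps) ] a
      ∎
    where
    cases : ∀ b → p ≺ᵇ q ≡ not b → ([ b ∧ sorted (p ∷ ps) ] a) + ([ p ≺ᵇ q ∧ sorted (p ∷ ps) ] a) ≈ [ sorted (p ∷ ps) ] a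
    cases true  eq rewrite eq = +-identityʳ _
    cases false eq rewrite eq = +-identityˡ _

  sumᵂ-insertAt : ∀ l {n} (j : Fin (suc n)) (F : Vec ℕ (suc n) → Carrier) →
    sumᵂ l (suc n) F ≈ sum< l (λ c → sumᵂ l n λ b → F (insertAt b j c))
  sumᵂ-insertAt l {n}     zero    F = sum<-cong l λ _ → sumᵂ-cong′ l n λ { [] → refl ; (_ ∷ _) → refl }
  sumᵂ-insertAt l {suc n} (suc j) F = trans
    (sum<-cong l λ {d} _ → sumᵂ-insertAt l j (λ c → F (d ∷ c))) (sum<-swap l l _)

  -- Every word is `b ∘ᵂ π` for exactly one `π` with `b` sorted: `π` ranks the positions by letter
  -- and then by position. In the induction, `𝔖` prepends a letter `j` to `π`, and just one `j` puts
  -- the first letter of the word into its place in the sorted sequence.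
  standardization : ∀ l n (F : Vec ℕ n → Carrier) → sumᵂ l n F ≈
    sumL (𝔖 n) (λ π → sumᵂ l n λ b → [ sorted (zip b (positions π)) ] F (b ∘ᵂ π))
  standardization l zero    F = sym (+-identityʳ _)
  standardization l (suc n) F = begin
    sum< l (λ c → sumᵂ l n λ cs → F (c ∷ cs))
      ≈⟨ sum<-cong l (λ {c} _ → standardization l n (λ cs → F (c ∷ cs))) ⟩
    sum< l (λ c → sumL (𝔖 n) λ π → sumᵂ l n λ b → [ sorted (zip b (positions π)) ] F (c ∷ b ∘ᵂ π))
      ≈⟨ sum<-sumL l (𝔖 n) _ ⟩
    sumL (𝔖 n) (λ π → sum< l λ c → sumᵂ l n λ b → [ sorted (zip b (positions π)) ] F (c ∷ b ∘ᵂ π))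
      ≈⟨ sumL-cong (𝔖 n) (λ π → sum<-cong l λ {c} _ → sumᵂ-cong′ l n λ b → insertions π c b) ⟩
    sumL (𝔖 n) (λ π → sum< l λ c → sumᵂ l n λ b → sumL (allFin (suc n)) λ j → G (insert zero j π) (insertAt b j c))
      ≈⟨ sumL-cong (𝔖 n) (λ π → trans
           (sum<-cong l λ {c} _ → sumᵂ-sumL l n (allFin (suc n)) _) (sum<-sumL l (allFin (suc n)) _)) ⟩
    sumL (𝔖 n) (λ π → sumL (allFin (suc n)) λ j → sum< l λ c → sumᵂ l n λ b → G (insert zero j π) (insertAt b j c))
      ≈⟨ sumL-swap (𝔖 n) (allFin (suc n)) _ ⟩
    sumL (allFin (suc n)) (λ j → sumL (𝔖 n) λ π → sum< l λ c → sumᵂ l n λ b → G (insert zero j π) (insertAt b j c))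
      ≈⟨ sumL-cong (allFin (suc n)) (λ j → sumL-cong (𝔖 n) λ π → sumᵂ-insertAt l j (G (insert zero j π))) ⟨
    sumL (allFin (suc n)) (λ j → sumL (𝔖 n) λ π → sumᵂ l (suc n) (G (insert zero j π)))
      ≈⟨ sumL-cartesianProductWith (insert zero) (allFin (suc n)) (𝔖 n) _ ⟨
    sumL (𝔖 (suc n)) (λ π → sumᵂ l (suc n) (G π))
      ∎
    where
    G : Permutation′ (suc n) → Vec ℕ (suc n) → Carrier
    G π b = [ sorted (zip b (positions π)) ] F (b ∘ᵂ π)
    complements : ∀ c {m} (ps : Vec (ℕ × ℕ) m) →
      Vecᴬ.All (λ r → r ≺ᵇ (c , 0) ≡ not ((c , 0) ≺ᵇ r)) (Vec.map shiftPosition ps)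
    complements c []       = []
    complements c (p ∷ ps) = ≺ᵇ-complement c p ∷ complements c ps
    insertions : ∀ π c b → ([ sorted (zip b (positions π)) ] F (c ∷ b ∘ᵂ π)) ≈
      sumL (allFin (suc n)) (λ j → G (insert zero j π) (insertAt b j c))
    insertions π c b = begin
      [ sorted (zip b (positions π)) ] F (c ∷ b ∘ᵂ π)
        ≡⟨ cong (λ χ → [ χ ] F (c ∷ b ∘ᵂ π)) (sorted-shiftPosition (zip b (positions π))) ⟨
      [ sorted (Vec.map shiftPosition (zip b (positions π))) ] F (c ∷ b ∘ᵂ π)
        ≈⟨ sum-insertions (c , 0) _ _ (complements c (zip b (positions π))) ⟨
      sumL (allFin (suc n)) (λ j → [ sorted (insertAt (Vec.map shiftPosition (zip b (positions π))) j (c , 0)) ] F (c ∷ b ∘ᵂ π))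
        ≈⟨ sumL-cong (allFin (suc n)) (λ j → reflexive (cong₂ (λ ps cs → [ sorted ps ] F cs)
             (zip-positions-insert j π b c) (∘ᵂ-insert j π b c))) ⟨
      sumL (allFin (suc n)) (λ j → G (insert zero j π) (insertAt b j c))
        ∎

  -- The number of P-partitions with parts below l, for the linear order given by is.
  labellings : ℕ → ∀ {n} → Vec ℕ n → Carrier
  labellings l {n} is = sumᵂ l n λ b → [ sorted (zip b is) ] 1#

  private
    labellingsFrom : ℕ → ℕ × ℕ → ∀ {n} → Vec ℕ n → Carrier
    labellingsFrom l p {n} is = sumᵂ l n λ b → [ sorted (p ∷ zip b is) ] 1#

    labellingsFrom-∷ : ∀ l p i {n} (is : Vec ℕ n) b → p ≺ᵇ (b , i) ≡ true →
      sumᵂ l n (λ bs → [ p ≺ᵇ (b , i) ∧ sorted ((b , i) ∷ zip bs is) ] 1#) ≈ labellingsFrom l (b , i) is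
    labellingsFrom-∷ l p i is b eq rewrite eq = refl

    labellingsFrom-⊀ : ∀ l p i {n} (is : Vec ℕ n) b → p ≺ᵇ (b , i) ≡ false →
      sumᵂ l n (λ bs → [ p ≺ᵇ (b , i) ∧ sorted ((b , i) ∷ zip bs is) ] 1#) ≈ 0#
    labellingsFrom-⊀ l p i {n} is b eq rewrite eq = sumᵂ-zero l n

    -- Labels after `suc b` are positive, and lowering all labels by one preserves every comparison.
    labellingsFrom-suc : ∀ l b i {n} (is : Vec ℕ n) →
      labellingsFrom (suc l) (suc b , i) is ≈ labellingsFrom l (b , i) is
    labellingsFrom-suc l b i []        = refl
    labellingsFrom-suc l b i {suc n} (i′ ∷ is) = trans (sum<-suc l _) (trans
      (+-cong (labellingsFrom-⊀ (suc l) (suc b , i) i′ is 0 ≡.refl)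
              (sum<-cong l λ {b′} _ → tail b′ ((b , i) ≺ᵇ (b′ , i′)) ≡.refl))
      (+-identityˡ _))
      where
      tail : ∀ b′ χ → (b , i) ≺ᵇ (b′ , i′) ≡ χ →
        sumᵂ (suc l) n (λ bs → [ (b , i) ≺ᵇ (b′ , i′) ∧ sorted ((suc b′ , i′) ∷ zip bs is) ] 1#) ≈
        sumᵂ l n (λ bs → [ (b , i) ≺ᵇ (b′ , i′) ∧ sorted ((b′ , i′) ∷ zip bs is) ] 1#)
      tail b′ true  eq rewrite eq = labellingsFrom-suc l b′ i′ is
      tail b′ false eq rewrite eq = trans (sumᵂ-zero (suc l) n) (sym (sumᵂ-zero l n))

    -- The first label is the least one. If it is 0, `labellingsFrom` counts the rest; if not, all
    -- labels can be lowered by one.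
    labellings-suc : ∀ l i {n} (is : Vec ℕ n) →
      labellings (suc l) (i ∷ is) ≈ labellings l (i ∷ is) + labellingsFrom (suc l) (0 , i) is
    labellings-suc l i is = trans (sum<-suc l _) (trans (+-comm _ _)
      (+-congʳ (sum<-cong l λ {b} _ → labellingsFrom-suc l b i is)))

    ≺ᵇ-positive : ∀ i j b → (0 , i) ≺ᵇ (suc b , j) ≡ true
    ≺ᵇ-positive i j b = dec-true ((0 , i) ≺? (suc b , j)) (inj₁ z<s)

    -- After the label 0, the next label may be 0 again only if its position is larger. So an ascent
    -- imposes no condition, while a nonascent makes all later labels positive, and they can be
    -- lowered by one.
    labellingsFrom-< : ∀ l i i′ {n} (is : Vec ℕ n) → i < i′ →
      labellingsFrom (suc l) (0 , i) (i′ ∷ is) ≈ labellings (suc l) (i′ ∷ is)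
    labellingsFrom-< l i i′ is i<i′ = sum<-cong (suc l) λ
      { {zero}  _ → labellingsFrom-∷ (suc l) (0 , i) i′ is 0 (dec-true ((0 , i) ≺? (0 , i′)) (inj₂ (≡.refl , i<i′)))
      ; {suc b} _ → labellingsFrom-∷ (suc l) (0 , i) i′ is (suc b) (≺ᵇ-positive i i′ b) }

    labellingsFrom-≮ : ∀ l i i′ {n} (is : Vec ℕ n) → ¬ (i < i′) →
      labellingsFrom (suc l) (0 , i) (i′ ∷ is) ≈ labellings l (i′ ∷ is)
    labellingsFrom-≮ l i i′ is i≮i′ = trans (sum<-suc l _) (trans
      (+-cong (labellingsFrom-⊀ (suc l) (0 , i) i′ is 0
                (dec-false ((0 , i) ≺? (0 , i′)) λ { (inj₂ (_ , i<i′)) → i≮i′ i<i′ }))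
              (sum<-cong l λ {b} _ → trans (labellingsFrom-∷ (suc l) (0 , i) i′ is (suc b) (≺ᵇ-positive i i′ b))
                                           (labellingsFrom-suc l b i′ is)))
      (+-identityˡ _))

  -- Power series in a nilpotent element and the count of P-partitions

  module GeneratingFunctions (X : Carrier) (N : ℕ) (X-nilpotent : X ^ suc N ≈ 0#) where
    open IntegerSolver R

    series : (ℕ → Carrier) → Carrier
    series f = sum< (suc N) λ l → X ^ l * f l

    -- The shift creates a top term with `X ^ suc N`, which vanishes, so both series may stop at the
    -- same index.
    series-shift : ∀ f → f 0 ≈ 0# → series f ≈ X * series (f ∘ suc)
    series-shift f f₀≈0 = begin
      series f
        ≈⟨ trans (+-congˡ (trans (*-congʳ X-nilpotent) (zeroˡ _))) (+-identityʳ _) ⟨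
      series f + X ^ suc N * f (suc N)
        ≈⟨ sum<-suc (suc N) (λ l → X ^ l * f l) ⟩
      1# * f 0 + sum< (suc N) (λ l → X * X ^ l * f (suc l))
        ≈⟨ +-cong (trans (*-identityˡ _) f₀≈0) (sum<-cong (suc N) λ _ → *-assoc _ _ _) ⟩
      0# + sum< (suc N) (λ l → X * (X ^ l * f (suc l)))
        ≈⟨ trans (+-identityˡ _) (sym (sum<-*ˡ (suc N) X _)) ⟩
      X * series (f ∘ suc)
        ∎

    series-+ : ∀ f g → series (λ l → f l + g l) ≈ series f + series g
    series-+ f g = trans (sum<-cong (suc N) λ _ → distribˡ _ _ _) (sum<-+ (suc N) _ _)

    series-cong : ∀ {f g} → (∀ l → f l ≈ g l) → series f ≈ series g
    series-cong f≈g = sum<-cong (suc N) λ {l} _ → *-congˡ (f≈g l)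

    -- Multiplication by `1# - X` is the difference operator; as `f 0` vanishes there is no boundary
    -- term.
    series-difference : ∀ f g → f 0 ≈ 0# → (∀ l → f (suc l) ≈ f l + g l) →
      (1# - X) * series (f ∘ suc) ≈ series g
    series-difference f g f₀≈0 step = begin
      (1# - X) * series (f ∘ suc)
        ≈⟨ solve 2 (λ X a → (:1 :- X) :* a := a :- X :* a) refl X _ ⟩
      series (f ∘ suc) - X * series (f ∘ suc)
        ≈⟨ +-cong (trans (series-cong step) (series-+ f g)) (-‿cong (sym (series-shift f f₀≈0))) ⟩
      series f + series g - series f
        ≈⟨ solve 2 (λ a b → a :+ b :- a := b) refl _ _ ⟩
      series g
        ∎

    series-1 : (1# - X) * series (λ _ → 1#) ≈ 1#
    series-1 = begin
      (1# - X) * series (λ _ → 1#)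
        -- The constant sequence is the shift of `step`, which starts at 0 and has the differences
        -- `δ`.
        ≈⟨ series-difference step δ refl (λ { zero → sym (+-identityˡ 1#) ; (suc _) → sym (+-identityʳ 1#) }) ⟩
      series δ
        ≈⟨ sum<-suc N _ ⟩
      1# * 1# + sum< N (λ l → X ^ suc l * 0#)
        ≈⟨ +-cong (*-identityˡ 1#) (sum<-zero N λ _ → zeroʳ _) ⟩
      1# + 0#
        ≈⟨ +-identityʳ 1# ⟩
      1#
        ∎
      where
      step δ : ℕ → Carrier
      step zero    = 0#
      step (suc _) = 1#
      δ zero    = 1#
      δ (suc _) = 0#

    -- Stanley's series for the P-partitions of a labelled chain. Removing the least element uses up
    -- one factor `1# - X`; a nonascent there shifts the alphabet by one and leaves a factor `X`. A
    -- single element has `suc l` labellings, whence the two factors of the base case.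
    labellings-series : ∀ {n} (is : Vec ℕ (suc n)) →
      (1# - X) ^ suc (suc n) * series (λ l → labellings (suc l) is) ≈ X ^ nonascents is
    labellings-series (i ∷ []) = begin
      (1# - X) * ((1# - X) * 1#) * series (λ l → labellings (suc l) (i ∷ []))
        ≈⟨ solve 2 (λ Y a → Y :* (Y :* :1) :* a := Y :* (Y :* a)) refl (1# - X) _ ⟩
      (1# - X) * ((1# - X) * series (λ l → labellings (suc l) (i ∷ [])))
        ≈⟨ *-congˡ (series-difference (λ l → labellings l (i ∷ [])) (λ _ → 1#) refl (λ l → labellings-suc l i [])) ⟩
      (1# - X) * series (λ _ → 1#)
        ≈⟨ series-1 ⟩
      1#
        ∎
    labellings-series {suc n} (i ∷ i′ ∷ is) = begin
      (1# - X) * Y * series (λ l → labellings (suc l) (i ∷ i′ ∷ is))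
        ≈⟨ solve 3 (λ X Y a → X :* Y :* a := Y :* (X :* a)) refl (1# - X) Y _ ⟩
      Y * ((1# - X) * series (λ l → labellings (suc l) (i ∷ i′ ∷ is)))
        ≈⟨ *-congˡ (series-difference (λ l → labellings l (i ∷ i′ ∷ is)) _ refl (λ l → labellings-suc l i (i′ ∷ is))) ⟩
      Y * series (λ l → labellingsFrom (suc l) (0 , i) (i′ ∷ is))
        ≈⟨ step (i ℕ.<? i′) ⟩
      X ^ nonascents (i ∷ i′ ∷ is)
        ∎
      where
      Y : Carrier
      Y = (1# - X) ^ suc (suc n)
      step : (d : Dec (i < i′)) → Y * series (λ l → labellingsFrom (suc l) (0 , i) (i′ ∷ is)) ≈
        X ^ (bit (not (does d)) ℕ.+ nonascents (i′ ∷ is))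
      step (yes i<i′) = trans (*-congˡ (series-cong λ l → labellingsFrom-< l i i′ is i<i′)) (labellings-series (i′ ∷ is))
      step (no  i≮i′) = begin
        Y * series (λ l → labellingsFrom (suc l) (0 , i) (i′ ∷ is))
          ≈⟨ *-congˡ (series-cong λ l → labellingsFrom-≮ l i i′ is i≮i′) ⟩
        Y * series (λ l → labellings l (i′ ∷ is))
          ≈⟨ *-congˡ (series-shift _ refl) ⟩
        Y * (X * series (λ l → labellings (suc l) (i′ ∷ is)))
          ≈⟨ solve 3 (λ X Y a → Y :* (X :* a) := X :* (Y :* a)) refl X Y _ ⟩
        X * (Y * series (λ l → labellings (suc l) (i′ ∷ is)))
          ≈⟨ *-congˡ (labellings-series (i′ ∷ is)) ⟩
        X * X ^ nonascents (i′ ∷ is)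
          ∎

-- Permutation statistics

countᵇ : ∀ {n} → (Fin n → Bool) → ℕ
countᵇ {zero}  b = 0
countᵇ {suc n} b = bit (b zero) ℕ.+ countᵇ (b ∘ suc)

countᵇ-cong : ∀ {n} {b c : Fin n → Bool} → (∀ i → b i ≡ c i) → countᵇ b ≡ countᵇ c
countᵇ-cong {zero}  b≡c = ≡.refl
countᵇ-cong {suc n} b≡c = cong₂ (λ d m → bit d ℕ.+ m) (b≡c zero) (countᵇ-cong (b≡c ∘ suc))

count≡countᵇ : ∀ {n} {P : Fin n → Set} (P? : Decidable P) → count P? ≡ countᵇ (does ∘ P?)
count≡countᵇ {P = P} P? = go (λ i → i)
  where
  go : ∀ {m} (g : Fin m → Fin _) → length (filter P? (List.tabulate g)) ≡ countᵇ (does ∘ P? ∘ g)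
  go {zero}  g = ≡.refl
  go {suc m} g with does (P? (g zero))
  ... | true  = cong suc (go (g ∘ suc))
  ... | false = go (g ∘ suc)

-- Each adjacent pair is counted in exactly one of the two summands; the last letter is counted in
-- the first.
nondescents-tabulate : ∀ {n} (f : Fin (suc n) → ℕ) →
  nondescents (toList (tabulate f)) ℕ.+ countᵇ (λ i → does (f (suc i) ℕ.<? f (inject₁ i))) ≡ suc n
nondescents-tabulate {zero}  f = ≡.refl
nondescents-tabulate {suc n} f = case f zero ℕ.≤? f (suc zero) of λ where
    (yes f₀≤f₁) → ≡.trans
      (cong₂ (λ a b → bit a ℕ.+ X ℕ.+ (bit b ℕ.+ Y)) (dec-true (f zero ℕ.≤? f (suc zero)) f₀≤f₁)
        (dec-false (f (suc zero) ℕ.<? f zero) (ℕ.≤⇒≯ f₀≤f₁)))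
      (cong suc (nondescents-tabulate (f ∘ suc)))
    (no  f₀≰f₁) → ≡.trans
      (cong₂ (λ a b → bit a ℕ.+ X ℕ.+ (bit b ℕ.+ Y)) (dec-false (f zero ℕ.≤? f (suc zero)) f₀≰f₁)
        (dec-true (f (suc zero) ℕ.<? f zero) (ℕ.≰⇒> f₀≰f₁)))
      (≡.trans (ℕ.+-suc X Y) (cong suc (nondescents-tabulate (f ∘ suc))))
  where
  X Y : ℕ
  X = nondescents (toList (tabulate (f ∘ suc)))
  Y = countᵇ (λ i → does (f (suc (suc i)) ℕ.<? f (suc (inject₁ i))))

nonascents-tabulate : ∀ {n} (f : Fin (suc n) → ℕ) → (∀ i → f (suc i) ≢ f (inject₁ i)) →
  nonascents (tabulate f) ≡ countᵇ (λ i → does (f (suc i) ℕ.<? f (inject₁ i)))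
nonascents-tabulate {zero}  f f≢ = ≡.refl
nonascents-tabulate {suc n} f f≢ = cong₂ (λ b m → bit b ℕ.+ m)
  (case (f zero ℕ.<? f (suc zero)) of λ where
    (yes f₀<f₁) → ≡.trans (cong not (dec-true (f zero ℕ.<? f (suc zero)) f₀<f₁))
                        (≡.sym (dec-false (f (suc zero) ℕ.<? f zero) (ℕ.<⇒≯ f₀<f₁)))
    (no  f₀≮f₁) → ≡.trans (cong not (dec-false (f zero ℕ.<? f (suc zero)) f₀≮f₁))
                        (≡.sym (dec-true (f (suc zero) ℕ.<? f zero) (ℕ.≤∧≢⇒< (ℕ.≮⇒≥ f₀≮f₁) (f≢ zero)))))
  (nonascents-tabulate (f ∘ suc) (f≢ ∘ suc))

-- The condition `m ≤ f i` carries the running maximum through the induction. The decision procedure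
-- is arbitrary, as `does-⇔` makes its outcome depend on the property alone.
lmaxFrom-tabulate : ∀ {n} m (f : Fin n → ℕ) →
  (P? : ∀ i → Dec (m ≤ f i × ∀ j → j Fin.< i → f j ≤ f i)) →
  lmaxFrom m (toList (tabulate f)) ≡ countᵇ (does ∘ P?)
lmaxFrom-tabulate {zero}  m f P? = ≡.refl
lmaxFrom-tabulate {suc n} m f P? = cong₂ (λ b k → bit b ℕ.+ k)
  (does-⇔ (mk⇔ (λ m≤f₀ → m≤f₀ , λ j ()) proj₁) (m ℕ.≤? f zero) (P? zero))
  (≡.trans (lmaxFrom-tabulate (m ⊔ f zero) (f ∘ suc) Q?)
         (countᵇ-cong λ i → does-⇔ (mk⇔ (to i) (from i)) (Q? i) (P? (suc i))))
  where
  Q : Fin n → Set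
  Q i = m ⊔ f zero ≤ f (suc i) × ∀ j → j Fin.< i → f (suc j) ≤ f (suc i)
  to : ∀ i → Q i → m ≤ f (suc i) × ∀ j → j Fin.< suc i → f j ≤ f (suc i)
  to i (m⊔f₀≤fᵢ , fⱼ≤fᵢ) = ℕ.≤-trans (ℕ.m≤m⊔n m (f zero)) m⊔f₀≤fᵢ , λ where
    zero    _         → ℕ.≤-trans (ℕ.m≤n⊔m m (f zero)) m⊔f₀≤fᵢ
    (suc j) (s<s j<i) → fⱼ≤fᵢ j j<i
  from : ∀ i → (m ≤ f (suc i) × ∀ j → j Fin.< suc i → f j ≤ f (suc i)) → Q i
  from i (m≤fᵢ , fⱼ≤fᵢ) = ℕ.⊔-lub m≤fᵢ (fⱼ≤fᵢ zero z<s) , λ j j<i → fⱼ≤fᵢ (suc j) (s<s j<i)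
  Q? : ∀ i → Dec (Q i)
  Q? i = Dec.map (mk⇔ (from i) (to i)) (P? (suc i))

rmaxʷ-tabulate : ∀ {n} (f : Fin n → ℕ) →
  (P? : ∀ i → Dec (∀ j → i Fin.< j → f j < f i)) →
  rmaxʷ (toList (tabulate f)) ≡ countᵇ (does ∘ P?)
rmaxʷ-tabulate {zero}  f P? = ≡.refl
rmaxʷ-tabulate {suc n} f P? = cong₂ (λ b k → bit b ℕ.+ k)
  (does-⇔ (mk⇔ (λ f<f₀ → λ { (suc j) _ → Vecᴬ.tabulate⁻ (Vecᴬ.toList⁻ f<f₀) j })
               (λ f<f₀ → Vecᴬ.toList⁺ (Vecᴬ.tabulate⁺ λ j → f<f₀ (suc j) z<s)))
    (All.all? (ℕ._<? f zero) (toList (tabulate (f ∘ suc)))) (P? zero))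
  (≡.trans (rmaxʷ-tabulate (f ∘ suc) Q?)
         (countᵇ-cong λ i → does-⇔ (mk⇔ (to i) (from i)) (Q? i) (P? (suc i))))
  where
  Q : Fin n → Set
  Q i = ∀ j → i Fin.< j → f (suc j) < f (suc i)
  to : ∀ i → Q i → ∀ j → suc i Fin.< j → f j < f (suc i)
  to i fⱼ<fᵢ (suc j) (s<s i<j) = fⱼ<fᵢ j i<j
  from : ∀ i → (∀ j → suc i Fin.< j → f j < f (suc i)) → Q i
  from i fⱼ<fᵢ j i<j = fⱼ<fᵢ (suc j) (s<s i<j)
  Q? : ∀ i → Dec (Q i)
  Q? i = Dec.map (mk⇔ (from i) (to i)) (P? (suc i))

sorted-head : ∀ {n} p (ps : Vec (ℕ × ℕ) n) → sorted (p ∷ ps) ≡ true → ∀ i → p ≺ lookup ps i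
sorted-head p (q ∷ ps) s zero    = ≺ᵇ⇒≺ p q (Bool.∧-conicalˡ _ _ s)
sorted-head p (q ∷ ps) s (suc i) = ≺-trans (≺ᵇ⇒≺ p q (Bool.∧-conicalˡ _ _ s))
  (sorted-head q ps (Bool.∧-conicalʳ (p ≺ᵇ q) _ s) i)

sorted-tail : ∀ {n} p (ps : Vec (ℕ × ℕ) n) → sorted (p ∷ ps) ≡ true → sorted ps ≡ true
sorted-tail p []       s = ≡.refl
sorted-tail p (q ∷ ps) s = Bool.∧-conicalʳ (p ≺ᵇ q) _ s

sorted-lookup : ∀ {n} (ps : Vec (ℕ × ℕ) n) → sorted ps ≡ true → ∀ {i j} → i Fin.< j → lookup ps i ≺ lookup ps j
sorted-lookup (p ∷ ps) s {zero}  {suc j} _         = sorted-head p ps s j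
sorted-lookup (p ∷ ps) s {suc i} {suc j} (s<s i<j) = sorted-lookup ps (sorted-tail p ps s) i<j

⟨$⟩ˡ-injective : ∀ {n} (π : Permutation′ n) {i j} → π ⟨$⟩ˡ i ≡ π ⟨$⟩ˡ j → i ≡ j
⟨$⟩ˡ-injective π eq = ≡.trans (≡.sym (Perm.inverseʳ π)) (≡.trans (cong (π ⟨$⟩ʳ_) eq) (Perm.inverseʳ π))

⟨$⟩ʳ-injective : ∀ {n} (π : Permutation′ n) {i j} → π ⟨$⟩ʳ i ≡ π ⟨$⟩ʳ j → i ≡ j
⟨$⟩ʳ-injective π eq = ≡.trans (≡.sym (Perm.inverseˡ π)) (≡.trans (cong (π ⟨$⟩ˡ_) eq) (Perm.inverseˡ π))

ides≡nonascents : ∀ {n} (π : Permutation′ (suc n)) → ides π ≡ nonascents (positions π)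
ides≡nonascents π = ≡.trans
  (count≡countᵇ (λ i → (π ⟨$⟩ˡ suc i) Fin.<? (π ⟨$⟩ˡ inject₁ i)))
  (≡.sym (nonascents-tabulate (λ p → toℕ (π ⟨$⟩ˡ p)) λ i eq →
    ℕ.1+n≢n {toℕ i} (≡.trans (cong toℕ (⟨$⟩ˡ-injective π {suc i} (Fin.toℕ-injective eq))) (Fin.toℕ-inject₁ i))))

module _ {n} (π : Permutation′ n) (b : Vec ℕ n) (s : sorted (zip b (positions π)) ≡ true) where

  private
    c : Fin n → ℕ
    c i = lookup b (π ⟨$⟩ʳ i)

  labelled : ∀ i → lookup (zip b (positions π)) (π ⟨$⟩ʳ i) ≡ (c i , toℕ i)
  labelled i = ≡.trans (Vec.lookup-zip (π ⟨$⟩ʳ i) b (positions π))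
    (cong (c i ,_) (≡.trans (Vec.lookup∘tabulate _ (π ⟨$⟩ʳ i)) (cong toℕ (Perm.inverseˡ π))))

  ordered : ∀ {i j} → (π ⟨$⟩ʳ i) Fin.< (π ⟨$⟩ʳ j) → (c i , toℕ i) ≺ (c j , toℕ j)
  ordered {i} {j} πi<πj = ≡.subst₂ _≺_ (labelled i) (labelled j) (sorted-lookup (zip b (positions π)) s πi<πj)

  -- Sortedness makes smaller values of `π` correspond to smaller pairs of letter and position. For
  -- `i < j` a tie between the letters would favour `i`, so an inversion forces a strictly smaller
  -- letter.
  inversion⇒ : ∀ {i j} → i Fin.< j → (π ⟨$⟩ʳ j) Fin.< (π ⟨$⟩ʳ i) → c j < c i
  inversion⇒ {i} {j} i<j πj<πi with ordered {j} {i} πj<πi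
  ... | inj₁ cj<ci     = cj<ci
  ... | inj₂ (_ , j<i) = contradiction j<i (ℕ.<⇒≯ i<j)

  noninversion⇒ : ∀ {i j} → (π ⟨$⟩ʳ i) Fin.< (π ⟨$⟩ʳ j) → c i ≤ c j
  noninversion⇒ {i} {j} πi<πj with ordered {i} {j} πi<πj
  ... | inj₁ ci<cj       = ℕ.<⇒≤ ci<cj
  ... | inj₂ (ci≡cj , _) = ℕ.≤-reflexive ci≡cj

  inversion⇐ : ∀ {i j} → c j < c i → (π ⟨$⟩ʳ j) Fin.< (π ⟨$⟩ʳ i)
  inversion⇐ {i} {j} cj<ci with Fin.<-cmp (π ⟨$⟩ʳ j) (π ⟨$⟩ʳ i)
  ... | tri< πj<πi _ _ = πj<πi
  ... | tri≈ _ πj≡πi _ = contradiction cj<ci (ℕ.≤⇒≯ (ℕ.≤-reflexive (cong (lookup b) (≡.sym πj≡πi))))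
  ... | tri> _ _ πi<πj = contradiction cj<ci (ℕ.≤⇒≯ (noninversion⇒ πi<πj))

  noninversion⇐ : ∀ {i j} → i Fin.< j → c i ≤ c j → (π ⟨$⟩ʳ i) Fin.< (π ⟨$⟩ʳ j)
  noninversion⇐ {i} {j} i<j ci≤cj with Fin.<-cmp (π ⟨$⟩ʳ i) (π ⟨$⟩ʳ j)
  ... | tri< πi<πj _ _ = πi<πj
  ... | tri≈ _ πi≡πj _ = contradiction (cong toℕ (⟨$⟩ʳ-injective π πi≡πj)) (ℕ.<⇒≢ i<j)
  ... | tri> _ _ πj<πi = contradiction (inversion⇒ i<j πj<πi) (ℕ.≤⇒≯ ci≤cj)

  lmaxFrom≡lmax : lmaxFrom 0 (toList (b ∘ᵂ π)) ≡ lmax π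
  lmaxFrom≡lmax = ≡.trans (lmaxFrom-tabulate 0 c P?)
    (≡.trans (countᵇ-cong λ i → does-⇔ (mk⇔ (to i) (from i)) (P? i) (Q? i)) (≡.sym (count≡countᵇ Q?)))
    where
    Q : Fin n → Set
    Q i = ∀ j → j Fin.< i → (π ⟨$⟩ʳ j) Fin.< (π ⟨$⟩ʳ i)
    Q? : ∀ i → Dec (Q i)
    Q? i = Fin.all? λ j → (j Fin.<? i) →-dec ((π ⟨$⟩ʳ j) Fin.<? (π ⟨$⟩ʳ i))
    P : Fin n → Set
    P i = 0 ≤ c i × ∀ j → j Fin.< i → c j ≤ c i
    to : ∀ i → P i → Q i
    to i (_ , cj≤ci) j j<i = noninversion⇐ j<i (cj≤ci j j<i)
    from : ∀ i → Q i → P i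
    from i πj<πi = z≤n , λ j j<i → noninversion⇒ (πj<πi j j<i)
    P? : ∀ i → Dec (P i)
    P? i = Dec.map (mk⇔ (from i) (to i)) (Q? i)

  rmaxʷ≡rmax : rmaxʷ (toList (b ∘ᵂ π)) ≡ rmax π
  rmaxʷ≡rmax = ≡.trans (rmaxʷ-tabulate c P?)
    (≡.trans (countᵇ-cong λ i → does-⇔ (mk⇔ (to i) (from i)) (P? i) (Q? i)) (≡.sym (count≡countᵇ Q?)))
    where
    Q : Fin n → Set
    Q i = ∀ j → i Fin.< j → (π ⟨$⟩ʳ j) Fin.< (π ⟨$⟩ʳ i)
    Q? : ∀ i → Dec (Q i)
    Q? i = Fin.all? λ j → (i Fin.<? j) →-dec ((π ⟨$⟩ʳ j) Fin.<? (π ⟨$⟩ʳ i))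
    P : Fin n → Set
    P i = ∀ j → i Fin.< j → c j < c i
    to : ∀ i → P i → Q i
    to i cj<ci j i<j = inversion⇐ (cj<ci j i<j)
    from : ∀ i → Q i → P i
    from i πj<πi j i<j = inversion⇒ i<j (πj<πi j i<j)
    P? : ∀ i → Dec (P i)
    P? i = Dec.map (mk⇔ (from i) (to i)) (Q? i)

nondescents≡n∸des : ∀ {n} (π : Permutation′ n) b → sorted (zip b (positions π)) ≡ true →
  nondescents (toList (b ∘ᵂ π)) ≡ n ∸ des π
nondescents≡n∸des {zero}  π b s = ≡.refl
nondescents≡n∸des {suc n} π b s = begin
  nondescents (toList (b ∘ᵂ π))
    ≡⟨ ℕ.m+n∸n≡m _ (des π) ⟨
  nondescents (toList (b ∘ᵂ π)) ℕ.+ des π ∸ des π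
    ≡⟨ cong (λ d → nondescents (toList (b ∘ᵂ π)) ℕ.+ d ∸ des π)
         (≡.trans (count≡countᵇ D?) (countᵇ-cong λ i → does-⇔
           (mk⇔ (inversion⇒ π b s (i<1+i i)) (inversion⇐ π b s)) (D? i) (c (suc i) ℕ.<? c (inject₁ i)))) ⟩
  nondescents (toList (tabulate c)) ℕ.+ countᵇ (λ i → does (c (suc i) ℕ.<? c (inject₁ i))) ∸ des π
    ≡⟨ cong (_∸ des π) (nondescents-tabulate c) ⟩
  suc n ∸ des π
    ∎
  where
  open ≡.≡-Reasoning
  c : Fin (suc n) → ℕ
  c i = lookup b (π ⟨$⟩ʳ i)
  D? : ∀ i → Dec ((π ⟨$⟩ʳ suc i) Fin.< (π ⟨$⟩ʳ inject₁ i))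
  D? i = (π ⟨$⟩ʳ suc i) Fin.<? (π ⟨$⟩ʳ inject₁ i)
  i<1+i : ∀ (i : Fin n) → inject₁ i Fin.< suc i
  i<1+i i = s≤s (ℕ.≤-reflexive (Fin.toℕ-inject₁ i))

-- Functional equations in an abstract ring

module EulerStirling (R : CommutativeRing 0ℓ 0ℓ) where
  open CommutativeRing R hiding (zero)
  open IntegerSolver R
  open Sums R
  open Words R
  open Standardization R
  open Relation.Binary.Reasoning.Setoid setoid

  module _ (w s t : Carrier) (M : ℕ) (s-nilpotent : s ^ suc M ≈ 0#) (s[w-1]≈t : s * (w - 1#) ≈ t) where
    open WordSeries w s M s-nilpotent

    permutationWeight : Carrier → Carrier → ∀ {n} → Permutation′ n → Carrier
    permutationWeight V Z {n} π = w ^ (n ∸ des π) * V ^ rmax π * Z ^ lmax π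

    -- The weight of a word depends on its standardization only, so it factors out of the sum over
    -- the labellings.
    words-permutations : ∀ V Z l n →
      words V Z l n ≈ sumL (𝔖 n) (λ π → permutationWeight V Z π * labellings l (positions π))
    words-permutations V Z l n = trans (standardization l n (weight V Z ∘ Vec.toList))
      (sumL-cong (𝔖 n) λ π → trans
        (sumᵂ-cong′ l n λ b → transfer π b (sorted (zip b (positions π))) ≡.refl)
        (sym (sumᵂ-*ˡ l n (permutationWeight V Z π) _)))
      where
      transfer : ∀ π b χ → sorted (zip b (positions π)) ≡ χ →
        ([ χ ] weight V Z (Vec.toList (b ∘ᵂ π))) ≈ permutationWeight V Z π * ([ χ ] 1#)
      transfer π b true  sorted≡ = trans
        (*-cong (*-cong (reflexive (cong (w ^_) (nondescents≡n∸des π b sorted≡)))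
                        (reflexive (cong (V ^_) (rmaxʷ≡rmax π b sorted≡))))
                (reflexive (cong (Z ^_) (lmaxFrom≡lmax π b sorted≡))))
        (sym (*-identityʳ _))
      transfer π b false sorted≡ = sym (zeroʳ _)

    B : Carrier → ℕ → Carrier
    B V l = w - 1# + E V 1# l

    increment : Carrier → Carrier → ℕ → Carrier
    increment V Z l = s * V * Z * (E 1# Z (suc l) * B V l)

    module _ (X : Carrier) (N : ℕ) (X-nilpotent : X ^ suc N ≈ 0#)
      (ι : ℕ → Carrier) (ι-inverse : ∀ n → ι n * ((w - 1#) ^ n * (1# - X) ^ n) ≈ 1#) where
      open GeneratingFunctions X N X-nilpotent

      -- Since `t = s * (w - 1#)`, the power of `w - 1#` in the denominator of the generating
      -- function cancels. `labellings-series` supplies one more factor `1# - X` than that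
      -- denominator absorbs; the surplus factor later takes differences in the number of letters.
      sum-permutations : ∀ V Z m → let n = suc m in
        t ^ n * sumL (𝔖 n) (λ π → w ^ (n ∸ des π) * X ^ ides π * 1# ^ lmin π * V ^ rmax π * Z ^ lmax π * ι n)
          ≈ (1# - X) * series (λ l → s ^ n * words V Z (suc l) n)
      sum-permutations V Z m = begin
        t ^ n * sumL (𝔖 n) (λ π → w ^ (n ∸ des π) * X ^ ides π * 1# ^ lmin π * V ^ rmax π * Z ^ lmax π * ι n)
          ≈⟨ sumL-*ˡ (𝔖 n) _ _ ⟩
        sumL (𝔖 n) (λ π → t ^ n * (w ^ (n ∸ des π) * X ^ ides π * 1# ^ lmin π * V ^ rmax π * Z ^ lmax π * ι n))
          ≈⟨ sumL-cong (𝔖 n) term ⟩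
        sumL (𝔖 n) (λ π → (1# - X) * (permutationWeight V Z π * series (λ l → s ^ n * labellings (suc l) (positions π))))
          ≈⟨ sumL-*ˡ (𝔖 n) _ _ ⟨
        (1# - X) * sumL (𝔖 n) (λ π → permutationWeight V Z π * series (λ l → s ^ n * labellings (suc l) (positions π)))
          ≈⟨ *-congˡ (sumL-cong (𝔖 n) λ π → sum<-*ˡ (suc N) _ _) ⟩
        (1# - X) * sumL (𝔖 n) (λ π → sum< (suc N) λ l → permutationWeight V Z π * (X ^ l * (s ^ n * labellings (suc l) (positions π))))
          ≈⟨ *-congˡ (sum<-sumL (suc N) (𝔖 n) _) ⟨
        (1# - X) * sum< (suc N) (λ l → sumL (𝔖 n) λ π → permutationWeight V Z π * (X ^ l * (s ^ n * labellings (suc l) (positions π))))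
          ≈⟨ *-congˡ (sum<-cong (suc N) λ {l} _ → trans
               (sumL-cong (𝔖 n) λ π → solve 4 (λ p X s a → p :* (X :* (s :* a)) := X :* s :* (p :* a)) refl _ _ _ _)
               (trans (sym (sumL-*ˡ (𝔖 n) _ _)) (trans (*-assoc _ _ _)
                 (*-congˡ (*-congˡ (sym (words-permutations V Z (suc l) n))))))) ⟩
        (1# - X) * series (λ l → s ^ n * words V Z (suc l) n)
          ∎
        where
        n : ℕ
        n = suc m
        term : ∀ π → t ^ n * (w ^ (n ∸ des π) * X ^ ides π * 1# ^ lmin π * V ^ rmax π * Z ^ lmax π * ι n) ≈
          (1# - X) * (permutationWeight V Z π * series (λ l → s ^ n * labellings (suc l) (positions π)))
        term π = begin
          t ^ n * (a * X ^ ides π * 1# ^ lmin π * b * c * ι n)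
            ≈⟨ *-cong (trans (^-congˡ n (sym s[w-1]≈t)) (^-distrib-* s (w - 1#) n))
                 (*-congʳ (*-congʳ (*-congʳ (*-cong (*-congˡ (trans (reflexive (cong (X ^_) (ides≡nonascents π)))
                   (sym (labellings-series (positions π))))) (1^ (lmin π)))))) ⟩
          s ^ n * (w - 1#) ^ n * (a * ((1# - X) * (1# - X) ^ n * Λ) * 1# * b * c * ι n)
            ≈⟨ solve 9 (λ s W a Y Yⁿ Λ b c ι →
                 s :* W :* (a :* (Y :* Yⁿ :* Λ) :* :1 :* b :* c :* ι) := Y :* (a :* b :* c :* (s :* Λ)) :* (ι :* (W :* Yⁿ)))
                 refl (s ^ n) ((w - 1#) ^ n) a (1# - X) ((1# - X) ^ n) Λ b c (ι n) ⟩
          (1# - X) * (a * b * c * (s ^ n * Λ)) * (ι n * ((w - 1#) ^ n * (1# - X) ^ n))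
            ≈⟨ trans (*-congˡ (ι-inverse n)) (*-identityʳ _) ⟩
          (1# - X) * (a * b * c * (s ^ n * Λ))
            ≈⟨ *-congˡ (*-congˡ (trans (sum<-*ˡ (suc N) _ _) (sum<-cong (suc N) λ _ →
                 solve 3 (λ s X a → s :* (X :* a) := X :* (s :* a)) refl _ _ _))) ⟩
          (1# - X) * (a * b * c * series (λ l → s ^ n * labellings (suc l) (positions π)))
            ∎
          where
          a b c Λ : Carrier
          a = w ^ (n ∸ des π)
          b = V ^ rmax π
          c = Z ^ lmax π
          Λ = series (λ l → labellings (suc l) (positions π))

      generating-function : ∀ V Z →
        sum< M (λ m → let n = suc m in
          t ^ n * sumL (𝔖 n) (λ π → w ^ (n ∸ des π) * X ^ ides π * 1# ^ lmin π * V ^ rmax π * Z ^ lmax π * ι n))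
            ≈ series (increment V Z)
      generating-function V Z = begin
        sum< M (λ m → let n = suc m in
          t ^ n * sumL (𝔖 n) (λ π → w ^ (n ∸ des π) * X ^ ides π * 1# ^ lmin π * V ^ rmax π * Z ^ lmax π * ι n))
          ≈⟨ sum<-cong M (λ {m} _ → sum-permutations V Z m) ⟩
        sum< M (λ m → (1# - X) * series (λ l → s ^ suc m * words V Z (suc l) (suc m)))
          ≈⟨ sum<-*ˡ M _ _ ⟨
        (1# - X) * sum< M (λ m → series (λ l → s ^ suc m * words V Z (suc l) (suc m)))
          ≈⟨ *-congˡ (sum<-swap M (suc N) _) ⟩
        (1# - X) * sum< (suc N) (λ l → sum< M λ m → X ^ l * (s ^ suc m * words V Z (suc l) (suc m)))
          ≈⟨ *-congˡ (sum<-cong (suc N) λ {l} _ → trans (sym (sum<-*ˡ M _ _)) (*-congˡ (begin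
               sum< M (λ m → s ^ suc m * words V Z (suc l) (suc m))
                 -- Permutations start at `n = 1`, so the empty word is added to complete `E` and
                 -- then removed; `E V Z l - 1#` vanishes at `l = 0`, as `series-difference`
                 -- demands.
                 ≈⟨ solve 1 (λ a → a := :1 :* (:1 :* :1 :* :1) :+ a :- :1) refl _ ⟩
               1# * (1# * 1# * 1#) + sum< M (λ m → s ^ suc m * words V Z (suc l) (suc m)) - 1#
                 ≈⟨ +-congʳ (sum<-suc M (λ m → s ^ m * words V Z (suc l) m)) ⟨
               E V Z (suc l) - 1#
                 ∎))) ⟩
        (1# - X) * series (λ l → E V Z (suc l) - 1#)
          ≈⟨ series-difference (λ l → E V Z l - 1#) (increment V Z)
               (trans (+-congʳ (E-zero V Z)) (-‿inverseʳ 1#))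
               (λ l → trans (+-congʳ (E-suc V Z l)) (solve 2 (λ a b → a :+ b :- :1 := a :- :1 :+ b) refl _ _)) ⟩
        series (increment V Z)
          ∎

    r : Carrier
    r = 1# - t

    -- With `e = E 1# 1# l` and `e′ = E 1# 1# (suc l)`, the quadratic recursion `E-suc` is linear in
    -- the reciprocals: `1 / e′ = r / e - s`. Because `s * (w - 1#) ≈ t`, its fixed point is
    -- `1 / (1 - w)`, which leads to the closed form. The proof checks it with denominators cleared.
    E-1-1 : ∀ l → E 1# 1# l * (1# - w * r ^ l) ≈ 1# - w
    E-1-1 zero    = trans (*-congʳ (E-zero 1# 1#)) (solve 1 (λ w → :1 :* (:1 :- w :* :1) := :1 :- w) refl w)
    E-1-1 (suc l) = begin
      e′ * (1# - w * ((1# - t) * r ^ l))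
        ≈⟨ solve 4 (λ e w t ρ → e :* (:1 :- w :* ((:1 :- t) :* ρ)) :=
             e :* (:1 :- w :* ρ) :- t :* (e :* (:1 :- w :* ρ :- :1))) refl e′ w t (r ^ l) ⟩
      e′ * y - t * (e′ * (y - 1#))
        ≈⟨ +-congʳ (begin
             e′ * y
               ≈⟨ *-congʳ (E-suc 1# 1# l) ⟩
             (e + s * 1# * 1# * (e′ * (w - 1# + e))) * y
               ≈⟨ solve 5 (λ e s e′ w y → (e :+ s :* :1 :* :1 :* (e′ :* (w :- :1 :+ e))) :* y :=
                    e :* y :+ s :* e′ :* ((w :- :1) :* y :+ e :* y)) refl e s e′ w y ⟩
             e * y + s * e′ * ((w - 1#) * y + e * y)
               ≈⟨ +-cong (E-1-1 l) (*-congˡ (+-congˡ (E-1-1 l))) ⟩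
             1# - w + s * e′ * ((w - 1#) * y + (1# - w))
               ≈⟨ solve 4 (λ s e′ w y → :1 :- w :+ s :* e′ :* ((w :- :1) :* y :+ (:1 :- w)) :=
                    :1 :- w :+ s :* (w :- :1) :* (e′ :* (y :- :1))) refl s e′ w y ⟩
             1# - w + s * (w - 1#) * (e′ * (y - 1#))
               ≈⟨ +-congˡ (*-congʳ s[w-1]≈t) ⟩
             1# - w + t * (e′ * (y - 1#))
               ∎) ⟩
      1# - w + t * (e′ * (y - 1#)) - t * (e′ * (y - 1#))
        ≈⟨ solve 2 (λ a b → a :+ b :- b := a) refl _ _ ⟩
      1# - w
        ∎
      where
      e e′ y : Carrier
      e = E 1# 1# l
      e′ = E 1# 1# (suc l)
      y = 1# - w * r ^ l

    -- At `V = 1` the recursion `E-suc` is linear in `E 1# Z`, with `e = E 1# 1# l` in its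
    -- coefficient. Multiplying by `y = 1# - w * r ^ l` removes `e` by `E-1-1` and leaves
    -- `(w - 1#) * (y - 1#)`, where `s` turns `w - 1#` into `t`.
    E-1-Z : ∀ Z l → E 1# Z (suc l) * (1# - (1# - t * Z) * (w * r ^ l)) ≈ E 1# Z l * (1# - w * r ^ l)
    E-1-Z Z l = begin
      a′ * (1# - (1# - t * Z) * (w * r ^ l))
        ≈⟨ solve 5 (λ a w t Z ρ → a :* (:1 :- (:1 :- t :* Z) :* (w :* ρ)) :=
             a :* (:1 :- w :* ρ) :- t :* (Z :* (a :* (:1 :- w :* ρ :- :1)))) refl a′ w t Z (r ^ l) ⟩
      a′ * y - t * (Z * (a′ * (y - 1#)))
        ≈⟨ +-congʳ (begin
             a′ * y
               ≈⟨ *-congʳ (E-suc 1# Z l) ⟩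
             (a + s * 1# * Z * (a′ * (w - 1# + e))) * y
               ≈⟨ solve 7 (λ a s Z a′ e w y → (a :+ s :* :1 :* Z :* (a′ :* (w :- :1 :+ e))) :* y :=
                    a :* y :+ s :* Z :* a′ :* ((w :- :1) :* y :+ e :* y)) refl a s Z a′ e w y ⟩
             a * y + s * Z * a′ * ((w - 1#) * y + e * y)
               ≈⟨ +-congˡ (*-congˡ (+-congˡ (E-1-1 l))) ⟩
             a * y + s * Z * a′ * ((w - 1#) * y + (1# - w))
               ≈⟨ solve 6 (λ a s Z a′ w y → a :* y :+ s :* Z :* a′ :* ((w :- :1) :* y :+ (:1 :- w)) :=
                    a :* y :+ s :* (w :- :1) :* (Z :* (a′ :* (y :- :1)))) refl a s Z a′ w y ⟩
             a * y + s * (w - 1#) * (Z * (a′ * (y - 1#)))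
               ≈⟨ +-congˡ (*-congʳ s[w-1]≈t) ⟩
             a * y + t * (Z * (a′ * (y - 1#)))
               ∎) ⟩
      a * y + t * (Z * (a′ * (y - 1#))) - t * (Z * (a′ * (y - 1#)))
        ≈⟨ solve 2 (λ a b → a :+ b :- b := a) refl _ _ ⟩
      a * y
        ∎
      where
      a a′ e y : Carrier
      a = E 1# Z l
      a′ = E 1# Z (suc l)
      e = E 1# 1# l
      y = 1# - w * r ^ l

    B-zero : ∀ V → B V 0 ≈ w
    B-zero V = trans (+-congˡ (E-zero V 1#)) (solve 1 (λ w → w :- :1 :+ :1 := w) refl w)

    B-suc : ∀ V l → B V (suc l) ≈ B V l + increment V 1# l
    B-suc V l = trans (+-congˡ (E-suc V 1# l)) (sym (+-assoc _ _ _))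

    -- At `Z = 1` the recursion of `B` is multiplicative and starts from `w`, so every `B V l` is a
    -- multiple of `w`. This cofactor later witnesses that `x * 𝒯 n` is divisible by `u⁻¹`.
    B/w : Carrier → ℕ → Carrier
    B/w V zero    = 1#
    B/w V (suc l) = B/w V l * (1# + s * V * 1# * E 1# 1# (suc l))

    B≈w*B/w : ∀ V l → B V l ≈ w * B/w V l
    B≈w*B/w V zero    = trans (B-zero V) (sym (*-identityʳ w))
    B≈w*B/w V (suc l) = begin
      B V (suc l)                                ≈⟨ B-suc V l ⟩
      B V l + increment V 1# l                   ≈⟨ solve 3 (λ b k e → b :+ k :* (e :* b) := b :* (:1 :+ k :* e)) refl (B V l) (s * V * 1#) e ⟩
      B V l * (1# + s * V * 1# * e)              ≈⟨ *-congʳ (B≈w*B/w V l) ⟩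
      w * B/w V l * (1# + s * V * 1# * e)        ≈⟨ *-assoc _ _ _ ⟩
      w * B/w V (suc l)                          ∎
      where
      e : Carrier
      e = E 1# 1# (suc l)

    module _ (X : Carrier) (N : ℕ) (X-nilpotent : X ^ suc N ≈ 0#) where
      open GeneratingFunctions X N X-nilpotent

      series-increment-divisible : ∀ V → X * series (increment V 1#) ≈
        w * (X * series (λ l → s * V * 1# * (E 1# 1# (suc l) * B/w V l)))
      series-increment-divisible V = trans
        (*-congˡ (trans (series-cong λ l → *-congˡ (*-congˡ (B≈w*B/w V l)))
          (trans (sum<-cong (suc N) λ {l} _ → solve 5 (λ X k e w b → X :* (k :* (e :* (w :* b))) := w :* (X :* (k :* (e :* b))))
                   refl (X ^ l) (s * V * 1#) (E 1# 1# (suc l)) w (B/w V l))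
                 (sym (sum<-*ˡ (suc N) w _)))))
        (solve 3 (λ X w a → X :* (w :* a) := w :* (X :* a)) refl X w _)

      -- Summation by parts; the initial value `w` is split off so that the remaining sequence
      -- starts at 0.
      series-B : ∀ V → w + X * series (increment V 1#) ≈ (1# - X) * series (B V)
      series-B V = sym (begin
        (1# - X) * series (B V)
          ≈⟨ *-congˡ (trans (series-cong λ l → solve 2 (λ b w → b := (b :- w) :+ w :* :1) refl (B V l) w)
               (trans (series-+ _ _) (+-cong (series-shift f f₀≈0) (sum<-cong (suc N) λ _ →
                 solve 2 (λ X w → X :* (w :* :1) := w :* (X :* :1)) refl _ w)))) ⟩
        (1# - X) * (X * series (f ∘ suc) + sum< (suc N) (λ l → w * (X ^ l * 1#)))
          ≈⟨ *-congˡ (+-congˡ (sum<-*ˡ (suc N) w _)) ⟨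
        (1# - X) * (X * series (f ∘ suc) + w * series (λ _ → 1#))
          ≈⟨ solve 4 (λ X a w b → (:1 :- X) :* (X :* a :+ w :* b) := w :* ((:1 :- X) :* b) :+ X :* ((:1 :- X) :* a)) refl X _ w _ ⟩
        w * ((1# - X) * series (λ _ → 1#)) + X * ((1# - X) * series (f ∘ suc))
          ≈⟨ +-cong (trans (*-congˡ series-1) (*-identityʳ w)) (*-congˡ (series-difference f (increment V 1#) f₀≈0
               λ l → trans (+-congʳ (B-suc V l)) (solve 3 (λ a b w → a :+ b :- w := a :- w :+ b) refl _ _ _))) ⟩
        w + X * series (increment V 1#)
          ∎)
        where
        f : ℕ → Carrier
        f l = B V l - w
        f₀≈0 : f 0 ≈ 0#
        f₀≈0 = trans (+-congʳ (B-zero V)) (-‿inverseʳ w)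

    -- The q-binomial series and the quotient of the theorem

    module Quotient (x v z : Carrier) (N K : ℕ)
      (nilpotent : ∀ m → (x * r ^ m) ^ suc N ≈ 0#)
      (ρ σ P : ℕ → Carrier)
      (P-zero : P 0 ≈ 1#) (P-suc : ∀ m → P (suc m) ≈ P m * (w * ρ m)) (P-K : P K ≈ 0#)
      (ρ-ratio : ∀ m → ρ m * (1# - r ^ suc m) ≈ 1# - (1# - t * z) * r ^ m)
      (σ≈1-ρ : ∀ m → σ m ≈ 1# - ρ m)
      (κ : ℕ → Carrier) (κ-inverse : ∀ l → κ l * (1# - (1# - t * z) * (w * r ^ l)) ≈ 1#)
      where

      S : ℕ → Carrier
      S l = sum< K λ m → r ^ (m ℕ.* l) * P m

      -- The functional equation of the q-binomial series with base `r`. For `f y` the sum of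
      -- `y ^ m * P m` and `a = 1# - t * z`, the ratio of consecutive `P m` gives
      -- `f y - f (r y) = w y (f y - a f (r y))`; here `y = r ^ l`.
      S-suc : ∀ l → S (suc l) * (1# - (1# - t * z) * (w * r ^ l)) ≈ S l * (1# - w * r ^ l)
      S-suc l = begin
        S (suc l) * (1# - a * (w * r ^ l))
          ≈⟨ solve 5 (λ S′ S a w ρ → S′ :* (:1 :- a :* (w :* ρ)) := S :- (S :- S′) :- a :* (w :* ρ) :* S′) refl (S (suc l)) (S l) a w (r ^ l) ⟩
        S l - (S l - S (suc l)) - a * (w * r ^ l) * S (suc l)
          ≈⟨ +-congʳ (+-congˡ (-‿cong difference)) ⟩
        S l - (w * r ^ l) * (S l - a * S (suc l)) - a * (w * r ^ l) * S (suc l)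
          ≈⟨ solve 4 (λ S′ S a y → S :- y :* (S :- a :* S′) :- a :* y :* S′ := S :* (:1 :- y)) refl (S (suc l)) (S l) a (w * r ^ l) ⟩
        S l * (1# - w * r ^ l)
          ∎
        where
        a : Carrier
        a = 1# - t * z
        -sum : ∀ n f → - sum< n f ≈ sum< n (λ i → - f i)
        -sum zero    f = solve 0 (:- con 0ℤ := con 0ℤ) refl
        -sum (suc n) f = trans (solve 2 (λ a b → :- (a :+ b) := :- a :+ :- b) refl _ _) (+-congʳ (-sum n f))
        h : ℕ → Carrier
        h m = r ^ (m ℕ.* l) * P m * (1# - r ^ m)
        r^-*suc : ∀ m → r ^ (m ℕ.* suc l) ≈ r ^ (m ℕ.* l) * r ^ m
        r^-*suc m = trans (reflexive (cong (r ^_) (≡.trans (ℕ.*-suc m l) (ℕ.+-comm m (m ℕ.* l))))) (^-homo-* r (m ℕ.* l) m)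
        h-suc : ∀ m → h (suc m) ≈ w * r ^ l * (r ^ (m ℕ.* l) * P m - a * (r ^ (m ℕ.* suc l) * P m))
        h-suc m = begin
          r ^ (l ℕ.+ m ℕ.* l) * P (suc m) * (1# - r ^ suc m)
            ≈⟨ *-congʳ (*-cong (^-homo-* r l (m ℕ.* l)) (P-suc m)) ⟩
          r ^ l * r ^ (m ℕ.* l) * (P m * (w * ρ m)) * (1# - r ^ suc m)
            ≈⟨ solve 6 (λ A B p w ρ y → A :* B :* (p :* (w :* ρ)) :* y := w :* A :* (B :* p) :* (ρ :* y)) refl (r ^ l) (r ^ (m ℕ.* l)) (P m) w (ρ m) _ ⟩
          w * r ^ l * (r ^ (m ℕ.* l) * P m) * (ρ m * (1# - r ^ suc m))
            ≈⟨ *-congˡ (ρ-ratio m) ⟩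
          w * r ^ l * (r ^ (m ℕ.* l) * P m) * (1# - a * r ^ m)
            ≈⟨ solve 6 (λ w A B p a q → w :* A :* (B :* p) :* (:1 :- a :* q) := w :* A :* (B :* p :- a :* (B :* q :* p))) refl w (r ^ l) (r ^ (m ℕ.* l)) (P m) a (r ^ m) ⟩
          w * r ^ l * (r ^ (m ℕ.* l) * P m - a * (r ^ (m ℕ.* l) * r ^ m * P m))
            ≈⟨ *-congˡ (+-congˡ (-‿cong (*-congˡ (*-congʳ (r^-*suc m))))) ⟨
          w * r ^ l * (r ^ (m ℕ.* l) * P m - a * (r ^ (m ℕ.* suc l) * P m))
            ∎
        difference : S l - S (suc l) ≈ (w * r ^ l) * (S l - a * S (suc l))
        difference = begin
          S l - S (suc l)
            ≈⟨ trans (+-congˡ (-sum K _)) (sym (sum<-+ K _ _)) ⟩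
          sum< K (λ m → r ^ (m ℕ.* l) * P m - r ^ (m ℕ.* suc l) * P m)
            ≈⟨ sum<-cong K (λ {m} _ → trans (+-congˡ (-‿cong (*-congʳ (r^-*suc m))))
                 (solve 3 (λ A q p → A :* p :- A :* q :* p := A :* p :* (:1 :- q)) refl (r ^ (m ℕ.* l)) (r ^ m) (P m))) ⟩
          sum< K h
            -- The sum can be shifted by one index since both ends vanish: `h K` because of `P-K`,
            -- and `h 0` because of its factor `1# - 1#`.
            ≈⟨ trans (+-congˡ (trans (*-congʳ (trans (*-congˡ P-K) (zeroʳ _))) (zeroˡ _))) (+-identityʳ _) ⟨
          sum< (suc K) h
            ≈⟨ sum<-suc K h ⟩
          1# * P 0 * (1# - 1#) + sum< K (h ∘ suc)
            ≈⟨ solve 2 (λ p q → :1 :* p :* (:1 :- :1) :+ q := q) refl _ _ ⟩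
          sum< K (h ∘ suc)
            ≈⟨ sum<-cong K (λ {m} _ → h-suc m) ⟩
          sum< K (λ m → w * r ^ l * (r ^ (m ℕ.* l) * P m - a * (r ^ (m ℕ.* suc l) * P m)))
            ≈⟨ sum<-*ˡ K _ _ ⟨
          w * r ^ l * sum< K (λ m → r ^ (m ℕ.* l) * P m - a * (r ^ (m ℕ.* suc l) * P m))
            ≈⟨ *-congˡ (trans (sum<-+ K _ _) (+-congˡ (trans (sym (-sum K _)) (-‿cong (sym (sum<-*ˡ K a _)))))) ⟩
          (w * r ^ l) * (S l - a * S (suc l))
            ∎

      -- By `σ≈1-ρ` the summand is `w * P m - P (suc m)`. The shifted sum lacks only `P 0`, which
      -- the leading `1#` restores.
      denominator : 1# - sum< K (λ m → w * σ m * P m) ≈ (1# - w) * S 0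
      denominator = begin
        1# - sum< K (λ m → w * σ m * P m)
          ≈⟨ +-congˡ (-‿cong (sum<-cong K λ {m} _ → trans (*-congʳ (*-congˡ (σ≈1-ρ m)))
               (trans (solve 3 (λ w ρ p → w :* (:1 :- ρ) :* p := w :* p :+ :- :1 :* (p :* (w :* ρ))) refl w (ρ m) (P m))
                      (+-congˡ (*-congˡ (sym (P-suc m))))))) ⟩
        1# - sum< K (λ m → w * P m + - 1# * P (suc m))
          ≈⟨ +-congˡ (-‿cong (trans (sum<-+ K _ _) (+-cong (sym (sum<-*ˡ K w P)) (sym (sum<-*ˡ K (- 1#) _))))) ⟩
        1# - (w * sum< K P + - 1# * sum< K (P ∘ suc))
          ≈⟨ solve 3 (λ w a b → :1 :- (w :* a :+ :- :1 :* b) := (:1 :+ b) :- w :* a) refl w _ _ ⟩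
        1# + sum< K (P ∘ suc) - w * sum< K P
          ≈⟨ +-congʳ (trans (+-congʳ (sym P-zero)) (trans (sym (sum<-suc K P)) (trans (+-congˡ P-K) (+-identityʳ _)))) ⟩
        sum< K P - w * sum< K P
          ≈⟨ solve 2 (λ w a → a :- w :* a := (:1 :- w) :* a) refl w _ ⟩
        (1# - w) * sum< K P
          ≈⟨ *-congˡ (sum<-cong K λ {m} _ → trans (*-congʳ (reflexive (cong (r ^_) (ℕ.*-zeroʳ m)))) (*-identityˡ _)) ⟨
        (1# - w) * S 0
          ∎

      -- Both sides satisfy the same first-order recursion, whose leading coefficient is cancelled
      -- by means of `κ`. The factor `S 0` makes the initial values agree.
      E*S₀ : ∀ l → E 1# z l * S 0 ≈ S l
      E*S₀ zero    = trans (*-congʳ (E-zero 1# z)) (*-identityˡ _)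
      E*S₀ (suc l) = begin
        E 1# z (suc l) * S 0
          ≈⟨ *-identityʳ _ ⟨
        E 1# z (suc l) * S 0 * 1#
          ≈⟨ *-congˡ (κ-inverse l) ⟨
        E 1# z (suc l) * S 0 * (κ l * c)
          ≈⟨ solve 4 (λ e S k c → e :* S :* (k :* c) := k :* S :* (e :* c)) refl _ _ _ _ ⟩
        κ l * S 0 * (E 1# z (suc l) * c)
          ≈⟨ *-congˡ (E-1-Z z l) ⟩
        κ l * S 0 * (E 1# z l * (1# - w * r ^ l))
          ≈⟨ solve 4 (λ k S e y → k :* S :* (e :* y) := k :* (e :* S :* y)) refl _ _ _ _ ⟩
        κ l * (E 1# z l * S 0 * (1# - w * r ^ l))
          ≈⟨ *-congˡ (trans (*-congʳ (E*S₀ l)) (sym (S-suc l))) ⟩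
        κ l * (S (suc l) * c)
          ≈⟨ solve 3 (λ k S c → k :* (S :* c) := S :* (k :* c)) refl _ _ _ ⟩
        S (suc l) * (κ l * c)
          ≈⟨ trans (*-congˡ (κ-inverse l)) (*-identityʳ _) ⟩
        S (suc l)
          ∎
        where
        c : Carrier
        c = 1# - (1# - t * z) * (w * r ^ l)

      module G m = GeneratingFunctions (x * r ^ m) N (nilpotent m)

      module _ (x-nilpotent : x ^ suc N ≈ 0#)
        (U ι : ℕ → Carrier) (ι-inverse : ∀ m → ι m * (x * r ^ m - 1#) ≈ 1#)
        (U-series : ∀ m → w * U m ≈ x * r ^ m * G.series m (increment v 1#)) where
        open GeneratingFunctions x N x-nilpotent using (series)

        private
          -- The factor `w` turns `1# + U m` into the left side of `series-B`, and the factor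
          -- `1# - X` on its right cancels against `ι m` up to sign. The power `X ^ l` then yields
          -- `r ^ (m * l)`, which joins `r ^ m` in the summand of `S (suc l)`.
          numerator-term : ∀ m → z * t * v * r ^ m * (1# + U m) * (w * ι m) * P m ≈
            sum< (suc N) (λ l → x ^ l * (- (z * t * v) * B v l * (r ^ (m ℕ.* suc l) * P m)))
          numerator-term m = begin
            z * t * v * r ^ m * (1# + U m) * (w * ι m) * P m
              ≈⟨ solve 6 (λ c q U w ι p → c :* q :* (:1 :+ U) :* (w :* ι) :* p := c :* q :* p :* (ι :* (w :+ w :* U)))
                   refl (z * t * v) (r ^ m) (U m) w (ι m) (P m) ⟩
            z * t * v * r ^ m * P m * (ι m * (w + w * U m))
              ≈⟨ *-congˡ (*-congˡ (trans (+-congˡ (U-series m)) (series-B (x * r ^ m) N (nilpotent m) v))) ⟩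
            z * t * v * r ^ m * P m * (ι m * ((1# - X) * G.series m (B v)))
              ≈⟨ solve 4 (λ c ι X b → c :* (ι :* ((:1 :- X) :* b)) := :- c :* b :* (ι :* (X :- :1))) refl _ (ι m) X _ ⟩
            - (z * t * v * r ^ m * P m) * G.series m (B v) * (ι m * (X - 1#))
              ≈⟨ trans (*-congˡ (ι-inverse m)) (*-identityʳ _) ⟩
            - (z * t * v * r ^ m * P m) * G.series m (B v)
              ≈⟨ sum<-*ˡ (suc N) _ _ ⟩
            sum< (suc N) (λ l → - (z * t * v * r ^ m * P m) * (X ^ l * B v l))
              ≈⟨ sum<-cong (suc N) (λ {l} _ → trans
                   (*-congˡ (*-congʳ (trans (^-distrib-* x (r ^ m) l) (*-congˡ (^-assocʳ r m l)))))
                   (trans (solve 6 (λ c q p X A b → :- (c :* q :* p) :* (X :* A :* b) := X :* (:- c :* b :* (q :* A :* p)))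
                             refl (z * t * v) (r ^ m) (P m) (x ^ l) (r ^ (m ℕ.* l)) (B v l))
                          (*-congˡ (*-congˡ (*-congʳ (trans (sym (^-homo-* r m (m ℕ.* l)))
                            (reflexive (cong (r ^_) (≡.sym (ℕ.*-suc m l)))))))))) ⟩
            sum< (suc N) (λ l → x ^ l * (- (z * t * v) * B v l * (r ^ (m ℕ.* suc l) * P m)))
              ∎
            where
            X : Carrier
            X = x * r ^ m

        -- Both sides are the same double sum. On the left, `1# - w` meets `s` to give `- t`, and
        -- `S 0` meets `E 1# z (suc l)` to give `S (suc l)`.
        quotient : series (increment v z) * (1# - sum< K (λ m → w * σ m * P m)) ≈
          sum< K (λ m → z * t * v * r ^ m * (1# + U m) * (w * ι m) * P m)
        quotient = begin
          series (increment v z) * (1# - sum< K (λ m → w * σ m * P m))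
            ≈⟨ *-congˡ denominator ⟩
          series (increment v z) * ((1# - w) * S 0)
            ≈⟨ sum<-*ʳ (suc N) _ _ ⟩
          sum< (suc N) (λ l → x ^ l * (s * v * z * (E 1# z (suc l) * B v l)) * ((1# - w) * S 0))
            ≈⟨ sum<-cong (suc N) (λ {l} _ → trans
                 (solve 8 (λ X s v z e b w S → X :* (s :* v :* z :* (e :* b)) :* ((:1 :- w) :* S) :=
                    X :* (:- (z :* (s :* (w :- :1)) :* v) :* b :* (e :* S))) refl (x ^ l) s v z (E 1# z (suc l)) (B v l) w (S 0))
                 (*-congˡ (*-cong (*-congʳ (-‿cong (*-congʳ (*-congˡ s[w-1]≈t)))) (E*S₀ (suc l))))) ⟩
          sum< (suc N) (λ l → x ^ l * (- (z * t * v) * B v l * S (suc l)))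
            ≈⟨ sum<-cong (suc N) (λ _ → trans (*-congˡ (sum<-*ˡ K _ _)) (sum<-*ˡ K _ _)) ⟩
          sum< (suc N) (λ l → sum< K λ m → x ^ l * (- (z * t * v) * B v l * (r ^ (m ℕ.* suc l) * P m)))
            ≈⟨ sum<-swap (suc N) K _ ⟩
          sum< K (λ m → sum< (suc N) λ l → x ^ l * (- (z * t * v) * B v l * (r ^ (m ℕ.* suc l) * P m)))
            ≈⟨ sum<-cong K (λ {m} _ → numerator-term m) ⟨
          sum< K (λ m → z * t * v * r ^ m * (1# + U m) * (w * ι m) * P m)
            ∎

-- Ring identities for the factors of the products and for the final division

module AssemblyIdentities (R : CommutativeRing 0ℓ 0ℓ) where
  open CommutativeRing R renaming (refl to ≈-refl; sym to ≈-sym; trans to ≈-trans)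
    hiding (zero)
  open IntegerSolver R
  open Relation.Binary.Reasoning.Setoid setoid

  power-difference-zero : ∀ t → 1# - 1# ≈ t * 0#
  power-difference-zero = solve 1 (λ t → :1 :- :1 := t :* con 0ℤ) ≈-refl

  power-difference-suc : ∀ t q h → q - 1# ≈ t * h → (1# - t) * q - 1# ≈ t * ((1# - t) * h - 1#)
  power-difference-suc t q h q-1≈th = begin
    (1# - t) * q - 1#
      ≈⟨ solve 2 (λ t q → (:1 :- t) :* q :- :1 := (:1 :- t) :* (q :- :1) :- t) ≈-refl t q ⟩
    (1# - t) * (q - 1#) - t
      ≈⟨ +-congʳ (*-congˡ q-1≈th) ⟩
    (1# - t) * (t * h) - t
      ≈⟨ solve 2 (λ t h → (:1 :- t) :* (t :* h) :- t := t :* ((:1 :- t) :* h :- :1)) ≈-refl t h ⟩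
    t * ((1# - t) * h - 1#)
      ∎

  ratio-numerator : ∀ t z q p h → p - 1# ≈ t * h → t * (1# - z) * q + p - 1# ≈ t * ((1# - z) * q + h)
  ratio-numerator t z q p h p-1≈th = begin
    t * (1# - z) * q + p - 1#       ≈⟨ +-assoc _ _ _ ⟩
    t * (1# - z) * q + (p - 1#)     ≈⟨ +-congˡ p-1≈th ⟩
    t * (1# - z) * q + t * h        ≈⟨ solve 4 (λ t z q h → t :* (:1 :- z) :* q :+ t :* h := t :* ((:1 :- z) :* q :+ h)) ≈-refl t z q h ⟩
    t * ((1# - z) * q + h)          ∎

  -- Multiplication by `- t` turns `h` into `1# - (1# - t) * q`, which removes the quotient by `t`
  -- from the statement.
  ratio : ∀ t z q ρ h → (1# - t) * q - 1# ≈ t * h → ρ * h ≈ (1# - z) * q + h →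
    ρ * (1# - (1# - t) * q) ≈ 1# - (1# - t * z) * q
  ratio t z q ρ h p-1≈th ρh≈ = begin
    ρ * (1# - (1# - t) * q)
      ≈⟨ solve 3 (λ t q ρ → ρ :* (:1 :- (:1 :- t) :* q) := :- (ρ :* ((:1 :- t) :* q :- :1))) ≈-refl t q ρ ⟩
    - (ρ * ((1# - t) * q - 1#))
      ≈⟨ -‿cong (*-congˡ p-1≈th) ⟩
    - (ρ * (t * h))
      ≈⟨ solve 3 (λ t ρ h → :- (ρ :* (t :* h)) := :- (t :* (ρ :* h))) ≈-refl t ρ h ⟩
    - (t * (ρ * h))
      ≈⟨ -‿cong (*-congˡ ρh≈) ⟩
    - (t * ((1# - z) * q + h))
      ≈⟨ solve 4 (λ t z q h → :- (t :* ((:1 :- z) :* q :+ h)) := :- (t :* (:1 :- z) :* q) :- t :* h) ≈-refl t z q h ⟩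
    - (t * (1# - z) * q) - t * h
      ≈⟨ +-congˡ (-‿cong p-1≈th) ⟨
    - (t * (1# - z) * q) - ((1# - t) * q - 1#)
      ≈⟨ solve 3 (λ t z q → :- (t :* (:1 :- z) :* q) :- ((:1 :- t) :* q :- :1) := :1 :- (:1 :- t :* z) :* q) ≈-refl t z q ⟩
    1# - (1# - t * z) * q
      ∎

  -- The numerators of `σ` and `ρ` over `h` add up to `h`, which has the inverse `η`.
  complementary : ∀ z q σ ρ h η → η * h ≈ 1# → σ * h ≈ (z - 1#) * q → ρ * h ≈ (1# - z) * q + h → σ ≈ 1# - ρ
  complementary z q σ ρ h η ηh≈1 σh≈ ρh≈ = begin
    σ
      ≈⟨ solve 2 (λ σ ρ → σ := (σ :+ ρ) :* :1 :- ρ) ≈-refl σ ρ ⟩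
    (σ + ρ) * 1# - ρ
      ≈⟨ +-congʳ (*-congˡ ηh≈1) ⟨
    (σ + ρ) * (η * h) - ρ
      ≈⟨ solve 4 (λ σ ρ η h → (σ :+ ρ) :* (η :* h) :- ρ := η :* (σ :* h :+ ρ :* h) :- ρ) ≈-refl σ ρ η h ⟩
    η * (σ * h + ρ * h) - ρ
      ≈⟨ +-congʳ (*-congˡ (+-cong σh≈ ρh≈)) ⟩
    η * ((z - 1#) * q + ((1# - z) * q + h)) - ρ
      ≈⟨ solve 5 (λ z q η h ρ → η :* ((z :- :1) :* q :+ ((:1 :- z) :* q :+ h)) :- ρ := η :* h :- ρ) ≈-refl z q η h ρ ⟩
    η * h - ρ
      ≈⟨ +-congʳ ηh≈1 ⟩
    1# - ρ
      ∎

  divide : ∀ t a ι → ι * a ≈ 1# → t * ι * a ≈ t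
  divide t a ι ιa≈1 = ≈-trans (*-assoc t ι a) (≈-trans (*-congˡ ιa≈1) (*-identityʳ t))

  scale : ∀ x q g s → g ≈ s → x * (q * g) ≈ x * q * s
  scale x q g s g≈s = ≈-trans (≈-sym (*-assoc x q g)) (*-congˡ g≈s)

  conclude : ∀ g a d d′ n n′ ι → g ≈ a → d ≈ d′ → n ≈ n′ → ι * d ≈ 1# → a * d′ ≈ n′ → g ≈ n * ι
  conclude g a d d′ n n′ ι g≈a d≈d′ n≈n′ ιd≈1 ad′≈n′ = begin
    g              ≈⟨ g≈a ⟩
    a              ≈⟨ *-identityʳ a ⟨
    a * 1#         ≈⟨ *-congˡ ιd≈1 ⟨
    a * (ι * d)    ≈⟨ solve 3 (λ a ι d → a :* (ι :* d) := a :* d :* ι) ≈-refl a ι d ⟩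
    a * d * ι      ≈⟨ *-congʳ (*-congˡ d≈d′) ⟩
    a * d′ * ι     ≈⟨ *-congʳ (≈-trans ad′≈n′ (≈-sym n≈n′)) ⟩
    n * ι          ∎

  subtract : ∀ a b → a ≈ b → 1# - a ≈ 1# - b
  subtract a b a≈b = +-congˡ (-‿cong a≈b)

open import Defs
open ≡ using (refl; sym; trans)

-- Truncated power series

module ℚΣ = Sums ℚ.+-*-commutativeRing

sum-zipWith-+ : ∀ {k} (β γ : Vec ℕ k) → Vec.sum (zipWith ℕ._+_ β γ) ≡ Vec.sum β ℕ.+ Vec.sum γ
sum-zipWith-+ []      []      = refl
sum-zipWith-+ (b ∷ β) (c ∷ γ) = begin
  b ℕ.+ c ℕ.+ Vec.sum (zipWith ℕ._+_ β γ)  ≡⟨ cong (b ℕ.+ c ℕ.+_) (sum-zipWith-+ β γ) ⟩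
  b ℕ.+ c ℕ.+ (Vec.sum β ℕ.+ Vec.sum γ)    ≡⟨ ℕ.+-assoc b c _ ⟩
  b ℕ.+ (c ℕ.+ (Vec.sum β ℕ.+ Vec.sum γ))  ≡⟨ cong (b ℕ.+_) (ℕ.+-comm c _) ⟩
  b ℕ.+ (Vec.sum β ℕ.+ Vec.sum γ ℕ.+ c)    ≡⟨ cong (b ℕ.+_) (ℕ.+-assoc (Vec.sum β) _ c) ⟩
  b ℕ.+ (Vec.sum β ℕ.+ (Vec.sum γ ℕ.+ c))  ≡⟨ cong (λ s → b ℕ.+ (Vec.sum β ℕ.+ s)) (ℕ.+-comm (Vec.sum γ) c) ⟩
  b ℕ.+ (Vec.sum β ℕ.+ (c ℕ.+ Vec.sum γ))  ≡⟨ ℕ.+-assoc b _ _ ⟨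
  b ℕ.+ Vec.sum β ℕ.+ (c ℕ.+ Vec.sum γ)    ∎
  where open ≡.≡-Reasoning

sum-divisors : ∀ {k} (α : Vec ℕ k) (H : Vec ℕ k → Vec ℕ k → ℚ) →
  ℚΣ.sumL (divisors α) (λ β → H β (zipWith _∸_ α β)) ≡ ℚΣ.convᵛ α H
sum-divisors []      H = ℚ.+-identityʳ (H [] [])
sum-divisors (a ∷ α) H = begin
  ℚΣ.sumL (List.cartesianProductWith _∷_ (List.upTo (suc a)) (divisors α)) (λ β → H β (zipWith _∸_ (a ∷ α) β))
    ≡⟨ ℚΣ.sumL-cartesianProductWith _∷_ (List.upTo (suc a)) (divisors α)
         (λ β → H β (zipWith _∸_ (a ∷ α) β)) ⟩
  ℚΣ.sumL (List.upTo (suc a)) (λ i → ℚΣ.sumL (divisors α) (λ β → H (i ∷ β) ((a ∸ i) ∷ zipWith _∸_ α β)))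
    ≡⟨ ℚΣ.sumL-cong (List.upTo (suc a)) (λ i → sum-divisors α (λ β γ → H (i ∷ β) ((a ∸ i) ∷ γ))) ⟩
  ℚΣ.sumL (List.upTo (suc a)) (λ i → ℚΣ.convᵛ α (λ β γ → H (i ∷ β) ((a ∸ i) ∷ γ)))
    ≡⟨ ℚΣ.sumL-applyUpTo (suc a) (λ i → i) _ ⟩
  ℚΣ.sum< (suc a) (λ i → ℚΣ.convᵛ α (λ β γ → H (i ∷ β) ((a ∸ i) ∷ γ)))
    ≡⟨ ℚΣ.sum<-antidiagonal a (λ i j → ℚΣ.convᵛ α (λ β γ → H (i ∷ β) (j ∷ γ))) ⟩
  ℚΣ.convᵛ (a ∷ α) H
    ∎
  where open ≡.≡-Reasoning

*-conv : ∀ f g α → (f * g) α ≡ ℚΣ.convᵛ α (λ β γ → f β ℚ.* g γ)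
*-conv f g α = sum-divisors α (λ β γ → f β ℚ.* g γ)

constant-≢ : ∀ c {α} → α ≢ 1ₘ → constant c α ≡ 0ℚ
constant-≢ c {α} α≢1 rewrite dec-false (Vec.≡-dec ℕ._≟_ α 1ₘ) α≢1 = refl

-- `0#` is `constant 0ℚ`, a conditional with equal branches that does not reduce at a variable `α`.
0#≡0 : ∀ α → 0# α ≡ 0ℚ
0#≡0 α with does (Vec.≡-dec ℕ._≟_ α 1ₘ)
... | true  = refl
... | false = refl

constant-* : ∀ c f α → (constant c * f) α ≡ c ℚ.* f α
constant-* c f α = begin
  (constant c * f) α                                          ≡⟨ *-conv (constant c) f α ⟩
  ℚΣ.convᵛ α (λ β γ → constant c β ℚ.* f γ)                   ≡⟨ cong (λ δ → ℚΣ.convᵛ δ _) (1ₘ+ α) ⟨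
  ℚΣ.convᵛ (zipWith ℕ._+_ 1ₘ α) (λ β γ → constant c β ℚ.* f γ) ≡⟨ ℚΣ.convᵛ-single 1ₘ α (λ {β} {γ} β≢1 →
                                                                  trans (cong (ℚ._* f γ) (constant-≢ c β≢1)) (ℚ.*-zeroˡ (f γ))) ⟩
  c ℚ.* f α                                                   ∎
  where
  open ≡.≡-Reasoning
  1ₘ+ : ∀ α → zipWith ℕ._+_ 1ₘ α ≡ α
  1ₘ+ (a ∷ b ∷ c ∷ d ∷ e ∷ []) = refl

infix 4 _≈[_]_
record _≈[_]_ (f : Series) (N : ℕ) (g : Series) : Set where
  constructor below
  field at : ∀ α → Vec.sum α < N → f α ≡ g α

open _≈[_]_ public

≈[]-*-cong : ∀ N {f f′ g g′} → f ≈[ N ] f′ → g ≈[ N ] g′ → f * g ≈[ N ] f′ * g′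
≈[]-*-cong N {f} {f′} {g} {g′} (below f≈f′) (below g≈g′) = below λ α α<N → begin
  (f * g) α                                   ≡⟨ *-conv f g α ⟩
  ℚΣ.convᵛ α (λ β γ → f β ℚ.* g γ)            ≡⟨ ℚΣ.convᵛ-cong α (λ {β} {γ} β+γ≡α →
    cong₂ ℚ._*_ (f≈f′ β (ℕ.≤-<-trans (left β γ β+γ≡α) α<N)) (g≈g′ γ (ℕ.≤-<-trans (right β γ β+γ≡α) α<N))) ⟩
  ℚΣ.convᵛ α (λ β γ → f′ β ℚ.* g′ γ)          ≡⟨ *-conv f′ g′ α ⟨
  (f′ * g′) α                                 ∎
  where
  open ≡.≡-Reasoning
  left : ∀ {α} β γ → zipWith ℕ._+_ β γ ≡ α → Vec.sum β ≤ Vec.sum α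
  left β γ refl = ≡.subst (Vec.sum β ≤_) (sym (sum-zipWith-+ β γ)) (ℕ.m≤m+n _ _)
  right : ∀ {α} β γ → zipWith ℕ._+_ β γ ≡ α → Vec.sum γ ≤ Vec.sum α
  right β γ refl = ≡.subst (Vec.sum γ ≤_) (sym (sum-zipWith-+ β γ)) (ℕ.m≤n+m _ _)

*-commute : ∀ f g α → (f * g) α ≡ (g * f) α
*-commute f g α = begin
  (f * g) α                          ≡⟨ *-conv f g α ⟩
  ℚΣ.convᵛ α (λ β γ → f β ℚ.* g γ)   ≡⟨ ℚΣ.convᵛ-comm α _ ⟩
  ℚΣ.convᵛ α (λ β γ → f γ ℚ.* g β)   ≡⟨ ℚΣ.convᵛ-cong α (λ {β} {γ} _ → ℚ.*-comm (f γ) (g β)) ⟩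
  ℚΣ.convᵛ α (λ β γ → g β ℚ.* f γ)   ≡⟨ *-conv g f α ⟨
  (g * f) α                          ∎
  where open ≡.≡-Reasoning

*-associate : ∀ f g h α → ((f * g) * h) α ≡ (f * (g * h)) α
*-associate f g h α = begin
  ((f * g) * h) α
    ≡⟨ *-conv (f * g) h α ⟩
  ℚΣ.convᵛ α (λ β γ → (f * g) β ℚ.* h γ)
    ≡⟨ ℚΣ.convᵛ-cong α (λ {β} {γ} _ → trans (cong (ℚ._* h γ) (*-conv f g β)) (trans (ℚ.*-comm _ (h γ)) (ℚΣ.convᵛ-*ˡ β (h γ) _))) ⟩
  ℚΣ.convᵛ α (λ β γ → ℚΣ.convᵛ β (λ δ ε → h γ ℚ.* (f δ ℚ.* g ε)))
    ≡⟨ ℚΣ.convᵛ-assoc α (λ δ ε γ → h γ ℚ.* (f δ ℚ.* g ε)) ⟩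
  ℚΣ.convᵛ α (λ δ β → ℚΣ.convᵛ β (λ ε γ → h γ ℚ.* (f δ ℚ.* g ε)))
    ≡⟨ ℚΣ.convᵛ-cong α (λ {δ} {β} _ → ℚΣ.convᵛ-cong β (λ {ε} {γ} _ →
         trans (ℚ.*-comm (h γ) _) (ℚ.*-assoc (f δ) (g ε) (h γ)))) ⟩
  ℚΣ.convᵛ α (λ δ β → ℚΣ.convᵛ β (λ ε γ → f δ ℚ.* (g ε ℚ.* h γ)))
    ≡⟨ ℚΣ.convᵛ-cong α (λ {δ} {β} _ → trans (cong (f δ ℚ.*_) (*-conv g h β)) (ℚΣ.convᵛ-*ˡ β (f δ) _)) ⟨
  ℚΣ.convᵛ α (λ δ β → f δ ℚ.* (g * h) β)
    ≡⟨ *-conv f (g * h) α ⟨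
  (f * (g * h)) α
    ∎
  where open ≡.≡-Reasoning

*-distribute : ∀ f g h α → (f * (g + h)) α ≡ (f * g + f * h) α
*-distribute f g h α = begin
  (f * (g + h)) α
    ≡⟨ *-conv f (g + h) α ⟩
  ℚΣ.convᵛ α (λ β γ → f β ℚ.* (g γ ℚ.+ h γ))
    ≡⟨ ℚΣ.convᵛ-cong α (λ {β} {γ} _ → ℚ.*-distribˡ-+ (f β) (g γ) (h γ)) ⟩
  ℚΣ.convᵛ α (λ β γ → f β ℚ.* g γ ℚ.+ f β ℚ.* h γ)
    ≡⟨ ℚΣ.convᵛ-+ α _ _ ⟩
  ℚΣ.convᵛ α (λ β γ → f β ℚ.* g γ) ℚ.+ ℚΣ.convᵛ α (λ β γ → f β ℚ.* h γ)
    ≡⟨ cong₂ ℚ._+_ (*-conv f g α) (*-conv f h α) ⟨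
  (f * g + f * h) α
    ∎
  where open ≡.≡-Reasoning

1#-* : ∀ f α → (1# * f) α ≡ f α
1#-* f α = trans (constant-* 1ℚ f α) (ℚ.*-identityˡ (f α))

-- The quotient by the ideal of series of order at least `N`, presented on all series: only the
-- equality depends on `N`, so one series can be viewed at several precisions.
truncated : ℕ → CommutativeRing 0ℓ 0ℓ
truncated N = record
  { Carrier = Series
  ; _≈_ = _≈[ N ]_
  ; _+_ = _+_
  ; _*_ = _*_
  ; -_  = -_
  ; 0#  = 0#
  ; 1#  = 1#
  ; isCommutativeRing = record
    { isRing = record
      { +-isAbelianGroup = record
        { isGroup = record
          { isMonoid = record
            { isSemigroup = record
              { isMagma = record
                { isEquivalence = record
                  { refl  = below λ _ _ → refl
                  ; sym   = λ (below f≈g) → below λ α α<N → sym (f≈g α α<N)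
                  ; trans = λ (below f≈g) (below g≈h) → below λ α α<N → trans (f≈g α α<N) (g≈h α α<N)
                  }
                ; ∙-cong = λ (below f≈f′) (below g≈g′) → below λ α α<N → cong₂ ℚ._+_ (f≈f′ α α<N) (g≈g′ α α<N)
                }
              ; assoc = λ f g h → below λ α _ → ℚ.+-assoc (f α) (g α) (h α)
              }
            ; identity = (λ f → below λ α _ → trans (cong (ℚ._+ f α) (0#≡0 α)) (ℚ.+-identityˡ (f α)))
                       , (λ f → below λ α _ → trans (cong (f α ℚ.+_) (0#≡0 α)) (ℚ.+-identityʳ (f α)))
            }
          ; inverse = (λ f → below λ α _ → trans (ℚ.+-inverseˡ (f α)) (sym (0#≡0 α)))
                    , (λ f → below λ α _ → trans (ℚ.+-inverseʳ (f α)) (sym (0#≡0 α)))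
          ; ⁻¹-cong = λ (below f≈g) → below λ α α<N → cong ℚ.-_ (f≈g α α<N)
          }
        ; comm = λ f g → below λ α _ → ℚ.+-comm (f α) (g α)
        }
      ; *-cong = ≈[]-*-cong N
      ; *-assoc = λ f g h → below λ α _ → *-associate f g h α
      ; *-identity = (λ f → below λ α _ → 1#-* f α)
                   , (λ f → below λ α _ → trans (*-commute f 1# α) (1#-* f α))
      ; distrib = (λ f g h → below λ α _ → *-distribute f g h α)
                , (λ f g h → below λ α _ → trans (*-commute (g + h) f α)
                    (trans (*-distribute f g h α) (cong₂ ℚ._+_ (*-commute f g α) (*-commute f h α))))
      }
    ; *-comm = λ f g → below λ α _ → *-commute f g α
    }
  }

≈[]-mono : ∀ {m n f g} → m ≤ n → f ≈[ n ] g → f ≈[ m ] g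
≈[]-mono m≤n (below f≈g) = below λ α α<m → f≈g α (ℕ.<-≤-trans α<m m≤n)

Order≥ : ℕ → Series → Set
Order≥ n f = f ≈[ n ] 0#

order-* : ∀ {m n f g} → Order≥ m f → Order≥ n g → Order≥ (m ℕ.+ n) (f * g)
order-* {m} {n} {f} {g} (below f≥m) (below g≥n) = below λ α α<m+n → begin
  (f * g) α                          ≡⟨ *-conv f g α ⟩
  ℚΣ.convᵛ α (λ β γ → f β ℚ.* g γ)   ≡⟨ ℚΣ.convᵛ-cong α (λ {β} {γ} → vanish β γ α<m+n) ⟩
  ℚΣ.convᵛ α (λ _ _ → 0ℚ)            ≡⟨ ℚΣ.convᵛ-zero α ⟩
  0ℚ                                 ≡⟨ 0#≡0 α ⟨
  0# α                               ∎
  where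
  open ≡.≡-Reasoning
  vanish : ∀ {α} β γ → Vec.sum α < m ℕ.+ n → zipWith ℕ._+_ β γ ≡ α → f β ℚ.* g γ ≡ 0ℚ
  vanish β γ α<m+n refl with Vec.sum β ℕ.<? m
  ... | yes β<m = trans (cong (ℚ._* g γ) (trans (f≥m β β<m) (0#≡0 β))) (ℚ.*-zeroˡ (g γ))
  ... | no  β≮m = trans (cong (f β ℚ.*_) (trans (g≥n γ γ<n) (0#≡0 γ))) (ℚ.*-zeroʳ (f β))
    where
    γ<n : Vec.sum γ < n
    γ<n = ℕ.+-cancelˡ-< (Vec.sum β) _ _ (ℕ.<-≤-trans
      (≡.subst (_< m ℕ.+ n) (sum-zipWith-+ β γ) α<m+n) (ℕ.+-monoˡ-≤ n (ℕ.≮⇒≥ β≮m)))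

order-*ˡ : ∀ {n f} g → Order≥ n f → Order≥ n (f * g)
order-*ˡ {n} {f} g f≥n = ≈-trans (*-cong f≥n (≈-refl {g})) (zeroˡ g)
  where open CommutativeRing (truncated n) using (zeroˡ; *-cong) renaming (refl to ≈-refl; trans to ≈-trans)

order-*ʳ : ∀ {n f} g → Order≥ n f → Order≥ n (g * f)
order-*ʳ {n} {f} g f≥n = ≈-trans (*-cong (≈-refl {g}) f≥n) (zeroʳ g)
  where open CommutativeRing (truncated n) using (zeroʳ; *-cong) renaming (refl to ≈-refl; trans to ≈-trans)

order-0 : ∀ f → Order≥ 0 f
order-0 f = below λ α ()

order-^ : ∀ {f} → Order≥ 1 f → ∀ n → Order≥ n (f ^ n)
order-^ {f} f≥1 zero    = order-0 (f ^ 0)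
order-^ {f} f≥1 (suc n) = order-* f≥1 (order-^ f≥1 n)

sum≡0⇒replicate : ∀ {k} (α : Vec ℕ k) → Vec.sum α ≡ 0 → α ≡ replicate k 0
sum≡0⇒replicate []      eq = refl
sum≡0⇒replicate (a ∷ α) eq = cong₂ _∷_ (ℕ.m+n≡0⇒m≡0 a eq) (sum≡0⇒replicate α (ℕ.m+n≡0⇒n≡0 a eq))

order-1 : ∀ {f} → f 1ₘ ≡ 0ℚ → Order≥ 1 f
order-1 {f} f₀≡0 = below vanish
  where
  vanish : ∀ α → Vec.sum α < 1 → f α ≡ 0# α
  vanish α α<1 with refl ← sum≡0⇒replicate α (ℕ.n<1⇒n≡0 α<1) = f₀≡0

*-1ₘ : ∀ f g → (f * g) 1ₘ ≡ f 1ₘ ℚ.* g 1ₘ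
*-1ₘ f g = *-conv f g 1ₘ

order-var : ∀ i → Order≥ 1 (var i)
order-var 0F = order-1 refl
order-var 1F = order-1 refl
order-var 2F = order-1 refl
order-var 3F = order-1 refl
order-var 4F = order-1 refl

∑-stable : ∀ f α m d → (∀ k → m < k → f k α ≡ 0ℚ) → (∑[1⋯ m ℕ.+ d ] f) α ≡ (∑[1⋯ m ] f) α
∑-stable f α m zero    f≡0 = cong (λ k → (∑[1⋯ k ] f) α) (ℕ.+-identityʳ m)
∑-stable f α m (suc d) f≡0 = begin
  (∑[1⋯ m ℕ.+ suc d ] f) α                      ≡⟨ cong (λ k → (∑[1⋯ k ] f) α) (ℕ.+-suc m d) ⟩
  (∑[1⋯ m ℕ.+ d ] f) α ℚ.+ f (suc (m ℕ.+ d)) α  ≡⟨ cong₂ ℚ._+_ (∑-stable f α m d f≡0) (f≡0 _ (s≤s (ℕ.m≤m+n m d))) ⟩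
  (∑[1⋯ m ] f) α ℚ.+ 0ℚ                         ≡⟨ ℚ.+-identityʳ _ ⟩
  (∑[1⋯ m ] f) α                                ∎
  where open ≡.≡-Reasoning

∑-truncate : ∀ {f} → (∀ n → Order≥ (suc n) (f (suc n))) → ∀ {M N} → M ≤ N →
  ∑[1⋯ M ] f ≈[ suc M ] ∑[1⋯ N ] f
∑-truncate {f} f≥n {M} {N} M≤N = below λ α α≤M → trans
  (sym (∑-stable f α M (N ∸ M) (vanish α α≤M))) (cong (λ k → (∑[1⋯ k ] f) α) (ℕ.m+[n∸m]≡n M≤N))
  where
  vanish : ∀ α → Vec.sum α < suc M → ∀ k → M < k → f k α ≡ 0ℚ
  vanish α α≤M (suc k) M<k = trans (at (f≥n k) α (ℕ.<-≤-trans α≤M M<k)) (0#≡0 α)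

-- `∑₁∞` stops at the degree of the coefficient in question, the finite sum at the fixed bound `N`.
-- The terms between have too high an order to matter.
∑₁∞-truncate : ∀ {f} → (∀ n → Order≥ (suc n) (f (suc n))) → ∀ N → ∑₁∞ f ≈[ N ] ∑[1⋯ N ] f
∑₁∞-truncate f≥n N = below λ α α<N → at (∑-truncate f≥n (ℕ.<⇒≤ α<N)) α ℕ.≤-refl

recip-inverse : ∀ {p} → p ≢ 0ℚ → recip p ℚ.* p ≡ 1ℚ
recip-inverse {p} p≢0 with p ℚ.≟ 0ℚ
... | yes p≡0 = contradiction p≡0 p≢0
... | no  p≢0 = ℚ.*-inverseˡ p {{ℚ.≢-nonZero p≢0}}

geometric : ∀ N y n → (1# - y) * (1# + ∑[1⋯ n ] (y ^_)) + y ^ suc n ≈[ N ] 1#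
geometric N y zero    = RingIdentities.geometric-zero (truncated N) y
geometric N y (suc n) = RingIdentities.geometric-suc (truncated N) y (∑[1⋯ n ] (y ^_)) (y ^ suc n) (geometric N y n)

-- `inv` uses a different partial sum for each degree. Below degree `N` all of them agree with the
-- single sum `S`, and the remainder `y ^ suc N` vanishes because `C` is chosen to give `y` the
-- constant term 0.
inv-inverse : ∀ {f} → f 1ₘ ≢ 0ℚ → ∀ N → inv f * f ≈[ N ] 1#
inv-inverse {f} f₀≢0 N = ≈-trans (*-congʳ {f} {inv f} {C * (1# + S)} truncate)
  (RingIdentities.geometric-inverse (truncated N) C f S (y ^ suc N) (geometric N y N)
    (≈[]-mono (ℕ.n≤1+n N) (order-^ y≥1 (suc N))))
  where
  open CommutativeRing (truncated N) using (*-congʳ) renaming (trans to ≈-trans)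
  C y S : Series
  C = constant (recip (f 1ₘ))
  y = 1# - C * f
  S = ∑[1⋯ N ] (y ^_)
  y≥1 : Order≥ 1 y
  y≥1 = order-1 (trans (cong (λ q → 1ℚ ℚ.- q) (trans (constant-* (recip (f 1ₘ)) f 1ₘ) (recip-inverse f₀≢0)))
                       (ℚ.+-inverseʳ 1ℚ))
  truncate : inv f ≈[ N ] C * (1# + S)
  truncate = below λ α α<N → at (≈[]-*-cong (suc (Vec.sum α)) {C} {C} {1# + ∑[1⋯ Vec.sum α ] (y ^_)} {1# + S}
    (below λ _ _ → refl)
    (below λ β β<α → cong (1# β ℚ.+_) (at (∑-truncate {y ^_} (λ n → order-^ y≥1 (suc n)) (ℕ.<⇒≤ α<N)) β β<α)))
    α ℕ.≤-refl

-- A factor without constant term gains one degree of precision, which makes up for the degree that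
-- a quotient by an indeterminate loses.
*-congˡ-order : ∀ {N a f g} → Order≥ 1 a → f ≈[ N ] g → a * f ≈[ suc N ] a * g
*-congˡ-order {N} {a} {f} {g} a≥1 (below f≈g) = ≈-trans (RingIdentities.split-difference (truncated (suc N)) a f g)
  (≈-trans (+-congˡ {a * g} {a * (f - g)} {0#} (order-* a≥1 f-g≥N)) (+-identityʳ (a * g)))
  where
  open CommutativeRing (truncated (suc N)) using (+-congˡ; +-identityʳ) renaming (trans to ≈-trans)
  f-g≥N : Order≥ N (f - g)
  f-g≥N = below λ α α<N → trans (cong (λ q → q ℚ.- g α) (f≈g α α<N)) (trans (ℚ.+-inverseʳ (g α)) (sym (0#≡0 α)))

shift : ∀ i α → updateAt α i suc ≡ zipWith ℕ._+_ (1ₘ [ i ]≔ 1) α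
shift 0F (a ∷ b ∷ c ∷ d ∷ e ∷ []) = refl
shift 1F (a ∷ b ∷ c ∷ d ∷ e ∷ []) = refl
shift 2F (a ∷ b ∷ c ∷ d ∷ e ∷ []) = refl
shift 3F (a ∷ b ∷ c ∷ d ∷ e ∷ []) = refl
shift 4F (a ∷ b ∷ c ∷ d ∷ e ∷ []) = refl

sum-shift : ∀ i α → Vec.sum (updateAt α i suc) ≡ suc (Vec.sum α)
sum-shift i α = trans (cong Vec.sum (shift i α))
  (trans (sum-zipWith-+ (1ₘ [ i ]≔ 1) α) (cong (ℕ._+ Vec.sum α) (degree-1 i)))
  where
  degree-1 : ∀ (i : Fin 5) → Vec.sum (1ₘ [ i ]≔ 1) ≡ 1
  degree-1 0F = refl
  degree-1 1F = refl
  degree-1 2F = refl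
  degree-1 3F = refl
  degree-1 4F = refl

var-/var : ∀ i f → (var i * f) /var i ≈ f
var-/var i f α = begin
  (var i * f) (updateAt α i suc)
    ≡⟨ cong (var i * f) (shift i α) ⟩
  (var i * f) (zipWith ℕ._+_ e α)
    ≡⟨ *-conv (var i) f (zipWith ℕ._+_ e α) ⟩
  ℚΣ.convᵛ (zipWith ℕ._+_ e α) (λ β γ → var i β ℚ.* f γ)
    ≡⟨ ℚΣ.convᵛ-single e α (λ {β} {γ} β≢e → trans (cong (ℚ._* f γ) (var-≢ β≢e)) (ℚ.*-zeroˡ (f γ))) ⟩
  var i e ℚ.* f α
    ≡⟨ cong (ℚ._* f α) var-e ⟩
  1ℚ ℚ.* f α
    ≡⟨ ℚ.*-identityˡ (f α) ⟩
  f α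
    ∎
  where
  open ≡.≡-Reasoning
  e : Monomial
  e = 1ₘ [ i ]≔ 1
  var-≢ : ∀ {β} → β ≢ e → var i β ≡ 0ℚ
  var-≢ {β} β≢e rewrite dec-false (Vec.≡-dec ℕ._≟_ β e) β≢e = refl
  var-e : var i e ≡ 1ℚ
  var-e rewrite dec-true (Vec.≡-dec ℕ._≟_ e e) refl = refl

/var-cong : ∀ {N f g} i → f ≈[ suc N ] g → f /var i ≈[ N ] g /var i
/var-cong {N} i (below f≈g) = below λ α α<N → f≈g (updateAt α i suc)
  (≡.subst (_< suc N) (sym (sum-shift i α)) (s≤s α<N))

/var-quotient : ∀ {N f g} i → f ≈[ suc N ] var i * g → f /var i ≈[ N ] g
/var-quotient {N} {f} {g} i f≈ig = below λ α α<N → trans (at (/var-cong i f≈ig) α α<N) (var-/var i g α)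

var-*-/var : ∀ {N f g} i → f ≈[ N ] var i * g → var i * (f /var i) ≈[ N ] f
var-*-/var {zero}  i f≈ig = below λ α ()
var-*-/var {suc N} {f} {g} i f≈ig = ≈-trans {var i * (f /var i)} {var i * g} {f}
  (*-congˡ-order {N} {var i} {f /var i} {g} (order-var i) (/var-quotient {N} {f} {g} i f≈ig)) (≈-sym f≈ig)
  where open CommutativeRing (truncated (suc N)) using () renaming (trans to ≈-trans; sym to ≈-sym)

-- The hypotheses range over all precisions since the quotient by `t` costs one degree: precision
-- `N` uses them at `suc N`, and the constant term of `g /var 0F` is read off at precision 2.
/ₜ-* : ∀ {f g f′ g′} → (∀ N → f ≈[ N ] t * f′) → (∀ N → g ≈[ N ] t * g′) → g′ 1ₘ ≢ 0ℚ →
  ∀ N → (f /ₜ g) * g′ ≈[ N ] f′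
/ₜ-* {f} {g} {f′} {g′} f≈tf′ g≈tg′ g′₀≢0 N = begin
  f /var 0F * inv (g /var 0F) * g′
    ≈⟨ *-congˡ {f /var 0F * inv (g /var 0F)} {g /var 0F} {g′} (/var-quotient {N} {g} {g′} 0F (g≈tg′ (suc N))) ⟨
  f /var 0F * inv (g /var 0F) * (g /var 0F)
    ≈⟨ *-assoc (f /var 0F) (inv (g /var 0F)) (g /var 0F) ⟩
  f /var 0F * (inv (g /var 0F) * (g /var 0F))
    ≈⟨ *-cong {f /var 0F} {f′} {inv (g /var 0F) * (g /var 0F)} {1#} (/var-quotient {N} {f} {f′} 0F (f≈tf′ (suc N)))
         (inv-inverse {g /var 0F} (λ g₀≡0 → g′₀≢0 (trans (sym (at (/var-quotient {1} {g} {g′} 0F (g≈tg′ 2)) 1ₘ z<s)) g₀≡0)) N) ⟩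
  f′ * 1#
    ≈⟨ *-identityʳ f′ ⟩
  f′
    ∎
  where
  open CommutativeRing (truncated N) using (setoid; *-congˡ; *-cong; *-assoc; *-identityʳ)
  open Relation.Binary.Reasoning.Setoid setoid

-- The generating function

p*q≢0 : ∀ {p q} → p ≢ 0ℚ → q ≢ 0ℚ → p ℚ.* q ≢ 0ℚ
p*q≢0 {p} {q} p≢0 q≢0 pq≡0 = q≢0 (begin
  q                          ≡⟨ ℚ.*-identityˡ q ⟨
  1ℚ ℚ.* q                   ≡⟨ cong (ℚ._* q) (recip-inverse p≢0) ⟨
  recip p ℚ.* p ℚ.* q        ≡⟨ ℚ.*-assoc (recip p) p q ⟩
  recip p ℚ.* (p ℚ.* q)      ≡⟨ cong (recip p ℚ.*_) pq≡0 ⟩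
  recip p ℚ.* 0ℚ             ≡⟨ ℚ.*-zeroʳ (recip p) ⟩
  0ℚ                         ∎)
  where open ≡.≡-Reasoning

*-unit : ∀ {f g} → f 1ₘ ≢ 0ℚ → g 1ₘ ≢ 0ℚ → (f * g) 1ₘ ≢ 0ℚ
*-unit {f} {g} f₀≢0 g₀≢0 eq = p*q≢0 f₀≢0 g₀≢0 (trans (sym (*-1ₘ f g)) eq)

^-unit : ∀ {f} n → f 1ₘ ≢ 0ℚ → (f ^ n) 1ₘ ≢ 0ℚ
^-unit {f} zero    f₀≢0 ()
^-unit {f} (suc n) f₀≢0 = *-unit {f} {f ^ n} f₀≢0 (^-unit {f} n f₀≢0)

1-f-unit : ∀ {f} → Order≥ 1 f → (1# - f) 1ₘ ≢ 0ℚ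
1-f-unit {f} f≥1 eq with () ← trans (cong (λ q → 1ℚ ℚ.- q) (sym (at f≥1 1ₘ z<s))) eq

f-1-unit : ∀ {f} → Order≥ 1 f → (f - 1#) 1ₘ ≢ 0ℚ
f-1-unit {f} f≥1 eq with () ← trans (cong (λ q → q ℚ.- 1ℚ) (sym (at f≥1 1ₘ z<s))) eq

order-∏ : ∀ {f} → (∀ i → Order≥ 1 (f (suc i))) → ∀ m → Order≥ m (∏[1⋯ m ] f)
order-∏ {f} f≥1 zero    = order-0 (∏[1⋯ 0 ] f)
order-∏ {f} f≥1 (suc m) = ≡.subst (λ k → Order≥ k (∏[1⋯ suc m ] f)) (ℕ.+-comm m 1)
  (order-* (order-∏ f≥1 m) (f≥1 m))

-- (rⁱ - 1) / t
h : ℕ → Series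
h zero    = 0#
h (suc i) = r * h i - 1#

t*h : ∀ i N → r ^ i - 1# ≈[ N ] t * h i
t*h zero    N = AssemblyIdentities.power-difference-zero (truncated N) t
t*h (suc i) N = AssemblyIdentities.power-difference-suc (truncated N) t (r ^ i) (h i) (t*h i N)

-- The constant term of `h i` is `- i`. Its sign suffices for invertibility and is inherited,
-- because `r` has constant term 1 and each step subtracts 1.
h-1ₘ≤0 : ∀ i → h i 1ₘ ℚ.≤ 0ℚ
h-1ₘ<0 : ∀ i → h (suc i) 1ₘ ℚ.< 0ℚ
h-1ₘ≤0 zero    = ℚ.≤-refl
h-1ₘ≤0 (suc i) = ℚ.<⇒≤ (h-1ₘ<0 i)
h-1ₘ<0 i = ≡.subst (ℚ._< 0ℚ)
  (cong (ℚ._- 1ℚ) (sym (trans (*-1ₘ r (h i)) (ℚ.*-identityˡ (h i 1ₘ)))))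
  (ℚ.≤-<-trans (ℚ.+-monoˡ-≤ (ℚ.- 1ℚ) (h-1ₘ≤0 i)) (ℚ.negative⁻¹ (ℚ.- 1ℚ)))

h-unit : ∀ i → h (suc i) 1ₘ ≢ 0ℚ
h-unit i = ℚ.<⇒≢ (h-1ₘ<0 i)

-- The quotients in the two products and in the denominator sum, apart from `u⁻¹`. They occur at
-- positive indices, where `h` has a nonzero constant term.
ρ σ : ℕ → Series
ρ i = (t * (1# - z) * r ^ (i ∸ 1) + r ^ i - 1#) /ₜ (r ^ i - 1#)
σ i = (t * (z - 1#) * r ^ (i ∸ 1)) /ₜ (r ^ i - 1#)

ρ*h : ∀ m N → ρ (suc m) * h (suc m) ≈[ N ] (1# - z) * r ^ m + h (suc m)
ρ*h m = /ₜ-* {f′ = (1# - z) * r ^ m + h (suc m)} {h (suc m)}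
  (λ N → AssemblyIdentities.ratio-numerator (truncated N) t z (r ^ m) (r ^ suc m) (h (suc m)) (t*h (suc m) N))
  (t*h (suc m)) (h-unit m)

σ*h : ∀ m N → σ (suc m) * h (suc m) ≈[ N ] (z - 1#) * r ^ m
σ*h m = /ₜ-* {f′ = (z - 1#) * r ^ m} {h (suc m)}
  (λ N → CommutativeRing.*-assoc (truncated N) t (z - 1#) (r ^ m)) (t*h (suc m)) (h-unit m)

-- The identity modulo a fixed total degree

module Truncation (N : ℕ) where
  R : CommutativeRing 0ℓ 0ℓ
  R = truncated (suc N)

  module R = CommutativeRing R
  module I = AssemblyIdentities R
  open Sums R using (sum<)
  open Algebra.Properties.CommutativeSemiring.Exp R.commutativeSemiring using () renaming (_^_ to _^ᴿ_)

  -- The two powers come from structures with the same product and unit but different equalities, so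
  -- they are identified by induction on the exponent.
  ^ᴿ≡^ : ∀ f n → f ^ᴿ n ≡ f ^ n
  ^ᴿ≡^ f zero    = refl
  ^ᴿ≡^ f (suc n) = cong (f *_) (^ᴿ≡^ f n)

  ∑≈sum< : ∀ n {f g} → (∀ i → f (suc i) ≈[ suc N ] g i) → ∑[1⋯ n ] f ≈[ suc N ] sum< n g
  ∑≈sum< zero    f≈g = R.refl
  ∑≈sum< (suc n) {f} {g} f≈g = R.+-cong {∑[1⋯ n ] f} {sum< n g} {f (suc n)} {g n} (∑≈sum< n f≈g) (f≈g n)

  nilpotent : ∀ {f} → Order≥ 1 f → f ^ᴿ suc N ≈[ suc N ] 0#
  nilpotent {f} f≥1 = ≡.subst (_≈[ suc N ] 0#) (sym (^ᴿ≡^ f (suc N))) (order-^ f≥1 (suc N))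

  s : Series
  s = t * inv (u⁻¹ - 1#)

  s[u⁻¹-1]≈t : s * (u⁻¹ - 1#) ≈[ suc N ] t
  s[u⁻¹-1]≈t = I.divide t (u⁻¹ - 1#) (inv (u⁻¹ - 1#)) (inv-inverse {u⁻¹ - 1#} (f-1-unit (order-var 1F)) (suc N))

  -- The bound on word lengths is `M = suc N`, so that `generating-function` has the range of
  -- `∑[1⋯ suc N ]`.
  s-nilpotent : s ^ᴿ suc (suc N) ≈[ suc N ] 0#
  s-nilpotent = ≡.subst (_≈[ suc N ] 0#) (sym (^ᴿ≡^ s (suc (suc N))))
    (≈[]-mono (ℕ.n≤1+n (suc N)) (order-^ {s} (order-*ˡ (inv (u⁻¹ - 1#)) (order-var 0F)) (suc (suc N))))

  module ES = EulerStirling R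
  increment : Series → Series → ℕ → Series
  increment = ES.increment u⁻¹ s t (suc N) s-nilpotent s[u⁻¹-1]≈t

  module _ {X : Series} (X≥1 : Order≥ 1 X) where
    open Standardization.GeneratingFunctions R X N (nilpotent X≥1) using (series)

    -- Positive order of `X` is the generality in which both `x` and the arguments `x * r ^ m` of
    -- `𝒯` are covered.
    𝒢-series : ∀ V Z → 𝒢 X V 1# Z ≈[ suc N ] series (increment V Z)
    𝒢-series V Z = R.trans {𝒢 X V 1# Z} {∑[1⋯ suc N ] term} {series (increment V Z)}
      (∑₁∞-truncate {term} (λ n → order-*ˡ {suc n} {t ^ suc n} (∑[ 𝔖 (suc n) ] summand) (order-^ (order-var 0F) (suc n))) (suc N))
      (R.trans {∑[1⋯ suc N ] term} {sum< (suc N) termᴿ} {series (increment V Z)} (∑≈sum< (suc N) {term} {termᴿ} term≈)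
        (ES.generating-function u⁻¹ s t (suc N) s-nilpotent s[u⁻¹-1]≈t X N (nilpotent X≥1) ι ι-inverse V Z))
      where
      open Sums R using (sumL; sumL-cong)
      ι : ℕ → Series
      ι n = inv ((u⁻¹ - 1#) ^ n * (1# - X) ^ n)
      ι-inverse : ∀ n → ι n * ((u⁻¹ - 1#) ^ᴿ n * (1# - X) ^ᴿ n) ≈[ suc N ] 1#
      ι-inverse n = ≡.subst (λ d → ι n * d ≈[ suc N ] 1#)
        (sym (cong₂ _*_ (^ᴿ≡^ (u⁻¹ - 1#) n) (^ᴿ≡^ (1# - X) n)))
        (inv-inverse {(u⁻¹ - 1#) ^ n * (1# - X) ^ n} (*-unit {(u⁻¹ - 1#) ^ n} {(1# - X) ^ n}
          (^-unit {u⁻¹ - 1#} n (f-1-unit (order-var 1F))) (^-unit {1# - X} n (1-f-unit X≥1))) (suc N))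
      summand summandᴿ : ∀ {n} → Permutation′ n → Series
      summand {n} π = u⁻¹ ^ (n ∸ des π) * X ^ ides π * 1# ^ lmin π * V ^ rmax π * Z ^ lmax π * ι n
      summandᴿ {n} π = u⁻¹ ^ᴿ (n ∸ des π) * X ^ᴿ ides π * 1# ^ᴿ lmin π * V ^ᴿ rmax π * Z ^ᴿ lmax π * ι n
      summand≡ : ∀ {n} (π : Permutation′ n) → summand π ≡ summandᴿ π
      summand≡ {n} π = sym (cong (_* ι n) (cong₂ _*_ (cong₂ _*_ (cong₂ _*_ (cong₂ _*_
        (^ᴿ≡^ u⁻¹ (n ∸ des π)) (^ᴿ≡^ X (ides π))) (^ᴿ≡^ 1# (lmin π))) (^ᴿ≡^ V (rmax π))) (^ᴿ≡^ Z (lmax π))))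
      term termᴿ : ℕ → Series
      term n = t ^ n * ∑[ 𝔖 n ] summand
      termᴿ m = t ^ᴿ suc m * sumL (𝔖 (suc m)) summandᴿ
      term≈ : ∀ m → term (suc m) ≈[ suc N ] termᴿ m
      term≈ m = R.*-cong {t ^ suc m} {t ^ᴿ suc m} {∑[ 𝔖 (suc m) ] summand} {sumL (𝔖 (suc m)) summandᴿ}
        (R.reflexive (sym (^ᴿ≡^ t (suc m))))
        (sumL-cong (𝔖 (suc m)) λ π → R.reflexive (summand≡ π))

  X : ℕ → Series
  X m = x * r ^ᴿ m

  X≥1 : ∀ m → Order≥ 1 (X m)
  X≥1 m = order-*ˡ (r ^ᴿ m) (order-var 2F)

  P : ℕ → Series
  P m = ∏[1⋯ m ] λ i → u⁻¹ * ρ i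

  P-order : ∀ m → Order≥ m (P m)
  P-order = order-∏ {λ i → u⁻¹ * ρ i} λ i → order-*ˡ (ρ (suc i)) (order-var 1F)

  U ι κ : ℕ → Series
  U m = u· (x * 𝒯 (suc m))
  ι m = inv (x * r ^ m - 1#)
  κ l = inv (1# - (1# - t * z) * (u⁻¹ * r ^ l))

  ι-inverse : ∀ m → ι m * (X m - 1#) ≈[ suc N ] 1#
  ι-inverse m = ≡.subst (λ q → ι m * (x * q - 1#) ≈[ suc N ] 1#) (sym (^ᴿ≡^ r m))
    (inv-inverse {x * r ^ m - 1#} (f-1-unit {x * r ^ m} (order-*ˡ (r ^ m) (order-var 2F))) (suc N))

  κ-inverse : ∀ l → κ l * (1# - (1# - t * z) * (u⁻¹ * r ^ᴿ l)) ≈[ suc N ] 1#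
  κ-inverse l = ≡.subst (λ q → κ l * (1# - (1# - t * z) * (u⁻¹ * q)) ≈[ suc N ] 1#) (sym (^ᴿ≡^ r l))
    (inv-inverse {1# - (1# - t * z) * (u⁻¹ * r ^ l)} (1-f-unit {(1# - t * z) * (u⁻¹ * r ^ l)}
      (order-*ʳ (1# - t * z) (order-*ˡ (r ^ l) (order-var 1F)))) (suc N))

  ρ-ratio : ∀ m → ρ (suc m) * (1# - r ^ᴿ suc m) ≈[ suc N ] 1# - (1# - t * z) * r ^ᴿ m
  ρ-ratio m = ≡.subst (λ q → ρ (suc m) * (1# - r * q) ≈[ suc N ] 1# - (1# - t * z) * q) (sym (^ᴿ≡^ r m))
    (I.ratio t z (r ^ m) (ρ (suc m)) (h (suc m)) (t*h (suc m) (suc N)) (ρ*h m (suc N)))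

  σ≈1-ρ : ∀ m → σ (suc m) ≈[ suc N ] 1# - ρ (suc m)
  σ≈1-ρ m = I.complementary z (r ^ m) (σ (suc m)) (ρ (suc m)) (h (suc m)) (inv (h (suc m)))
    (inv-inverse {h (suc m)} (h-unit m) (suc N)) (σ*h m (suc N)) (ρ*h m (suc N))

  seriesᵐ : ℕ → (ℕ → Series) → Series
  seriesᵐ m = Standardization.GeneratingFunctions.series R (X m) N (nilpotent (X≥1 m))

  x*𝒯-series : ∀ m → x * 𝒯 (suc m) ≈[ suc N ] X m * seriesᵐ m (increment v 1#)
  x*𝒯-series m = ≡.subst (λ q → x * (r ^ m * 𝒢 (x * r ^ m) v 1# 1#) ≈[ suc N ] x * q * seriesᵐ m (increment v 1#))
    (sym (^ᴿ≡^ r m))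
    (I.scale x (r ^ m) (𝒢 (x * r ^ m) v 1# 1#) (seriesᵐ m (increment v 1#))
      (≡.subst (λ q → 𝒢 (x * q) v 1# 1# ≈[ suc N ] seriesᵐ m (increment v 1#)) (^ᴿ≡^ r m) (𝒢-series (X≥1 m) v 1#)))

  -- Multiplication by `u⁻¹` undoes `u·` on multiples of `u⁻¹`; `series-increment-divisible`
  -- provides the cofactor.
  U-series : ∀ m → u⁻¹ * U m ≈[ suc N ] X m * seriesᵐ m (increment v 1#)
  U-series m = R.trans {u⁻¹ * U m} {x * 𝒯 (suc m)}
    (var-*-/var {suc N} {x * 𝒯 (suc m)} {quotient} 1F (R.trans {x * 𝒯 (suc m)} (x*𝒯-series m)
      (ES.series-increment-divisible u⁻¹ s t (suc N) s-nilpotent s[u⁻¹-1]≈t (X m) N (nilpotent (X≥1 m)) v)))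
    (x*𝒯-series m)
    where
    quotient : Series
    quotient = X m * seriesᵐ m λ l → s * v * 1# * (Words.WordSeries.E R u⁻¹ s (suc N) s-nilpotent 1# 1# (suc l)
      * ES.B/w u⁻¹ s t (suc N) s-nilpotent s[u⁻¹-1]≈t v l)

  numerator denominator : ℕ → Series
  numerator n = z * t * v * r ^ (n ∸ 1) * (1# + u· (x * 𝒯 n)) * (u⁻¹ * inv (x * r ^ (n ∸ 1) - 1#)) * P (n ∸ 1)
  denominator n = u⁻¹ * σ n * P (n ∸ 1)

  -- Convergence is in powers of `u⁻¹`: one from each factor of the product and one from the factor
  -- in front of it.
  numerator-order : ∀ m → Order≥ (suc m) (numerator (suc m))
  numerator-order m = order-* {1} {m}
    (order-*ʳ (z * t * v * r ^ m * (1# + u· (x * 𝒯 (suc m)))) (order-*ˡ (ι m) (order-var 1F))) (P-order m)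

  denominator-order : ∀ m → Order≥ (suc m) (denominator (suc m))
  denominator-order m = order-* {1} {m} (order-*ˡ (σ (suc m)) (order-var 1F)) (P-order m)

  numeratorᴿ denominatorᴿ : ℕ → Series
  numeratorᴿ m = z * t * v * r ^ᴿ m * (1# + U m) * (u⁻¹ * ι m) * P m
  denominatorᴿ m = u⁻¹ * σ (suc m) * P m

  theorem4-truncated : 𝒢 x v 1# z ≈[ suc N ] ∑₁∞ numerator * inv (1# - ∑₁∞ denominator)
  theorem4-truncated = I.conclude (𝒢 x v 1# z) _ (1# - ∑₁∞ denominator) (1# - sum< (suc N) denominatorᴿ)
    (∑₁∞ numerator) (sum< (suc N) numeratorᴿ) (inv (1# - ∑₁∞ denominator))
    (𝒢-series (order-var 2F) v z)
    (I.subtract (∑₁∞ denominator) (sum< (suc N) denominatorᴿ)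
      (R.trans {∑₁∞ denominator} {∑[1⋯ suc N ] denominator}
        (∑₁∞-truncate {denominator} denominator-order (suc N))
        (∑≈sum< (suc N) {denominator} {denominatorᴿ} (λ _ → R.refl))))
    (R.trans {∑₁∞ numerator} {∑[1⋯ suc N ] numerator}
      (∑₁∞-truncate {numerator} numerator-order (suc N))
      (∑≈sum< (suc N) {numerator} {numeratorᴿ} λ m → R.reflexive
        (cong (λ q → z * t * v * q * (1# + U m) * (u⁻¹ * ι m) * P m) (sym (^ᴿ≡^ r m)))))
    -- At the monomial 1 the sum `∑₁∞` is empty, so the constant term evaluates to 1.
    (inv-inverse {1# - ∑₁∞ denominator} (λ ()) (suc N))
    (ES.Quotient.quotient u⁻¹ s t (suc N) s-nilpotent s[u⁻¹-1]≈t x v z N (suc N) (λ m → nilpotent (X≥1 m))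
      (λ m → ρ (suc m)) (λ m → σ (suc m)) P R.refl (λ m → R.refl) (P-order (suc N)) ρ-ratio σ≈1-ρ κ κ-inverse
      (nilpotent (order-var 2F)) U ι ι-inverse U-series)

theorem4 : 𝒢 x v 1# z
    ≈ (∑₁∞ λ n →
    z * t * v * r ^ (n ∸ 1) * (1# + u· (x * 𝒯 n))
    * (u⁻¹ * inv (x * r ^ (n ∸ 1) - 1#))
    * ∏[1⋯ n ∸ 1 ] λ i →
    u⁻¹ * ((t * (1# - z) * r ^ (i ∸ 1) + r ^ i - 1#) /ₜ (r ^ i - 1#)))
    * inv (1# - (∑₁∞ λ n →
    u⁻¹ * ((t * (z - 1#) * r ^ (n ∸ 1)) /ₜ (r ^ n - 1#))
    * ∏[1⋯ n ∸ 1 ] λ i →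
    u⁻¹ * ((t * (1# - z) * r ^ (i ∸ 1) + r ^ i - 1#) /ₜ (r ^ i - 1#))))
-- `Truncation N` works below degree `suc N`, so the degree of `α` itself is a sufficient choice of
-- `N`.
theorem4 α = at (Truncation.theorem4-truncated (Vec.sum α)) α ℕ.≤-refl
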